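{- Let $k\geq 2$ be an integer. Then \[ \mathrm{ex}(n,C_{2k},\textnormal{rainbow- }C_{2k})= \begin{cases} \Theta(n^{k-1}) & \text{if } k\geq 3,\\ \Theta(n^{2}) & \text{if } k=2. \end{cases} \]
   Context: A proper edge-colouring of a graph assigns colours to edges so that any two edges sharing a vertex receive different colours. A subgraph of an edge-coloured graph is rainbow if all its edges have distinct colours. $\mathrm{ex}(n,H,\textnormal{rainbow- }F)$ denotes the maximum number of copies of $H$ in a properly edge-coloured graph on $n$ vertices containing no rainbow subgraph isomorphic to $F$. $C_m$ denotes the cycle of length $m$. Implied constants may depend on $k$. -}

module Defs where

open import Data.Nat using (ℕ; zero; suc; _+_; _*_; _∸_; _^_; _≤_; _<_)
open import Data.Nat.DivMod using (_mod_; _/_)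
open import Data.Fin using (Fin; toℕ)
open import Data.Fin.Properties using (all?; _≟_)
open import Data.Maybe using (Maybe; just; nothing; is-just)
open import Data.Bool using (T)
open import Data.List using (List; []; _∷_; [_]; map; concatMap; allFin; filter; length)
open import Data.Vec using (Vec; lookup)
import Data.Vec as Vec
open import Data.Product using (Σ; ∃; _×_)
open import Data.Unit using (⊤)
open import Relation.Nullary using (¬_; Dec)
open import Relation.Nullary.Decidable using (_→-dec_; _×-dec_; T?)
open import Relation.Binary.PropositionalEquality using (_≡_; _≢_)

-- An edge-coloured graph on vertex set Fin n: c u v = just a means uv is an
-- edge of colour a; c u v = nothing means uv is not an edge.
Colouring : ℕ → Set
Colouring n = Fin n → Fin n → Maybe ℕ

ProperColouring : ∀ {n} → Colouring n → Set
ProperColouring {n} c =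
  (∀ u v → c u v ≡ c v u) ×
  (∀ u → c u u ≡ nothing) ×
  (∀ u v w a → c u v ≡ just a → c u w ≡ just a → v ≡ w)

Adj : ∀ {n} → Colouring n → Fin n → Fin n → Set
Adj c u v = T (is-just (c u v))

cyc : ∀ {l} → Fin (suc l) → Fin (suc l)
cyc {l} i = suc (toℕ i) mod (suc l)

-- f : Fin (suc l) → Fin n is an embedding of the cycle C_{suc l}
-- (vertices f 0, f 1, ..., f l in cyclic order, edges f i f (i+1 mod (l+1)))
IsCycle : ∀ {n} (c : Colouring n) (l : ℕ) → (Fin (suc l) → Fin n) → Set
IsCycle c l f = (∀ i j → f i ≡ f j → i ≡ j) × (∀ i → Adj c (f i) (f (cyc i)))

isCycle? : ∀ {n} (c : Colouring n) (l : ℕ) (f : Fin (suc l) → Fin n) → Dec (IsCycle c l f)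
isCycle? c l f =
  all? (λ i → all? (λ j → (f i ≟ f j) →-dec (i ≟ j)))
  ×-dec all? (λ i → T? (is-just (c (f i) (f (cyc i)))))

IsRainbowCycle : ∀ {n} (c : Colouring n) (l : ℕ) → (Fin (suc l) → Fin n) → Set
IsRainbowCycle c l f =
  IsCycle c l f × (∀ i j → c (f i) (f (cyc i)) ≡ c (f j) (f (cyc j)) → i ≡ j)

HasRainbowCycle : ∀ {n} → Colouring n → ℕ → Set
HasRainbowCycle c l = ∃ λ f → IsRainbowCycle c l f

allVecs : ∀ m n → List (Vec (Fin n) m)
allVecs zero n = [ Vec.[] ]
allVecs (suc m) n = concatMap (λ v → map (λ x → x Vec.∷ v) (allFin n)) (allVecs m n)

numCycleEmbeddings : ∀ {n} → Colouring n → ℕ → ℕ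
numCycleEmbeddings {n} c l =
  length (filter (λ v → isCycle? c l (lookup v)) (allVecs (suc l) n))

-- number of copies (subgraphs isomorphic to) C_{suc l}:
-- embeddings divided by |Aut(C_{suc l})| = 2 (suc l)   (for suc l ≥ 3)
copiesOfCycle : ∀ {n} → Colouring n → ℕ → ℕ
copiesOfCycle c l = numCycleEmbeddings c l / (2 * suc l)

-- ex(n, C_m, rainbow-C_m) = Θ(n^d)  with m = suc l, constants depending only on l, d:
-- upper bound: every proper colouring without rainbow C_m has ≤ C n^d copies of C_m;
-- lower bound: some proper colouring without rainbow C_m has ≥ (1/a) n^d copies.
ExCycleTheta : ℕ → ℕ → Set
ExCycleTheta l d =
  Σ ℕ λ C → Σ ℕ λ a → Σ ℕ λ n₀ →
    (∀ n → n₀ ≤ n → (c : Colouring n) → ProperColouring c →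
       ¬ HasRainbowCycle c l → copiesOfCycle c l ≤ C * n ^ d) ×
    (∀ n → n₀ ≤ n → Σ (Colouring n) λ c → ProperColouring c ×
       ¬ HasRainbowCycle c l × n ^ d ≤ a * copiesOfCycle c l)

{-# OPTIONS --safe #-}
module Submission where

-- Upper bounds.  A finite family either has a subfamily whose members can all be varied in many ways in prescribed
-- directions, or can be labelled so that every member is determined, up to boundedly many choices, by a part of it
-- (peeling).  For the two-paths p v x from a fixed vertex p the first alternative yields a rainbow C_2k that returns to
-- N(p) at every second step.  Hence there are O(n) two-paths from p, and each two-path p v x is thin (p and x leave
-- boundedly many choices for v) or thick (p and v determine x, x and v determine p, and p, x have many common
-- neighbours).  Peeling the rainbow hexagons with thin corners shows that there are O(n²) three-paths, so there are
-- O(n^(k-1)) paths on 2k - 2 vertices.  A 2k-cycle is determined by 2k - 2 consecutive vertices if it has a thick corner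
-- such that the second next corner is thin, or if it has no thick corner and repeats a colour.  Otherwise every second
-- corner is thick, and exchanging these corners one after another produces a rainbow cycle.
--
-- Lower bounds.  For k ≥ 3, blow up k - 1 independent vertices of C_2k such that two edges survive, and give these two
-- edges the same colour; every 2k-cycle winds around once.  For k = 2, join points of (Z/p)² whose sum or difference
-- lies on one of two halves of the parabola (x, x²), which is a Sidon set, so that four-cycles alternate between the
-- two kinds of edges and repeat colours; a Chebyshev estimate supplies a prime p of order √n.

open import Defs
open import Data.Nat using (ℕ; _≤_; _*_; _∸_)
open import Data.Product using (_×_)
open import Relation.Binary.PropositionalEquality using (_≡_)
open import Data.Nat as ℕ using (zero; suc; _+_; _^_; _<_; z≤n; s≤s; _≤?_; _<?_; pred; _!; NonZero)
open import Data.Nat.Properties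
open import Data.Nat.DivMod as DivMod using (_mod_; _%_; _/_; m%n<n; m%n%n≡m%n; m<n⇒m%n≡m; n%n≡0; m≡m%n+[m/n]*n; m/n≤m; %-distribˡ-+; [m+n]%n≡m%n; [m+kn]%n≡m%n)
open import Data.Nat.Divisibility using (_∣_; divides; _∣?_; ∣⇒≤; ∣-refl; ∣-trans; ∣m+n∣m⇒∣n; m∣m*n; n∣m*n; *-pres-∣; 1∣_; m≤n⇒m!∣n!)
open import Data.Nat.ListAction using (product)
open import Data.Nat.Primality using (Prime; prime?; ¬prime[0]; ¬prime[1]; prime⇒nonZero; euclidsLemma)
open import Data.Nat.Primality.Factorisation using (factorise; module PrimeFactorisation)
open import Data.Nat.Tactic.RingSolver using (solve-∀)
open import Data.Integer using (ℤ; ∣_∣) renaming (+_ to ι; -_ to ⊝_; _+_ to _⊕_; _-_ to _⊖_; _*_ to _⊗_)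
import Data.Integer.Properties as ℤₚ
import Data.Integer.Tactic.RingSolver as ℤ-Solver
open import Data.Bool using (Bool; true; false; T)
open import Data.Fin using (Fin; zero; suc; toℕ; fromℕ; fromℕ<; inject₁; inject≤; combine; remQuot)
open import Data.Fin.Patterns using (0F; 1F; 2F; 3F; 4F; 5F)
import Data.Fin.Properties as Finₚ
open import Data.Fin.Relation.Unary.Top using (view; ‵fromℕ; ‵inject₁)
open import Data.Maybe using (Maybe; just; nothing; is-just)
import Data.Maybe.Properties as Maybeₚ
open import Data.List using (List; []; _∷_; _++_; map; filter; length; lookup; deduplicate; allFin; applyUpTo; cartesianProduct; concatMap)
open import Data.List.Properties using (length-map; length-++; length-tabulate; length-applyUpTo; filter-notAll)
open import Data.List.Relation.Unary.All as All using (All; []; _∷_)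
import Data.List.Relation.Unary.All.Properties as Allₚ
open import Data.List.Relation.Unary.Any as Any using (Any; here; there)
import Data.List.Relation.Unary.Any.Properties as Anyₚ
open import Data.List.Relation.Unary.AllPairs as AllPairs using (AllPairs; []; _∷_)
import Data.List.Relation.Unary.AllPairs.Properties as AllPairsₚ
open import Data.List.Relation.Unary.Unique.Propositional using (Unique)
import Data.List.Relation.Unary.Unique.Propositional.Properties as Uniqueₚ
import Data.List.Relation.Unary.Unique.DecPropositional.Properties as DecUnique
open import Data.List.Membership.Propositional using (_∈_; _∉_)
open import Data.List.Membership.Propositional.Properties
open import Data.Vec as Vec using (Vec; []; _∷_; toList)
import Data.Vec.Properties as Vecₚ
import Data.Vec.Membership.Propositional.Properties as Vec∈ₚ
open import Data.Product as Product using (Σ; ∃; _,_; proj₁; proj₂)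
open import Data.Product.Properties using (≡-dec)
open import Data.Sum using (_⊎_; inj₁; inj₂; [_,_]′)
open import Data.Empty using (⊥; ⊥-elim)
open import Data.Unit using (⊤; tt)
import Data.Unit.Properties as ⊤ₚ
open import Function using (_∘_; id; case_of_)
open import Relation.Nullary using (¬_; Dec; yes; no; contradiction; ¬?)
open import Relation.Nullary.Decidable using (_×-dec_; _⊎-dec_; _→-dec_; T?; from-yes; decidable-stable)
open import Relation.Unary using (Decidable)
open import Relation.Binary.Definitions using (DecidableEquality; tri<; tri≈; tri>)
open import Relation.Binary.PropositionalEquality using (refl; sym; trans; cong; cong₂; subst; subst₂; _≢_; module ≡-Reasoning)

-- What shapes the peeling is properness. Forbidding a vertex, or a colour on an edge with one end
-- fixed, removes boundedly many choices; forbidding a colour on an edge both of whose ends move,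
-- such as the middle edge of a three-path between fixed ends, may remove nearly all of them. So
-- each direction carries a key, which stays, and a colour: a member can be varied if its colour
-- admits many members or its key admits many colours. The bound on rainbow hexagons is linear in
-- the number t of thin three-paths, not in n. It becomes absolute because pairs of parallel thin
-- paths number at most a constant times t, so a positive proportion of the paths has end points
-- joined by few of them. The exponent k - 1 comes from covering 2k - 2 consecutive vertices by one
-- three-path, at cost n², and k - 3 two-paths, at cost n each. For k = 2 this is too short:
-- opposite vertices cost n² and have boundedly many common neighbours, while blowing up one vertex
-- gives only linearly many transversal cycles, whence the algebraic graph.

-- Counting with lists without repetition

-- Counting by lists without repetition needs neither a decision procedure for P nor an enumeration of A.
record AtMost {A : Set} (N : ℕ) (P : A → Set) : Set where
  field
    bound : ∀ xs → Unique xs → All P xs → length xs ≤ N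

open AtMost

module _ {A : Set} where

  atMost-⊆ : ∀ {N} {P Q : A → Set} → (∀ {x} → P x → Q x) → AtMost N Q → AtMost N P
  bound (atMost-⊆ f q) xs u ps = bound q xs u (All.map f ps)

  atMost-≤ : ∀ {M N} {P : A → Set} → M ≤ N → AtMost M P → AtMost N P
  bound (atMost-≤ m≤n p) xs u ps = ≤-trans (bound p xs u ps) m≤n

  atMost-∅ : ∀ {P : A → Set} → (∀ {x} → ¬ P x) → AtMost 0 P
  bound (atMost-∅ f) [] u ps = z≤n
  bound (atMost-∅ f) (x ∷ xs) u (p ∷ ps) = ⊥-elim (f p)

  atMost-1 : ∀ {P : A → Set} → (∀ {x y} → P x → P y → x ≡ y) → AtMost 1 P
  bound (atMost-1 f) [] u ps = z≤n
  bound (atMost-1 f) (x ∷ []) u ps = s≤s z≤n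
  bound (atMost-1 f) (x ∷ y ∷ xs) ((x≢y ∷ _) ∷ _) (p ∷ q ∷ _) = ⊥-elim (x≢y (f p q))

  -- Only the empty list offers no member, and it satisfies every bound. A bound may therefore be
  -- proved with a reference member in hand, as in `fixFirstColour`.
  atMost-inhabited : ∀ {N} {P : A → Set} → (∀ x → P x → AtMost N P) → AtMost N P
  bound (atMost-inhabited f) [] u ps = z≤n
  bound (atMost-inhabited f) (x ∷ xs) u (p ∷ ps) = bound (f x p) (x ∷ xs) u (p ∷ ps)

  atMost-⊎ : ∀ {M N} {P Q R : A → Set} → (∀ {x} → P x → Q x ⊎ R x) →
             AtMost M Q → AtMost N R → AtMost (M + N) P
  bound (atMost-⊎ {M} {N} {P} {Q} {R} f q r) xs u ps with split xs u ps
    where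
    -- The last component carries the freshness of each head over to both halves, which keeps them
    -- free of repetitions.
    split : ∀ xs → Unique xs → All P xs → Σ (List A) λ ys → Σ (List A) λ zs →
      (Unique ys × All Q ys) × (Unique zs × All R zs) × length xs ≡ length ys + length zs ×
      (∀ {B : A → Set} → All B xs → All B ys × All B zs)
    split [] u ps = [] , [] , ([] , []) , ([] , []) , refl , λ _ → [] , []
    split (x ∷ xs) (x∉ ∷ u) (p ∷ ps) with split xs u ps | f p
    ... | ys , zs , (uy , qy) , (uz , rz) , eq , sub | inj₁ qx =
      x ∷ ys , zs , (proj₁ (sub x∉) ∷ uy , qx ∷ qy) , (uz , rz) , cong suc eq ,
      λ { (b ∷ bs) → b ∷ proj₁ (sub bs) , proj₂ (sub bs) }
    ... | ys , zs , (uy , qy) , (uz , rz) , eq , sub | inj₂ rx =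
      ys , x ∷ zs , (uy , qy) , (proj₂ (sub x∉) ∷ uz , rx ∷ rz) ,
      trans (cong suc eq) (sym (+-suc (length ys) (length zs))) ,
      λ { (b ∷ bs) → proj₁ (sub bs) , b ∷ proj₂ (sub bs) }
  ... | ys , zs , (uy , qy) , (uz , rz) , eq , _ =
    subst (_≤ M + N) (sym eq) (+-mono-≤ (bound q ys uy qy) (bound r zs uz rz))

  atMost-∪ : ∀ {M N} {P Q R : A → Set} → AtMost M (λ x → P x × Q x) → AtMost N (λ x → P x × R x) →
             AtMost (M + N) (λ x → P x × (Q x ⊎ R x))
  atMost-∪ = atMost-⊎ λ { (p , inj₁ q) → inj₁ (p , q) ; (p , inj₂ r) → inj₂ (p , r) }

  atMost-⋃ : ∀ {N} m {P : Fin m → A → Set} → (∀ i → AtMost N (P i)) → AtMost (m * N) (λ x → ∃ λ i → P i x)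
  atMost-⋃ zero f = atMost-∅ λ ()
  atMost-⋃ (suc m) f = atMost-⊎ (λ { (zero , p) → inj₁ p ; (suc i , p) → inj₂ (i , p) }) (f zero) (atMost-⋃ m (f ∘ suc))

  length-filter-split : ∀ {P : A → Set} (P? : Decidable P) xs →
    length (filter P? xs) + length (filter (¬? ∘ P?) xs) ≡ length xs
  length-filter-split P? [] = refl
  length-filter-split P? (x ∷ xs) with P? x
  ... | yes _ = cong suc (length-filter-split P? xs)
  ... | no _ = trans (+-suc _ _) (cong suc (length-filter-split P? xs))

  filter-All : ∀ {P Q : A → Set} (P? : Decidable P) {xs} → All Q xs → All (λ x → Q x × P x) (filter P? xs)
  filter-All P? {xs} qs = All.zip (Allₚ.filter⁺ P? qs , Allₚ.all-filter P? xs)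

  unique-lookup : ∀ {xs : List A} → Unique xs → ∀ i j → lookup xs i ≡ lookup xs j → i ≡ j
  unique-lookup (_ ∷ _) zero zero e = refl
  unique-lookup (x∉ ∷ _) zero (suc j) e = contradiction e (All.lookup x∉ (∈-lookup j))
  unique-lookup (x∉ ∷ _) (suc i) zero e = contradiction (sym e) (All.lookup x∉ (∈-lookup i))
  unique-lookup (_ ∷ u) (suc i) (suc j) e = cong suc (unique-lookup u i j e)

  unique-⊆-length : ∀ {xs ys : List A} → Unique xs → (∀ {x} → x ∈ xs → x ∈ ys) → length xs ≤ length ys
  unique-⊆-length {xs} {ys} u sub = Finₚ.injective⇒≤ {f = f} inj
    where
    f : Fin (length xs) → Fin (length ys)
    f i = Any.index (sub (∈-lookup i))
    eq : ∀ i → lookup ys (f i) ≡ lookup xs i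
    eq i = sym (Anyₚ.lookup-index (sub (∈-lookup i)))
    inj : ∀ {i j} → f i ≡ f j → i ≡ j
    inj {i} {j} e = unique-lookup u i j (trans (sym (eq i)) (trans (cong (lookup ys) e) (eq j)))

  atMost-list : ∀ {P : A → Set} (ys : List A) → (∀ {x} → P x → x ∈ ys) → AtMost (length ys) P
  bound (atMost-list ys sub) xs u ps = unique-⊆-length u (λ x∈ → sub (All.lookup ps x∈))

atMost-Fin : ∀ {n} → AtMost n (λ (_ : Fin n) → ⊤)
atMost-Fin {n} = subst (λ m → AtMost m (λ (_ : Fin n) → ⊤)) (length-tabulate id) (atMost-list (allFin n) (λ {x} _ → ∈-allFin x))

module _ {A B : Set} (_≟_ : DecidableEquality B) where

  atMost-fibre : ∀ {M K} {P : A → Set} {Q : B → Set} (g : A → B) → (∀ {x} → P x → Q (g x)) →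
    AtMost M Q → (∀ y → Q y → AtMost K (λ x → P x × g x ≡ y)) → AtMost (M * K) P
  bound (atMost-fibre {M} {K} {P} {Q} g pq q fib) xs u ps =
    ≤-trans (cover ys xs u ps (All.tabulate λ x∈ → ∈-deduplicate⁺ _≟_ (∈-map⁺ g x∈)) qs)
            (*-monoˡ-≤ K (bound q ys (DecUnique.deduplicate-! _≟_ (map g xs)) qs))
    where
    ys = deduplicate _≟_ (map g xs)
    qs : All Q ys
    qs = All.tabulate λ y∈ → case ∈-map⁻ g (∈-deduplicate⁻ _≟_ (map g xs) y∈) of λ
      { (x , x∈ , refl) → pq (All.lookup ps x∈) }
    cover : ∀ ys xs → Unique xs → All P xs → All (λ x → g x ∈ ys) xs → All Q ys → length xs ≤ length ys * K
    cover [] [] u ps gs qs = z≤n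
    cover [] (x ∷ xs) u ps (() ∷ gs) qs
    cover (y ∷ ys) xs u ps gs (qy ∷ qs) = subst (_≤ K + length ys * K) (length-filter-split P? xs)
      (+-mono-≤ (bound (fib y qy) (filter P? xs) (Uniqueₚ.filter⁺ P? u) (filter-All P? ps))
                (cover ys (filter (¬? ∘ P?) xs) (Uniqueₚ.filter⁺ (¬? ∘ P?) u) (Allₚ.filter⁺ (¬? ∘ P?) ps)
                  (All.map (λ { (here e , ne) → contradiction e ne ; (there m , _) → m }) (filter-All (¬? ∘ P?) gs)) qs))
      where
      P? : Decidable (λ x → g x ≡ y)
      P? x = g x ≟ y

  atMost-map∈ : ∀ {K} {P : A → Set} (g : A → B) (F : List B) →
    (∀ y → AtMost K (λ x → P x × g x ≡ y)) → AtMost (length F * K) (λ x → P x × g x ∈ F)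
  atMost-map∈ g F fib = atMost-fibre g proj₂ (atMost-list F id)
    (λ y _ → atMost-⊆ (λ { ((p , _) , e) → p , e }) (fib y))

  atMost-injective : ∀ {N} {P : A → Set} {Q : B → Set} (g : A → B) → (∀ {x} → P x → Q (g x)) →
    (∀ {x y} → P x → P y → g x ≡ g y → x ≡ y) → AtMost N Q → AtMost N P
  atMost-injective {N} {P} {Q} g pq inj q =
    subst (λ m → AtMost m P) (*-identityʳ N)
      (atMost-fibre g pq q (λ y _ → atMost-1 λ { (p , e) (p′ , e′) → inj p p′ (trans e (sym e′)) }))

-- Double counting: each x contributes at least C pairs, and pairs that come from different x are
-- different.
atMost-pairs : {A B : Set} {C : ℕ} {P : A → Set} {D : A × B → Set} (g : A → List B) →
  (∀ {x} → P x → Unique (g x) × C ≤ length (g x) × (∀ {y} → y ∈ g x → D (x , y))) →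
  ∀ {N} → AtMost N D → ∀ xs → Unique xs → All P xs → C * length xs ≤ N
atMost-pairs {A} {B} {C} {P} {D} g h d xs u ps = ≤-trans (len xs ps) (bound d (pairs xs) (uniq xs u ps) (All.tabulate (allD xs ps)))
  where
  pairs : List A → List (A × B)
  pairs = concatMap (λ x → map (x ,_) (g x))
  proj∈ : ∀ xs {z} → z ∈ pairs xs → proj₁ z ∈ xs × proj₂ z ∈ g (proj₁ z)
  proj∈ (x ∷ xs) z∈ with ∈-++⁻ (map (x ,_) (g x)) z∈
  ... | inj₁ m with ∈-map⁻ (x ,_) m
  ... | y , y∈ , refl = here refl , y∈
  proj∈ (x ∷ xs) z∈ | inj₂ m with proj∈ xs m
  ... | a , b = there a , b
  allD : ∀ xs → All P xs → ∀ {z} → z ∈ pairs xs → D z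
  allD xs ps z∈ with proj∈ xs z∈
  ... | a , b = proj₂ (proj₂ (h (All.lookup ps a))) b
  uniq : ∀ xs → Unique xs → All P xs → Unique (pairs xs)
  uniq [] u ps = []
  uniq (x ∷ xs) (x∉ ∷ u) (p ∷ ps) = Uniqueₚ.++⁺ (Uniqueₚ.map⁺ (λ { refl → refl }) (proj₁ (h p))) (uniq xs u ps)
    λ { (m₁ , m₂) → case ∈-map⁻ (x ,_) m₁ of λ { (y , _ , refl) → All.lookup x∉ (proj₁ (proj∈ xs m₂)) refl } }
  len : ∀ xs → All P xs → C * length xs ≤ length (pairs xs)
  len [] ps = ≤-reflexive (*-zeroʳ C)
  len (x ∷ xs) (p ∷ ps) = begin
    C * suc (length xs)                             ≡⟨ *-suc C (length xs) ⟩
    C + C * length xs                               ≤⟨ +-mono-≤ (proj₁ (proj₂ (h p))) (len xs ps) ⟩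
    length (g x) + length (pairs xs)                ≡⟨ cong (_+ length (pairs xs)) (sym (length-map (x ,_) (g x))) ⟩
    length (map (x ,_) (g x)) + length (pairs xs)   ≡⟨ sym (length-++ (map (x ,_) (g x))) ⟩
    length (pairs (x ∷ xs))                         ∎
    where open ≤-Reasoning

pick : {A : Set} {N : ℕ} {P Q : A → Set} → Decidable Q → AtMost N (λ x → P x × Q x) →
       ∀ xs → Unique xs → All P xs → N < length xs → ∃ λ x → x ∈ xs × ¬ Q x
pick {A} {N} {P} {Q} Q? q xs u ps lt with Any.any? (¬? ∘ Q?) xs
... | yes e = Any.lookup e , ∈-lookup (Any.index e) , Anyₚ.lookup-result e
... | no ne = contradiction (bound q xs u (All.zip (ps , All.map (λ {x} nn → dn (Q? x) nn) (Allₚ.¬Any⇒All¬ xs ne)))) (<⇒≱ lt)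
  where
  dn : ∀ {X : Set} → Dec X → ¬ ¬ X → X
  dn (yes x) _ = x
  dn (no nx) nnx = contradiction nx nnx

-- Peeling a finite family

-- A move in direction j replaces a member by another one with the same `key j`. The colour `col j`
-- belongs to an edge that the move alters and that cannot be controlled by excluding boundedly many
-- members.
module Peeling {A K C : Set} {r : ℕ} (_≟ₖ_ : DecidableEquality K) (_≟ᶜ_ : DecidableEquality C)
  (key : Fin (suc r) → A → K) (col : Fin (suc r) → A → C) (M R : ℕ) where

  Mate Class : Fin (suc r) → A → A → Set
  Mate j a z = key j z ≡ key j a
  Class j a z = key j z ≡ key j a × col j z ≡ col j a

  mate? : ∀ j a → Decidable (Mate j a)
  mate? j a z = key j z ≟ₖ key j a

  class? : ∀ j a → Decidable (Class j a)
  class? j a z = (key j z ≟ₖ key j a) ×-dec (col j z ≟ᶜ col j a)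

  cols : Fin (suc r) → A → List A → List C
  cols j a xs = deduplicate _≟ᶜ_ (map (col j) (filter (mate? j a) xs))

  Free : Fin (suc r) → A → List A → Set
  Free j a xs = M < length (filter (class? j a) xs) ⊎ R < length (cols j a xs)

  free? : ∀ j a xs → Dec (Free j a xs)
  free? j a xs = (M <? _) ⊎-dec (R <? _)

  Closed : List A → Set
  Closed xs = ∀ {a} → a ∈ xs → ∀ j → Free j a xs

  Core : List A → Set
  Core xs = Σ (List A) λ ys → (∃ λ a → a ∈ ys) × Closed ys × Unique ys × (∀ {z} → z ∈ ys → z ∈ xs)

  Labelled : List A → (A → Fin (suc r)) → Fin (suc r) → K → A → Set
  Labelled xs label j k z = z ∈ xs × label z ≡ j × key j z ≡ k

  -- The second half is the stronger induction hypothesis. The bound `R * M` alone would grow by M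
  -- with each class removed from the same key, whereas a cover Φ of the colours loses one colour
  -- with each such class.
  Bounded : List A → (A → Fin (suc r)) → Set
  Bounded xs label = ∀ j k → AtMost (R * M) (Labelled xs label j k) ×
    (∀ Φ → (∀ {z} → z ∈ xs → key j z ≡ k → col j z ∈ Φ) → AtMost (length Φ * M) (Labelled xs label j k))

  private
    remove : ∀ c (Φ : List C) → c ∈ Φ → suc (length (filter (¬? ∘ (c ≟ᶜ_)) Φ)) ≤ length Φ
    remove c Φ c∈ = filter-notAll (¬? ∘ (c ≟ᶜ_)) Φ (Any.map (λ e ne → ne e) c∈)

    step : ∀ xs → Unique xs → ∀ a j → a ∈ xs → ¬ Free j a xs →
      ∀ label′ → Bounded (filter (¬? ∘ class? j a) xs) label′ → Σ (A → Fin (suc r)) (Bounded xs)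
    step xs u a j a∈ stuck label′ bounded′ = label , bounded
      where
      ys = filter (¬? ∘ class? j a) xs
      label : A → Fin (suc r)
      label z with class? j a z
      ... | yes _ = j
      ... | no _ = label′ z
      Q : Fin (suc r) → K → A → Set
      Q j′ k z = (z ∈ xs × Class j a z) × j ≡ j′ × key j a ≡ k
      split : ∀ {j′ k z} → Labelled xs label j′ k z → Q j′ k z ⊎ Labelled ys label′ j′ k z
      split {z = z} (z∈ , l , e) with class? j a z
      ... | yes cl = inj₁ ((z∈ , cl) , l , trans (sym (proj₁ cl)) (trans (cong (λ i → key i z) l) e))
      ... | no ncl = inj₂ (∈-filter⁺ (¬? ∘ class? j a) z∈ ncl , l , e)
      small : AtMost M (λ z → z ∈ xs × Class j a z)
      small = atMost-≤ (≮⇒≥ (stuck ∘ inj₁)) (atMost-list _ λ { (z∈ , cl) → ∈-filter⁺ (class? j a) z∈ cl })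
      cover : ∀ j′ k Φ → (∀ {z} → z ∈ xs → key j′ z ≡ k → col j′ z ∈ Φ) → AtMost (length Φ * M) (Labelled xs label j′ k)
      cover j′ k Φ cov with j Finₚ.≟ j′ | key j a ≟ₖ k
      -- The whole class leaves at once, so what remains of this key is covered by Φ without
      -- `col j a`.
      ... | yes refl | yes refl = atMost-≤ (*-monoˡ-≤ M (remove (col j a) Φ (cov a∈ refl)))
              (atMost-⊎ split (atMost-⊆ proj₁ small)
                (proj₂ (bounded′ j k) _ λ {z} z∈ e → ∈-filter⁺ (¬? ∘ (col j a ≟ᶜ_)) (cov (proj₁ (∈-filter⁻ (¬? ∘ class? j a) z∈)) e)
                  λ ce → proj₂ (∈-filter⁻ (¬? ∘ class? j a) {xs = xs} z∈) (e , sym ce)))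
      ... | no ne | _ = atMost-⊎ split (atMost-∅ λ (_ , e , _) → ne e)
              (proj₂ (bounded′ j′ k) Φ λ z∈ → cov (proj₁ (∈-filter⁻ (¬? ∘ class? j a) z∈)))
      ... | yes _ | no ne = atMost-⊎ split (atMost-∅ λ (_ , _ , e) → ne e)
              (proj₂ (bounded′ j′ k) Φ λ z∈ → cov (proj₁ (∈-filter⁻ (¬? ∘ class? j a) z∈)))
      total : ∀ j′ k → AtMost (R * M) (Labelled xs label j′ k)
      total j′ k with j Finₚ.≟ j′ | key j a ≟ₖ k
      -- Being stuck at this moment bounds the number of colours over the key by R, and those
      -- colours are the cover.
      ... | yes refl | yes refl = atMost-≤ (*-monoˡ-≤ M (≮⇒≥ (stuck ∘ inj₂)))
              (cover j k (cols j a xs) λ z∈ e → ∈-deduplicate⁺ _≟ᶜ_ (∈-map⁺ (col j) (∈-filter⁺ (mate? j a) z∈ e)))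
      ... | no ne | _ = atMost-⊎ split (atMost-∅ λ (_ , e , _) → ne e) (proj₁ (bounded′ j′ k))
      ... | yes _ | no ne = atMost-⊎ split (atMost-∅ λ (_ , _ , e) → ne e) (proj₁ (bounded′ j′ k))
      bounded : Bounded xs label
      bounded j′ k = total j′ k , cover j′ k

    peelBy : ∀ n xs → length xs ≤ n → Unique xs → Core xs ⊎ Σ (A → Fin (suc r)) (Bounded xs)
    peelBy n [] le u = inj₂ ((λ _ → zero) , λ j k → atMost-≤ z≤n (atMost-∅ λ ()) ,
                                                   λ Φ _ → atMost-≤ z≤n (atMost-∅ λ ()))
    peelBy (suc n) xs@(x ∷ _) le u with Any.any? (λ a → Finₚ.any? λ j → ¬? (free? j a xs)) xs
    ... | no ne = inj₁ (xs , (x , here refl) ,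
                        (λ a∈ j → decidable-stable (free? j _ xs) λ nf → All.lookup (Allₚ.¬Any⇒All¬ xs ne) a∈ (j , nf)) , u , id)
    ... | yes e with Any.lookup e | Anyₚ.lookup-result e | ∈-lookup {xs = xs} (Any.index e)
    ... | a | j , stuck | a∈ with peelBy n (filter (¬? ∘ class? j a) xs)
              (≤-pred (≤-trans (filter-notAll (¬? ∘ class? j a) xs (Any.map (λ { refl nc → nc (refl , refl) }) a∈)) le))
              (Uniqueₚ.filter⁺ (¬? ∘ class? j a) u)
    ... | inj₁ (ys , ne , cl , uy , sub) = inj₁ (ys , ne , cl , uy , λ z∈ → proj₁ (∈-filter⁻ (¬? ∘ class? j a) (sub z∈)))
    ... | inj₂ (label′ , b′) = inj₂ (step xs u a j a∈ stuck label′ b′)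

    representatives : ∀ {P : A → Set} (f : A → C) cs → All (λ c → ∃ λ z → P z × f z ≡ c) cs →
      Σ (List A) λ zs → All P zs × map f zs ≡ cs
    representatives f [] [] = [] , [] , refl
    representatives f (c ∷ cs) ((z , p , e) ∷ rest) with representatives f cs rest
    ... | zs , ps , eq = z ∷ zs , p ∷ ps , cong₂ _∷_ e eq

  peel : ∀ xs → Unique xs →
    Core xs ⊎ Σ (A → Fin (suc r)) λ label → ∀ j k → AtMost (R * M) (Labelled xs label j k)
  peel xs u with peelBy (length xs) xs ≤-refl u
  ... | inj₁ core = inj₁ core
  ... | inj₂ (label , b) = inj₂ (label , λ j k → proj₁ (b j k))

  -- A class with more than M members contains a good one of unchanged colour. Otherwise take one
  -- representative for each of more than R colours: at most `length G` of them have a colour in G,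
  -- and at most N of the others are bad.
  move : ∀ {xs} → Closed xs → Unique xs → ∀ {a} → a ∈ xs → ∀ j (G : List C) {Bad : A → Set} → Decidable Bad →
    ∀ {N} → AtMost N (λ z → (z ∈ xs × Mate j a z) × Bad z) → N ≤ M → length G + N ≤ R →
    ∃ λ z → z ∈ xs × Mate j a z × ¬ Bad z × (col j z ≡ col j a ⊎ col j z ∉ G)
  move {xs} cl u {a} a∈ j G bad? {N} few N≤M N≤R with cl a∈ j
  ... | inj₁ pop with pick bad? few (filter (class? j a) xs) (Uniqueₚ.filter⁺ (class? j a) u)
                        (All.tabulate λ z∈ → let (z∈xs , e , _) = ∈-filter⁻ (class? j a) z∈ in z∈xs , e) (≤-<-trans N≤M pop)
  ... | z , z∈ , nb = let (z∈xs , e , ce) = ∈-filter⁻ (class? j a) {xs = xs} z∈ in z , z∈xs , e , nb , inj₁ ce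
  move {xs} cl u {a} a∈ j G bad? {N} few N≤M N≤R | inj₂ div
    with representatives {P = λ z → z ∈ xs × Mate j a z} (col j) (cols j a xs)
           (All.tabulate λ c∈ → case ∈-map⁻ (col j) (∈-deduplicate⁻ _≟ᶜ_ (map (col j) (filter (mate? j a) xs)) c∈) of
             λ { (z , z∈ , refl) → z , ∈-filter⁻ (mate? j a) z∈ , refl })
  ... | zs , ps , eq = let (z , z∈ , nb) = pick bad? few zs′ uz′ (Allₚ.filter⁺ out? ps) long
                           (z∈zs , out) = ∈-filter⁻ out? {xs = zs} z∈
                           (z∈xs , e) = All.lookup ps z∈zs
                       in z , z∈xs , e , nb , inj₂ out
    where
    in? : Decidable (λ z → col j z ∈ G)
    in? z = Any.any? (col j z ≟ᶜ_) G
    out? : Decidable (λ z → col j z ∉ G)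
    out? = ¬? ∘ in?
    zs′ = filter out? zs
    ucols : AllPairs (λ x y → col j x ≢ col j y) zs
    ucols = AllPairsₚ.map⁻ (subst Unique (sym eq) (DecUnique.deduplicate-! _≟ᶜ_ (map (col j) (filter (mate? j a) xs))))
    uz′ : Unique zs′
    uz′ = Uniqueₚ.filter⁺ out? (AllPairs.map (λ ne e → ne (cong (col j) e)) ucols)
    few-in : length (filter in? zs) ≤ length G
    few-in = subst (_≤ length G) (length-map (col j) (filter in? zs))
      (unique-⊆-length (AllPairsₚ.map⁺ (AllPairsₚ.filter⁺ in? ucols))
        λ c∈ → case ∈-map⁻ (col j) c∈ of λ { (z , z∈ , refl) → proj₂ (∈-filter⁻ in? {xs = zs} z∈) })
    long : N < length zs′
    long = +-cancelˡ-< (length G) N (length zs′) (begin-strict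
      length G + N                          ≤⟨ N≤R ⟩
      R                                     <⟨ div ⟩
      length (cols j a xs)                  ≡⟨ cong length (sym eq) ⟩
      length (map (col j) zs)               ≡⟨ length-map (col j) zs ⟩
      length zs                             ≡⟨ sym (length-filter-split in? zs) ⟩
      length (filter in? zs) + length zs′   ≤⟨ +-monoˡ-≤ (length zs′) few-in ⟩
      length G + length zs′                 ∎)
      where open ≤-Reasoning

toℕ-cyc : ∀ {l} (i : Fin (suc l)) → toℕ (cyc i) ≡ suc (toℕ i) ℕ.% suc l
toℕ-cyc {l} i = Finₚ.toℕ-fromℕ< _

cyc-inject₁ : ∀ {l} (i : Fin l) → cyc (inject₁ i) ≡ suc i
cyc-inject₁ {l} i = Finₚ.toℕ-injective (trans (toℕ-cyc (inject₁ i))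
  (trans (cong (λ t → suc t ℕ.% suc l) (Finₚ.toℕ-inject₁ i)) (m<n⇒m%n≡m (s≤s (Finₚ.toℕ<n i)))))

cyc-fromℕ : ∀ l → cyc (fromℕ l) ≡ zero
cyc-fromℕ l = Finₚ.toℕ-injective (trans (toℕ-cyc (fromℕ l))
  (trans (cong (λ t → suc t ℕ.% suc l) (Finₚ.toℕ-fromℕ l)) (n%n≡0 (suc l))))

lookup∈toList : ∀ {A : Set} {m} (xs : Vec A m) i → Vec.lookup xs i ∈ toList xs
lookup∈toList xs i = Vec∈ₚ.∈-toList⁺ (Vec∈ₚ.∈-lookup i xs)

-- Constants of the upper bound

module Constants (q : ℕ) where

  L : ℕ
  L = 6 + q * 2

  opaque
    -- One L for the used vertices and one for the used colours at each of the two edges of a moved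
    -- middle vertex.
    M₁ : ℕ
    M₁ = L * 1 + (L * 1 + L * 1)

    3L≤M₁ : L * 1 + (L * 1 + L * 1) ≤ M₁
    3L≤M₁ = ≤-refl

  -- `K₀` is 4L, for 2L vertices and L colours at each of two edges in `common-fresh`. The summands
  -- of `Kₜ` are the three ways in which a corner fails to be thick. `N₂` has four kinds of bad
  -- pairs, each with L forbidden values that leave `Kₜ` choices.
  L₀ K₀ Kₜ C₁ N₂ : ℕ
  L₀ = M₁ * M₁
  K₀ = M₁ + L
  Kₜ = L₀ + (L₀ + K₀)
  C₁ = L₀ + Kₜ
  N₂ = L * Kₜ + (L * Kₜ + (L * Kₜ + L * Kₜ))

  opaque
    -- Serves as R in `move`: L forbidden colours and `N₂` bad members.
    M₂ : ℕ
    M₂ = L + N₂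

    L+N₂≤M₂ : L + N₂ ≤ M₂
    L+N₂≤M₂ = ≤-refl

  N₂≤M₂ : N₂ ≤ M₂
  N₂≤M₂ = ≤-trans (m≤n+m N₂ L) L+N₂≤M₂

-- Rainbow trails; thick and thin two-paths

module Coloured {n : ℕ} (c : Colouring n) (pc : ProperColouring c) where

  V Col : Set
  V = Fin n
  Col = Maybe ℕ

  _≟ᵛ_ : DecidableEquality V
  _≟ᵛ_ = Finₚ._≟_

  _≟ᶜ_ : DecidableEquality Col
  _≟ᶜ_ = Maybeₚ.≡-dec ℕ._≟_

  infix 4 _~_ _~?_
  _~_ : V → V → Set
  _~_ = Adj c

  _~?_ : ∀ u v → Dec (u ~ v)
  u ~? v = T? (is-just (c u v))

  c-sym : ∀ u v → c u v ≡ c v u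
  c-sym = proj₁ pc

  ~-sym : ∀ {u v} → u ~ v → v ~ u
  ~-sym {u} {v} = subst (T ∘ is-just) (c-sym u v)

  ~⇒≢ : ∀ {u v} → u ~ v → u ≢ v
  ~⇒≢ {u} e refl = subst (T ∘ is-just) (proj₁ (proj₂ pc) u) e

  proper : ∀ {u v w} → u ~ v → c u v ≡ c u w → v ≡ w
  proper {u} {v} {w} e eq with c u v in cuv
  ... | just a = proj₂ (proj₂ pc) u v w a cuv (sym eq)

  proper′ : ∀ {u v w} → v ~ u → c v u ≡ c w u → v ≡ w
  proper′ {u} {v} {w} e eq = proper (~-sym e) (trans (c-sym u v) (trans eq (c-sym w u)))

  -- A rainbow path with distinct vertices, stored backwards: u is its current end, us the earlier vertices.
  data Trail (p : V) : (m : ℕ) → V → Vec V m → Vec Col m → Set where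
    start : Trail p zero p [] []
    step  : ∀ {m u us cs v} → Trail p m u us cs → u ~ v → v ∉ u ∷ toList us → c u v ∉ toList cs →
            Trail p (suc m) v (u ∷ us) (c u v ∷ cs)

  private
    trail-vertices : ∀ {p m u us cs} → Trail p m u us cs → ∀ i j →
      Vec.lookup (u ∷ us) i ≡ Vec.lookup (u ∷ us) j → i ≡ j
    trail-vertices t zero zero e = refl
    trail-vertices {us = us} (step {u = u} t _ fr _) zero (suc j) e =
      contradiction (subst (_∈ _) (sym e) (lookup∈toList us j)) fr
    trail-vertices {us = us} (step {u = u} t _ fr _) (suc i) zero e =
      contradiction (subst (_∈ _) e (lookup∈toList us i)) fr
    trail-vertices (step t _ _ _) (suc i) (suc j) e = cong suc (trail-vertices t i j e)

    trail-colours : ∀ {p m u us cs} → Trail p m u us cs → ∀ i j → Vec.lookup cs i ≡ Vec.lookup cs j → i ≡ j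
    trail-colours (step _ _ _ _) zero zero e = refl
    trail-colours (step {cs = cs} _ _ _ fr) zero (suc j) e = contradiction (subst (_∈ _) (sym e) (lookup∈toList cs j)) fr
    trail-colours (step {cs = cs} _ _ _ fr) (suc i) zero e = contradiction (subst (_∈ _) e (lookup∈toList cs i)) fr
    trail-colours (step t _ _ _) (suc i) (suc j) e = cong suc (trail-colours t i j e)

    trail-edge : ∀ {p m u us cs} → Trail p m u us cs → ∀ i →
      c (Vec.lookup (u ∷ us) (inject₁ i)) (Vec.lookup us i) ≡ Vec.lookup cs i ×
      Vec.lookup (u ∷ us) (inject₁ i) ~ Vec.lookup us i
    trail-edge (step _ e _ _) zero = c-sym _ _ , ~-sym e
    trail-edge (step t _ _ _) (suc i) = trail-edge t i

    trail-base : ∀ {p m u us cs} → Trail p m u us cs → Vec.lookup (u ∷ us) (fromℕ m) ≡ p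
    trail-base start = refl
    trail-base (step t _ _ _) = trail-base t

  close : ∀ {p l u us cs} → Trail p l u us cs → u ~ p → c u p ∉ toList cs → HasRainbowCycle c l
  close {p} {l} {u} {us} {cs} t u~p fresh = f , (trail-vertices t , adj) , colours
    where
    f : Fin (suc l) → V
    f = Vec.lookup (u ∷ us)
    closing : ∀ {i} → i ≡ zero → c (f (fromℕ l)) (f i) ≡ c u p
    closing refl = trans (cong (λ v → c v u) (trail-base t)) (c-sym p u)
    edge : ∀ (i : Fin l) {i′} → i′ ≡ suc i → c (f (inject₁ i)) (f i′) ≡ Vec.lookup cs i
    edge i refl = proj₁ (trail-edge t i)
    adj : ∀ i → f i ~ f (cyc i)
    adj i with view i
    ... | ‵fromℕ = subst (T ∘ is-just) (sym (closing (cyc-fromℕ l))) u~p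
    ... | ‵inject₁ j = subst (λ i′ → f (inject₁ j) ~ f i′) (sym (cyc-inject₁ j)) (proj₂ (trail-edge t j))
    colours : ∀ i j → c (f i) (f (cyc i)) ≡ c (f j) (f (cyc j)) → i ≡ j
    colours i j eq with view i | view j
    ... | ‵fromℕ | ‵fromℕ = refl
    ... | ‵fromℕ | ‵inject₁ j′ = contradiction
      (subst (_∈ toList cs) (trans (sym (edge j′ (cyc-inject₁ j′))) (trans (sym eq) (closing (cyc-fromℕ l))))
          (lookup∈toList cs j′)) fresh
    ... | ‵inject₁ i′ | ‵fromℕ = contradiction
      (subst (_∈ toList cs) (trans (sym (edge i′ (cyc-inject₁ i′))) (trans eq (closing (cyc-fromℕ l)))) (lookup∈toList cs i′)) fresh
    ... | ‵inject₁ i′ | ‵inject₁ j′ = cong inject₁ (trail-colours t i′ j′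
      (trans (sym (edge i′ (cyc-inject₁ i′))) (trans eq (edge j′ (cyc-inject₁ j′)))))

  trail-length : ∀ {p m u us cs} → Trail p m u us cs → length (u ∷ toList us) ≡ suc m × length (toList cs) ≡ m
  trail-length {us = us} {cs} _ = cong suc (Vecₚ.length-toList us) , Vecₚ.length-toList cs

  _∈?ᵛ_ : ∀ (v : V) F → Dec (v ∈ F)
  v ∈?ᵛ F = Any.any? (v ≟ᵛ_) F

  _∈?ᶜ_ : ∀ (v : Col) F → Dec (v ∈ F)
  v ∈?ᶜ F = Any.any? (v ≟ᶜ_) F

  TwoPath : V → V → V → Set
  TwoPath p v x = p ~ v × v ~ x × x ≢ p

  twoPath? : ∀ p v x → Dec (TwoPath p v x)
  twoPath? p v x = (p ~? v) ×-dec (v ~? x) ×-dec ¬? (x ≟ᵛ p)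

  twoPath-sym : ∀ {p v x} → TwoPath p v x → TwoPath x v p
  twoPath-sym (a , b , ne) = ~-sym b , ~-sym a , ne ∘ sym

  twoPathsFrom : V → List (V × V)
  twoPathsFrom p = filter (λ (v , x) → twoPath? p v x) (cartesianProduct (allFin n) (allFin n))

  ∈-twoPathsFrom : ∀ {p v x} → TwoPath p v x → (v , x) ∈ twoPathsFrom p
  ∈-twoPathsFrom {p} t = ∈-filter⁺ (λ (v , x) → twoPath? p v x) (∈-cartesianProduct⁺ (∈-allFin _) (∈-allFin _)) t

  twoPathsFrom-∈ : ∀ {p v x} → (v , x) ∈ twoPathsFrom p → TwoPath p v x
  twoPathsFrom-∈ {p} m = proj₂ (∈-filter⁻ (λ (v , x) → twoPath? p v x) {xs = cartesianProduct (allFin n) (allFin n)} m)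

  unique-twoPathsFrom : ∀ p → Unique (twoPathsFrom p)
  unique-twoPathsFrom p = Uniqueₚ.filter⁺ (λ (v , x) → twoPath? p v x)
    (Uniqueₚ.cartesianProduct⁺ (Uniqueₚ.allFin⁺ n) (Uniqueₚ.allFin⁺ n))

  atMost-map∈′ : ∀ {A B : Set} (_≟_ : DecidableEquality B) {L K} {P : A → Set} (g : A → B) (F : List B) → length F ≤ L →
    (∀ y → AtMost K (λ x → P x × g x ≡ y)) → AtMost (L * K) (λ x → P x × g x ∈ F)
  atMost-map∈′ _≟_ {K = K} g F le fib = atMost-≤ (*-monoˡ-≤ K le) (atMost-map∈ _≟_ g F fib)

  module NoRainbow (q : ℕ) (noRainbow : ¬ HasRainbowCycle c (5 + q * 2)) where

    open Constants q

    endpoint : Fin 2 → V × V → V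
    endpoint zero = proj₁
    endpoint (suc zero) = proj₂

    module _ (p : V) where

      -- A trivial colour suffices: every edge altered by a move keeps one end, so properness
      -- excludes the used colours directly.
      open Peeling {A = V × V} {r = 1} _≟ᵛ_ ⊤ₚ._≟_ endpoint (λ _ _ → tt) M₁ M₁

      private
        module _ {ys} (cl : Closed ys) (u : Unique ys) (sub : ∀ {z} → z ∈ ys → z ∈ twoPathsFrom p) where

          moveEnd : ∀ F G → length F ≤ L → length G ≤ L → ∀ {v x} → (v , x) ∈ ys →
            ∃ λ x′ → (v , x′) ∈ ys × x′ ∉ F × c v x′ ∉ G
          moveEnd F G F≤ G≤ {v} {x} vx∈ =
            let ((v′ , x′) , z∈ , e , nb , _) = move cl u vx∈ zero [] {Bad = λ (v′ , x′) → x′ ∈ F ⊎ c v′ x′ ∈ G}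
                  (λ (v′ , x′) → (x′ ∈?ᵛ F) ⊎-dec (c v′ x′ ∈?ᶜ G))
                  (atMost-∪
                    (atMost-map∈′ _≟ᵛ_ proj₂ F F≤ λ y → atMost-1 λ
                      { ((_ , refl) , refl) ((_ , refl) , refl) → refl })
                    (atMost-map∈′ _≟ᶜ_ (λ (v′ , x′) → c v′ x′) G G≤ λ y → atMost-1 λ
                      { ((m , refl) , e) ((m′ , refl) , e′) →
                        cong (v ,_) (proper (proj₁ (proj₂ (twoPathsFrom-∈ (sub m)))) (trans e (sym e′))) }))
                  (≤-trans (m≤n+m _ (L * 1)) 3L≤M₁) (≤-trans (m≤n+m _ (L * 1)) 3L≤M₁)
            in x′ , subst (λ w → (w , x′) ∈ ys) e z∈ , nb ∘ inj₁ , λ b → nb (inj₂ (subst (λ w → c w x′ ∈ G) (sym e) b))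

          -- The colour of the edge from v′ back to p is kept new as well, because the walk may have
          -- to close there.
          moveMid : ∀ F G → length F ≤ L → length G ≤ L → ∀ {v x} → (v , x) ∈ ys →
            ∃ λ v′ → (v′ , x) ∈ ys × v′ ∉ F × c x v′ ∉ G × c p v′ ∉ G
          moveMid F G F≤ G≤ {v} {x} vx∈ =
            let ((v′ , x′) , z∈ , e , nb , _) = move cl u vx∈ (suc zero) []
                  {Bad = λ (v′ , x′) → v′ ∈ F ⊎ c x′ v′ ∈ G ⊎ c p v′ ∈ G}
                  (λ (v′ , x′) → (v′ ∈?ᵛ F) ⊎-dec ((c x′ v′ ∈?ᶜ G) ⊎-dec (c p v′ ∈?ᶜ G)))
                  (atMost-∪
                    (atMost-map∈′ _≟ᵛ_ proj₁ F F≤ λ y → atMost-1 λ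
                      { ((_ , refl) , refl) ((_ , refl) , refl) → refl })
                    (atMost-∪
                      (atMost-map∈′ _≟ᶜ_ (λ (v′ , x′) → c x′ v′) G G≤ λ y → atMost-1 λ
                        { ((m , refl) , e) ((m′ , refl) , e′) →
                          cong (_, x) (proper (~-sym (proj₁ (proj₂ (twoPathsFrom-∈ (sub m))))) (trans e (sym e′))) })
                      (atMost-map∈′ _≟ᶜ_ (λ (v′ , x′) → c p v′) G G≤ λ y → atMost-1 λ
                        { ((m , refl) , e) ((m′ , refl) , e′) →
                          cong (_, x) (proper (proj₁ (twoPathsFrom-∈ (sub m))) (trans e (sym e′))) })))
                  3L≤M₁ 3L≤M₁
            in v′ , subst (λ w → (v′ , w) ∈ ys) e z∈ , nb ∘ inj₁ ,
               (λ b → nb (inj₂ (inj₁ (subst (λ w → c w v′ ∈ G) (sym e) b)))) , nb ∘ inj₂ ∘ inj₂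

          -- The rainbow cycle p v x v′ x′ v″ … p: every other vertex is a neighbour of p.
          zigzag : ∀ j {m v us cs x} → Trail p m v us cs → (v , x) ∈ ys → m + suc j * 2 ≡ 5 + q * 2 → ⊥
          zigzag j {m} {v} {us} {cs} tr vx∈ len =
            let x′ , vx′∈ , x′∉ , cx′∉ = moveEnd (v ∷ toList us) (toList cs)
                   (≤-trans (≤-reflexive (proj₁ (trail-length tr))) (≤-trans m+1≤ (n≤1+n _)))
                   (≤-trans (≤-reflexive (proj₂ (trail-length tr))) (≤-trans (n≤1+n m) (≤-trans m+1≤ (n≤1+n _)))) vx∈
                (_ , v~x′ , x′≢p) = twoPathsFrom-∈ (sub vx′∈)
                tr′ = step tr v~x′ x′∉ cx′∉
                v′ , v′x′∈ , v′∉ , cv′∉ , cpv′∉ = moveMid (x′ ∷ v ∷ toList us) (c v x′ ∷ toList cs)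
                   (≤-trans (≤-reflexive (proj₁ (trail-length tr′))) m+2≤)
                   (≤-trans (≤-reflexive (proj₂ (trail-length tr′))) (≤-trans m+1≤ (n≤1+n _))) vx′∈
                (p~v′ , v′~x′ , _) = twoPathsFrom-∈ (sub v′x′∈)
                tr″ = step tr′ (~-sym v′~x′) v′∉ cv′∉
                fresh : c v′ p ∉ c x′ v′ ∷ toList (c v x′ ∷ cs)
                fresh = λ { (here e) → x′≢p (sym (proper′ p~v′ (trans (c-sym p v′) e)))
                          ; (there m) → cpv′∉ (subst (_∈ c v x′ ∷ toList cs) (c-sym v′ p) m) }
            in finish j tr″ v′x′∈ (~-sym p~v′) fresh (trans (sym len′) len)
            where
            len′ : m + suc j * 2 ≡ 2 + m + j * 2
            len′ = trans (+-suc m (suc (j * 2))) (cong suc (+-suc m (j * 2)))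
            m+2≤ : 2 + m ≤ L
            m+2≤ = ≤-trans (subst (2 + m ≤_) (trans (sym len′) len) (m≤m+n (2 + m) (j * 2))) (n≤1+n _)
            m+1≤ : 1 + m ≤ 5 + q * 2
            m+1≤ = ≤-pred m+2≤
            finish : ∀ j {m v us cs x} → Trail p m v us cs → (v , x) ∈ ys → v ~ p → c v p ∉ toList cs →
              m + j * 2 ≡ 5 + q * 2 → ⊥
            finish zero {m} tr _ v~p fr len with trans (sym (+-identityʳ m)) len
            ... | refl = noRainbow (close tr v~p fr)
            finish (suc j) tr vx∈ _ _ len = zigzag j tr vx∈ len

        noCore : ¬ Core (twoPathsFrom p)
        noCore (ys , ((v , x) , vx∈) , cl , u , sub) =
          let (p~v , _ , _) = twoPathsFrom-∈ (sub vx∈)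
          in zigzag cl u sub (suc q) (step start p~v (λ { (here e) → ~⇒≢ p~v (sym e) }) (λ ())) vx∈ refl

      orientation : Σ (V × V → Fin 2) λ label →
        (∀ v → AtMost L₀ (λ x → TwoPath p v x × label (v , x) ≡ zero)) ×
        (∀ x → AtMost L₀ (λ v → TwoPath p v x × label (v , x) ≢ zero))
      orientation with peel (twoPathsFrom p) (unique-twoPathsFrom p)
      ... | inj₁ core = ⊥-elim (noCore core)
      ... | inj₂ (label , b) = label ,
        (λ v → atMost-injective (≡-dec _≟ᵛ_ _≟ᵛ_) (v ,_) (λ (t , e) → ∈-twoPathsFrom t , e , refl) (λ { _ _ refl → refl })
            (b zero v)) ,
        (λ x → atMost-injective (≡-dec _≟ᵛ_ _≟ᵛ_) (_, x) (λ (t , ne) → ∈-twoPathsFrom t , one _ ne , refl) (λ { _ _ refl → refl })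
            (b (suc zero) x))
        where
        one : ∀ (i : Fin 2) → i ≢ zero → i ≡ suc zero
        one zero ne = ⊥-elim (ne refl)
        one (suc zero) ne = refl

    common : V → V → List V
    common p x = filter (λ v → (p ~? v) ×-dec (v ~? x)) (allFin n)

    private
      label : V → V × V → Fin 2
      label p = proj₁ (orientation p)

    -- Both labels are asked for so that the notion is symmetric in p and x; the common neighbours
    -- are the vertices for which v can be exchanged.
    Thick : V → V → V → Set
    Thick p v x = label p (v , x) ≡ zero × label x (v , p) ≡ zero × K₀ < length (common p x)

    thick? : ∀ p v x → Dec (Thick p v x)
    thick? p v x = (label p (v , x) Finₚ.≟ zero) ×-dec (label x (v , p) Finₚ.≟ zero) ×-dec (K₀ <? length (common p x))

    common-sym : ∀ p x → length (common p x) ≤ length (common x p)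
    common-sym p x = unique-⊆-length (Uniqueₚ.filter⁺ (λ v → (p ~? v) ×-dec (v ~? x)) (Uniqueₚ.allFin⁺ n)) λ {v} m →
      let (_ , a , b) = ∈-filter⁻ (λ v → (p ~? v) ×-dec (v ~? x)) {xs = allFin n} m
      in ∈-filter⁺ (λ v → (x ~? v) ×-dec (v ~? p)) (∈-allFin v) (~-sym b , ~-sym a)

    thick-sym : ∀ {p v x} → Thick p v x → Thick x v p
    thick-sym {p} {v} {x} (a , b , k) = b , a , ≤-trans k (common-sym p x)

    thick-next : ∀ p v → AtMost L₀ (λ x → TwoPath p v x × Thick p v x)
    thick-next p v = atMost-⊆ (λ (t , th) → t , proj₁ th) (proj₁ (proj₂ (orientation p)) v)

    -- A corner is thin because of its label at p, its label at x, or a small codegree. Each of the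
    -- labels bounds the middle vertices by `L₀`, and a small codegree bounds them by `K₀`.
    thin-mid : ∀ p x → AtMost Kₜ (λ v → TwoPath p v x × ¬ Thick p v x)
    thin-mid p x = atMost-⊎ {Q = λ v → TwoPath p v x × label p (v , x) ≢ zero}
      (λ {v} (t , nth) → case label p (v , x) Finₚ.≟ zero of λ { (yes e) → inj₂ (t , e , nth) ; (no ne) → inj₁ (t , ne) })
      (proj₂ (proj₂ (orientation p)) x)
      (atMost-⊎ {Q = λ v → TwoPath x v p × label x (v , p) ≢ zero} {R = λ v → TwoPath p v x × ¬ (K₀ < length (common p x))}
        (λ {v} (t , e , nth) → case label x (v , p) Finₚ.≟ zero of λ
          { (yes e′) → inj₂ (t , λ k → nth (e , e′ , k)) ; (no ne) → inj₁ (twoPath-sym t , ne) })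
        (proj₂ (proj₂ (orientation x)) p)
        (atMost-inhabited λ _ (_ , k) → atMost-≤ (≮⇒≥ k)
          (atMost-list (common p x) λ {v} ((a , b , _) , _) → ∈-filter⁺ (λ v → (p ~? v) ×-dec (v ~? x)) (∈-allFin v) (a , b))))

    -- A thick two-path is counted through its middle vertex, a thin one through its end.
    two-paths : ∀ p → AtMost (n * C₁) (λ (v , x) → TwoPath p v x)
    two-paths p = atMost-≤ (≤-reflexive (sym (*-distribˡ-+ n L₀ Kₜ))) (atMost-⊎
      {Q = λ (v , x) → TwoPath p v x × Thick p v x} {R = λ (v , x) → TwoPath p v x × ¬ Thick p v x}
      (λ {(v , x)} t → case thick? p v x of λ { (yes th) → inj₁ (t , th) ; (no nth) → inj₂ (t , nth) })
      (atMost-fibre _≟ᵛ_ proj₁ (λ _ → tt) atMost-Fin λ y _ →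
        atMost-injective _≟ᵛ_ proj₂ (λ { (h , refl) → h }) (λ { (_ , refl) (_ , refl) refl → refl }) (thick-next p y))
      (atMost-fibre _≟ᵛ_ proj₂ (λ _ → tt) atMost-Fin λ y _ →
        atMost-injective _≟ᵛ_ proj₁ (λ { (h , refl) → h }) (λ { (_ , refl) (_ , refl) refl → refl }) (thin-mid p y)))

concatMap-unique : {A B : Set} (g : A → List B) → (∀ x → Unique (g x)) →
  (∀ {x y z} → z ∈ g x → z ∈ g y → x ≡ y) → ∀ {xs} → Unique xs → Unique (concatMap g xs)
concatMap-unique g ug inj [] = []
concatMap-unique g ug inj {x ∷ xs} (x∉ ∷ u) = Uniqueₚ.++⁺ (ug x) (concatMap-unique g ug inj u) λ (m₁ , m₂) →
  let (y , y∈ , z∈) = ∈-∃ xs m₂ in All.lookup x∉ y∈ (inj m₁ z∈)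
  where
  ∈-∃ : ∀ xs {z} → z ∈ concatMap g xs → ∃ λ y → y ∈ xs × z ∈ g y
  ∈-∃ (y ∷ ys) m with ∈-++⁻ (g y) m
  ... | inj₁ m₁ = y , here refl , m₁
  ... | inj₂ m₂ = let (y′ , y∈ , z∈) = ∈-∃ ys m₂ in y′ , there y∈ , z∈

∈-allVecs : ∀ {m n} (v : Vec (Fin n) m) → v ∈ allVecs m n
∈-allVecs [] = here refl
∈-allVecs {suc m} {n} (x ∷ v) = go (∈-allVecs v)
  where
  go : ∀ {vs} → v ∈ vs → (x ∷ v) ∈ concatMap (λ v → map (λ x → x Vec.∷ v) (allFin n)) vs
  go (here refl) = ∈-++⁺ˡ (∈-map⁺ (λ x → x Vec.∷ v) (∈-allFin x))
  go {w ∷ _} (there m) = ∈-++⁺ʳ (map (λ x → x Vec.∷ w) (allFin n)) (go m)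

unique-allVecs : ∀ m n → Unique (allVecs m n)
unique-allVecs zero n = [] ∷ []
unique-allVecs (suc m) n = concatMap-unique _ (λ v → Uniqueₚ.map⁺ (λ { refl → refl }) (Uniqueₚ.allFin⁺ n))
  (λ {v} {w} m₁ m₂ → case ∈-map⁻ (λ x → x Vec.∷ v) m₁ of λ { (a , _ , refl) →
    case ∈-map⁻ (λ x → x Vec.∷ w) m₂ of λ { (b , _ , refl) → refl } }) (unique-allVecs m n)

atMost-window : {A B : Set} (_≟_ : DecidableEquality B) → ∀ {M K} {P : A → Set} {Q : B → Set} (g : A → B) →
  AtMost M Q → (∀ {x} → P x → Q (g x)) → (∀ x → P x → AtMost K (λ y → P y × g y ≡ g x)) → AtMost (M * K) P
atMost-window _≟_ g q pq fib = atMost-fibre _≟_ g pq q λ y _ → atMost-inhabited λ { x (p , refl) → fib x p }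

-- Rainbow hexagons with thin corners

pattern hex x0 x1 x2 x3 x4 x5 = x0 ∷ x1 ∷ x2 ∷ x3 ∷ x4 ∷ x5 ∷ []
pattern quad x0 x1 x2 x3 = x0 ∷ x1 ∷ x2 ∷ x3 ∷ []

module ThreePaths {n : ℕ} (c : Colouring n) (pc : ProperColouring c) (q : ℕ)
  (noRainbow : ¬ HasRainbowCycle c (5 + q * 2)) where

  open Coloured c pc
  open NoRainbow q noRainbow
  open Constants q

  ThinPath : V → V → V → V → Set
  ThinPath x0 x1 x2 x3 = (TwoPath x0 x1 x2 × TwoPath x1 x2 x3 × x0 ≢ x3) × ¬ Thick x0 x1 x2 × ¬ Thick x1 x2 x3

  thinPath? : ∀ x0 x1 x2 x3 → Dec (ThinPath x0 x1 x2 x3)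
  thinPath? x0 x1 x2 x3 = (twoPath? x0 x1 x2 ×-dec twoPath? x1 x2 x3 ×-dec ¬? (x0 ≟ᵛ x3)) ×-dec
    ¬? (thick? x0 x1 x2) ×-dec ¬? (thick? x1 x2 x3)

  thinPath-sym : ∀ {x0 x1 x2 x3} → ThinPath x0 x1 x2 x3 → ThinPath x3 x2 x1 x0
  thinPath-sym ((a , b , ne) , t , t′) = (twoPath-sym b , twoPath-sym a , ne ∘ sym) , t′ ∘ thick-sym , t ∘ thick-sym

  ThinQuad : Vec V 4 → Set
  ThinQuad (x0 ∷ x1 ∷ x2 ∷ x3 ∷ []) = ThinPath x0 x1 x2 x3

  thinQuad? : Decidable ThinQuad
  thinQuad? (x0 ∷ x1 ∷ x2 ∷ x3 ∷ []) = thinPath? x0 x1 x2 x3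

  _≟⁴_ : DecidableEquality (Vec V 4)
  _≟⁴_ = Vecₚ.≡-dec _≟ᵛ_

  -- The colour conditions are those among the fifteen distinctness conditions of a rainbow hexagon that the zigzag uses.
  RainbowHex : Vec V 6 → Set
  RainbowHex (hex x0 x1 x2 x3 x4 x5) =
    (ThinPath x0 x1 x2 x3 × ThinPath x3 x4 x5 x0 × ThinPath x5 x0 x1 x2 × ThinPath x2 x3 x4 x5) ×
    (c x0 x5 ≢ c x1 x2 × c x3 x4 ≢ c x1 x2 × c x5 x4 ≢ c x1 x2 × c x0 x5 ≢ c x3 x4 × c x1 x0 ≢ c x2 x3)

  rainbowHex? : Decidable RainbowHex
  rainbowHex? (hex x0 x1 x2 x3 x4 x5) =
    (thinPath? x0 x1 x2 x3 ×-dec thinPath? x3 x4 x5 x0 ×-dec thinPath? x5 x0 x1 x2 ×-dec thinPath? x2 x3 x4 x5) ×-dec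
    (¬? (_ ≟ᶜ _) ×-dec ¬? (_ ≟ᶜ _) ×-dec ¬? (_ ≟ᶜ _) ×-dec ¬? (_ ≟ᶜ _) ×-dec ¬? (_ ≟ᶜ _))

  rainbowHexes : List (Vec V 6)
  rainbowHexes = filter rainbowHex? (allVecs 6 n)

  -- Direction 0 moves x1, x2 between x0 and x3; direction 1 moves x3, x4 between x2 and x5. The key
  -- consists of the other four vertices, a thin path, so that a labelling bounds hexagons in terms
  -- of thin paths.
  keyOf : Fin 2 → Vec V 6 → Vec V 4
  keyOf zero (hex x0 x1 x2 x3 x4 x5) = x3 ∷ x4 ∷ x5 ∷ x0 ∷ []
  keyOf (suc zero) (hex x0 x1 x2 x3 x4 x5) = x5 ∷ x0 ∷ x1 ∷ x2 ∷ []

  private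
    -- The edge x1 x2 moves with both ends and may become an edge of the cycle. After a move in
    -- direction 1 the walk uses only x2 x3, which has a fixed end.
    col : Fin 2 → Vec V 6 → Col
    col zero (hex x0 x1 x2 x3 x4 x5) = c x1 x2
    col (suc zero) _ = nothing

  open Peeling {A = Vec V 6} {r = 1} _≟⁴_ _≟ᶜ_ keyOf col M₂ M₂

  Bad : V → V → List V → List Col → V → V → Set
  Bad a d F G y z = y ∈ F ⊎ z ∈ F ⊎ c a y ∈ G ⊎ c d z ∈ G

  bad? : ∀ a d F G y z → Dec (Bad a d F G y z)
  bad? a d F G y z = (y ∈?ᵛ F) ⊎-dec (z ∈?ᵛ F) ⊎-dec (c a y ∈?ᶜ G) ⊎-dec (c d z ∈?ᶜ G)

  fixFirst : ∀ a d y → AtMost Kₜ (λ ((y′ , z) : V × V) → ThinPath a y′ z d × y′ ≡ y)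
  fixFirst a d y = atMost-injective _≟ᵛ_ proj₂ (λ { (((_ , t , _) , _ , th) , refl) → t , th })
    (λ { (_ , refl) (_ , refl) refl → refl }) (thin-mid y d)

  fixSecond : ∀ a d z → AtMost Kₜ (λ ((y , z′) : V × V) → ThinPath a y z′ d × z′ ≡ z)
  fixSecond a d z = atMost-injective _≟ᵛ_ proj₁ (λ { (((t , _ , _) , th , _) , refl) → t , th })
    (λ { (_ , refl) (_ , refl) refl → refl }) (thin-mid a z)

  -- Properness at a turns the colour into the vertex y.
  fixFirstColour : ∀ a d α → AtMost Kₜ (λ ((y , z) : V × V) → ThinPath a y z d × c a y ≡ α)
  fixFirstColour a d α = atMost-inhabited λ { (y₀ , _) (((t₀ , _) , _) , e₀) → atMost-⊆
    (λ { (p@((t , _) , _) , e) → p , proper (proj₁ t) (trans e (sym e₀)) }) (fixFirst a d y₀) }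

  fixSecondColour : ∀ a d α → AtMost Kₜ (λ ((y , z) : V × V) → ThinPath a y z d × c d z ≡ α)
  fixSecondColour a d α = atMost-inhabited λ { (_ , z₀) (((_ , t₀ , _) , _) , e₀) → atMost-⊆
    (λ { (p@((_ , t , _) , _) , e) → p , proper (~-sym (proj₁ (proj₂ t))) (trans e (sym e₀)) }) (fixSecond a d z₀) }

  fewBad : ∀ a d F G → length F ≤ L → length G ≤ L →
    AtMost N₂ (λ ((y , z) : V × V) → ThinPath a y z d × Bad a d F G y z)
  fewBad a d F G F≤ G≤ =
    atMost-∪
      (atMost-map∈′ _≟ᵛ_ proj₁ F F≤ (fixFirst a d))
    (atMost-∪
      (atMost-map∈′ _≟ᵛ_ proj₂ F F≤ (fixSecond a d))
    (atMost-∪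
      (atMost-map∈′ _≟ᶜ_ (λ (y , z) → c a y) G G≤ (fixFirstColour a d))
      (atMost-map∈′ _≟ᶜ_ (λ (y , z) → c d z) G G≤ (fixSecondColour a d))))

  module _ {ys} (cl : Closed ys) (u : Unique ys) (sub : ∀ {z} → z ∈ ys → z ∈ rainbowHexes) where

    isHex : ∀ {z} → z ∈ ys → RainbowHex z
    isHex m = proj₂ (∈-filter⁻ rainbowHex? {xs = allVecs 6 n} (sub m))

    -- `Bad` covers the edges at x0 and x3. The middle edge is left to the last alternative, where
    -- its colour is inherited or new.
    move₁₂ : ∀ F G → length F ≤ L → length G ≤ L → ∀ {x0 x1 x2 x3 x4 x5} →
      hex x0 x1 x2 x3 x4 x5 ∈ ys →
      ∃ λ y → ∃ λ z → hex x0 y z x3 x4 x5 ∈ ys × ¬ Bad x0 x3 F G y z × (c y z ≡ c x1 x2 ⊎ c y z ∉ G)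
    move₁₂ F G F≤ G≤ {x0} {x1} {x2} {x3} {x4} {x5} m
      with move cl u m zero G {Bad = λ { (_ ∷ y ∷ z ∷ _) → Bad x0 x3 F G y z }} (λ { (_ ∷ y ∷ z ∷ _) → bad? x0 x3 F G y z })
        (atMost-injective (≡-dec _≟ᵛ_ _≟ᵛ_) (λ { (_ ∷ y ∷ z ∷ _) → y , z })
          (λ { {_ ∷ _ ∷ _ ∷ _ ∷ _ ∷ _ ∷ []} ((z∈ , refl) , b) → proj₁ (proj₁ (isHex z∈)) , b })
          (λ { {_ ∷ _ ∷ _ ∷ _ ∷ _ ∷ _ ∷ []} {_ ∷ _ ∷ _ ∷ _ ∷ _ ∷ _ ∷ []} ((_ , refl) , _) ((_ , refl) , _) refl → refl })
          (fewBad x0 x3 F G F≤ G≤))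
        N₂≤M₂ (≤-trans (+-monoˡ-≤ N₂ G≤) L+N₂≤M₂)
    ... | (_ ∷ y ∷ z ∷ _ ∷ _ ∷ _ ∷ []) , z∈ , refl , nb , cc = y , z , z∈ , nb , cc

    move₃₄ : ∀ F G → length F ≤ L → length G ≤ L → ∀ {x0 x1 x2 x3 x4 x5} →
      hex x0 x1 x2 x3 x4 x5 ∈ ys →
      ∃ λ y → ∃ λ z → hex x0 x1 x2 y z x5 ∈ ys × ¬ Bad x2 x5 F G y z
    move₃₄ F G F≤ G≤ {x0} {x1} {x2} {x3} {x4} {x5} m
      with move cl u m (suc zero) [] {Bad = λ { (_ ∷ _ ∷ _ ∷ y ∷ z ∷ _) → Bad x2 x5 F G y z }} (λ { (_ ∷ _ ∷ _ ∷ y ∷ z ∷ _) →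
          bad? x2 x5 F G y z })
        (atMost-injective (≡-dec _≟ᵛ_ _≟ᵛ_) (λ { (_ ∷ _ ∷ _ ∷ y ∷ z ∷ _) → y , z })
          (λ { {_ ∷ _ ∷ _ ∷ _ ∷ _ ∷ _ ∷ []} ((z∈ , refl) , b) → proj₂ (proj₂ (proj₂ (proj₁ (isHex z∈)))) , b })
          (λ { {_ ∷ _ ∷ _ ∷ _ ∷ _ ∷ _ ∷ []} {_ ∷ _ ∷ _ ∷ _ ∷ _ ∷ _ ∷ []} ((_ , refl) , _) ((_ , refl) , _) refl → refl })
          (fewBad x2 x5 F G F≤ G≤))
        N₂≤M₂ N₂≤M₂
    ... | (_ ∷ _ ∷ _ ∷ y ∷ z ∷ _ ∷ []) , z∈ , refl , nb , _ = y , z , z∈ , nb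

    -- The rainbow cycle x0 x5 x4 x3 w x w′ x′ … w″ v″ x0, where x0 v w x x4 x5 runs through the family.
    zigzag₆ : ∀ j {m x0 x1 x2 x3 x4 x5 us cs} → Trail x0 m x3 us cs → hex x0 x1 x2 x3 x4 x5 ∈ ys →
      c x1 x2 ∉ toList cs → m + suc j * 2 ≡ 5 + q * 2 → ⊥
    zigzag₆ j {m} {x0} {x1} {x2} {x3} {x4} {x5} {us} {cs} tr m∈ κ∉ len =
      let (v , w , h∈ , nb , κ) = move₁₂ (x3 ∷ toList us) (toList cs)
             (≤-trans (≤-reflexive (proj₁ (trail-length tr))) (≤-trans m+1≤ (n≤1+n _)))
             (≤-trans (≤-reflexive (proj₂ (trail-length tr))) (≤-trans (n≤1+n m) (≤-trans m+1≤ (n≤1+n _)))) m∈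
          ((((x0~v , _ , _) , (v~w , w~x3 , x3≢v) , _) , _) , _) , (_ , _ , _ , _ , c01≢c23) = isHex h∈
          -- If the colour of the middle edge is inherited, the invariant on x1 x2 applies;
          -- otherwise it is new by choice.
          κ′∉ = λ b → [ (λ e → κ∉ (subst (_∈ toList cs) e b)) , (λ nb′ → nb′ b) ]′ κ
          tr′ = step tr (~-sym w~x3) (nb ∘ inj₂ ∘ inj₁) (nb ∘ inj₂ ∘ inj₂ ∘ inj₂)
          κ″∉ = λ { (here e) → x3≢v (sym (proper′ v~w e)) ; (there b) → κ′∉ b }
      in continue j h∈ tr′ (nb ∘ inj₁) (nb ∘ inj₂ ∘ inj₂ ∘ inj₁) κ″∉ (trans (sym len′) len)
      where
      len′ : m + suc j * 2 ≡ 2 + m + j * 2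
      len′ = trans (+-suc m (suc (j * 2))) (cong suc (+-suc m (j * 2)))
      m+2≤ : 2 + m ≤ L
      m+2≤ = ≤-trans (subst (2 + m ≤_) (trans (sym len′) len) (m≤m+n (2 + m) (j * 2))) (n≤1+n _)
      m+1≤ : 1 + m ≤ 5 + q * 2
      m+1≤ = ≤-pred m+2≤
      continue : ∀ j {v w} → hex x0 v w x3 x4 x5 ∈ ys → Trail x0 (suc m) w (x3 ∷ us) (c x3 w ∷ cs) →
        v ∉ x3 ∷ toList us → c x0 v ∉ toList cs → c v w ∉ c x3 w ∷ toList cs → 2 + m + j * 2 ≡ 5 + q * 2 → ⊥
      continue zero {v} {w} h∈ tr′ v∉ cv∉ κ∉ len₀ with trans (sym (+-identityʳ (2 + m))) len₀
      ... | refl =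
        let ((((x0~v , _ , w≢x0) , (v~w , w~x3 , x3≢v) , _) , _) , _) , (_ , _ , _ , _ , c01≢c23) = isHex h∈
        in noRainbow (close
             (step tr′ (~-sym v~w) (λ { (here e) → ~⇒≢ v~w e ; (there b) → v∉ b })
               (λ b → κ∉ (subst (_∈ c x3 w ∷ toList cs) (c-sym w v) b)))
             (~-sym x0~v)
             (λ { (here e) → w≢x0 (sym (proper′ x0~v (trans (c-sym x0 v) e)))
                -- The edges x0 v and x3 w were chosen in the same move, so avoiding earlier colours
                -- does not separate them; the hexagon's own colour condition does.
                ; (there (here e)) → c01≢c23 (trans e (c-sym x3 w))
                ; (there (there b)) → cv∉ (subst (_∈ toList cs) (c-sym v x0) b) }))
      continue (suc j) {v} {w} h∈ tr′ v∉ cv∉ κ∉ len₀ =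
        let (x , y , g∈ , nb) = move₃₄ (w ∷ x3 ∷ toList us) (c x3 w ∷ toList cs)
               (≤-trans (≤-reflexive (proj₁ (trail-length tr′))) m+2≤)
               (≤-trans (≤-reflexive (proj₂ (trail-length tr′))) (≤-trans m+1≤ (n≤1+n _))) h∈
            (((_ , (v~w , w~x , x≢v) , _) , _) , _) , _ = isHex g∈
        in zigzag₆ j (step tr′ w~x (nb ∘ inj₁) (nb ∘ inj₂ ∘ inj₂ ∘ inj₁)) g∈
             (λ { (here e) → x≢v (sym (proper (~-sym v~w) (trans (c-sym w v) e))) ; (there b) → κ∉ b })
             len₀

  noHexCore : ¬ Core rainbowHexes
  noHexCore (ys , ((hex x0 x1 x2 x3 x4 x5) , m) , cl , u , sub) =
    let (_ , ((((x3~x4 , x4~x5 , x5≢x3) , (_ , x5~x0 , x0≢x4) , x3≢x0)) , _) , _) , (e₁ , e₂ , e₃ , e₄ , _) = isHex cl u sub m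
        t₁ = step start (~-sym x5~x0) (λ { (here e) → ~⇒≢ x5~x0 e }) (λ ())
        t₂ = step t₁ (~-sym x4~x5) (λ { (here e) → ~⇒≢ x4~x5 e ; (there (here e)) → x0≢x4 (sym e) })
               (λ { (here e) → x0≢x4 (proper x5~x0 (trans (c-sym x5 x0) (sym e))) })
        t₃ = step t₂ (~-sym x3~x4) (λ { (here e) → ~⇒≢ x3~x4 e ; (there (here e)) → x5≢x3 (sym e) ; (there (there (here e))) →
            x3≢x0 e })
               (λ { (here e) → x5≢x3 (proper x4~x5 (trans (c-sym x4 x5) (sym e)))
                  ; (there (here e)) → e₄ (trans (sym e) (c-sym x4 x3)) })
    in zigzag₆ cl u sub q t₃ m
         (λ { (here e) → e₂ (trans (c-sym x3 x4) (sym e)) ; (there (here e)) → e₃ (sym e) ; (there (there (here e))) → e₁ (sym e) })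
         refl

  labelling : Σ (Vec V 6 → Fin 2) λ label → ∀ i k → AtMost (M₂ * M₂) (λ x → RainbowHex x × label x ≡ i × keyOf i x ≡ k)
  labelling with peel rainbowHexes (Uniqueₚ.filter⁺ rainbowHex? (unique-allVecs 6 n))
  ... | inj₁ core = ⊥-elim (noHexCore core)
  ... | inj₂ (label , h) = label , λ i k → atMost-⊆ (λ (p , l , e) → ∈-filter⁺ rainbowHex? (∈-allVecs _) p , l , e) (h i k)

  keyThin : ∀ i x → RainbowHex x → ThinQuad (keyOf i x)
  keyThin zero (hex x0 x1 x2 x3 x4 x5) ((_ , h , _) , _) = h
  keyThin (suc zero) (hex x0 x1 x2 x3 x4 x5) ((_ , _ , h , _) , _) = h

atMost-? : {A : Set} {M N : ℕ} {P Q : A → Set} → Decidable Q →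
  AtMost M (λ x → P x × Q x) → AtMost N (λ x → P x × ¬ Q x) → AtMost (M + N) P
atMost-? Q? = atMost-⊎ λ {x} p → case Q? x of λ { (yes y) → inj₁ (p , y) ; (no ny) → inj₂ (p , ny) }

atMost-?* : {A : Set} (T : ℕ) {M N : ℕ} {P Q : A → Set} → Decidable Q →
  AtMost (T * M) (λ x → P x × Q x) → AtMost (T * N) (λ x → P x × ¬ Q x) → AtMost (T * (M + N)) P
atMost-?* T {M} {N} Q? a b = atMost-≤ (≤-reflexive (sym (*-distribˡ-+ T M N))) (atMost-? Q? a b)

-- Counting three-paths

module Constants₃ (q : ℕ) where

  open Constants q

  -- The first ten summands of `C₂` belong to the exceptional cases, the last one to the two labels
  -- of the rainbow hexagons. Those of `C₃` belong to a thick first corner, a thick second corner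
  -- and two thin corners.
  C₂ C₃ : ℕ
  C₂ = Kₜ + (Kₜ + (Kₜ + (L₀ * Kₜ + (L₀ * Kₜ + (Kₜ + (Kₜ + (Kₜ + (Kₜ + (Kₜ + 2 * (M₂ * M₂))))))))))
  C₃ = C₁ * L₀ + (C₁ * L₀ + suc C₂ * C₂)

module ThreePathCount {n : ℕ} (c : Colouring n) (pc : ProperColouring c) (q : ℕ)
  (noRainbow : ¬ HasRainbowCycle c (5 + q * 2)) where

  open Coloured c pc
  open NoRainbow q noRainbow
  open ThreePaths c pc q noRainbow
  open Constants q
  open Constants₃ q

  private
    g₀ g₂ g₅ : Vec V 6 → Vec V 4
    g₀ (hex x0 x1 x2 x3 x4 x5) = quad x0 x1 x2 x3
    g₂ (hex x0 x1 x2 x3 x4 x5) = quad x2 x3 x4 x5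
    g₅ (hex x0 x1 x2 x3 x4 x5) = quad x5 x0 x1 x2

    at : Fin 6 → Vec V 6 → V
    at i x = Vec.lookup x i

    P₀ : Vec V 6 → Set
    P₀ (hex x0 x1 x2 x3 x4 x5) = ThinPath x0 x1 x2 x3 × ThinPath x0 x5 x4 x3

    -- Three overlaps of two parallel paths, thickness of the new corners at the common ends x0 and
    -- x3, and the colour coincidences that `RainbowHex` forbids.
    Q₁ Q₂ Q₃ Q₄ Q₅ Q₆ Q₇ Q₈ Q₉ Q₁₀ : Vec V 6 → Set
    Q₁ (hex x0 x1 x2 x3 x4 x5) = x1 ≡ x5
    Q₂ (hex x0 x1 x2 x3 x4 x5) = x2 ≡ x4
    Q₃ (hex x0 x1 x2 x3 x4 x5) = x2 ≡ x5
    Q₄ (hex x0 x1 x2 x3 x4 x5) = Thick x1 x0 x5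
    Q₅ (hex x0 x1 x2 x3 x4 x5) = Thick x2 x3 x4
    Q₆ (hex x0 x1 x2 x3 x4 x5) = c x0 x5 ≡ c x1 x2
    Q₇ (hex x0 x1 x2 x3 x4 x5) = c x3 x4 ≡ c x1 x2
    Q₈ (hex x0 x1 x2 x3 x4 x5) = c x5 x4 ≡ c x1 x2
    Q₉ (hex x0 x1 x2 x3 x4 x5) = c x0 x5 ≡ c x3 x4
    Q₁₀ (hex x0 x1 x2 x3 x4 x5) = c x1 x0 ≡ c x2 x3

    Core₅ : Vec V 6 → Set
    Core₅ (hex x0 x1 x2 x3 x4 x5) = ThinPath x0 x1 x2 x3 × ThinPath x3 x4 x5 x0 × ThinPath x5 x0 x1 x2 × ThinPath x2 x3 x4 x5

    rainbow : ∀ x → ((((Core₅ x × ¬ Q₆ x) × ¬ Q₇ x) × ¬ Q₈ x) × ¬ Q₉ x) × ¬ Q₁₀ x → RainbowHex x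
    rainbow (hex _ _ _ _ _ _) (((((h , a) , b) , d) , e) , f) = h , a , b , d , e , f

    core₅ : ∀ x → ((((P₀ x × ¬ Q₁ x) × ¬ Q₂ x) × ¬ Q₃ x) × ¬ Q₄ x) × ¬ Q₅ x → Core₅ x
    core₅ (hex x0 x1 x2 x3 x4 x5) ((((((h@(((a , b , ne) , _) , t , t′) , h′@(((a′ , b′ , ne′) , (_ , d′ , ne″) , _) , _)) , n₁) ,
        n₂) , n₃) , n₄) , n₅) =
      h , thinPath-sym h′ ,
      (((~-sym a′ , a , n₁) , (a , b , ne) , n₃ ∘ sym) , n₄ ∘ thick-sym , t) ,
      (((proj₁ (proj₂ (proj₁ (proj₂ (proj₁ h)))) , ~-sym d′ , n₂ ∘ sym) , (~-sym d′ , ~-sym b′ , ne″ ∘ sym) , n₃) , n₅ , proj₂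
          (proj₂ h′) ∘ thick-sym)

  module _ {t : ℕ} (ht : AtMost t ThinQuad) where

    private
      -- In each of the ten exceptional cases four consecutive vertices leave boundedly many choices for the other two.
      case₁ : AtMost (t * Kₜ) (λ x → P₀ x × Q₁ x)
      case₁ = atMost-window _≟⁴_ g₀ ht (λ { {hex _ _ _ _ _ _} ((h , _) , _) → h })
        λ { (hex x0 x1 x2 x3 _ _) _ → atMost-injective _≟ᵛ_ (at 4F)
          (λ { {hex _ _ _ _ _ _} (((_ , (_ , t , _) , _ , th) , refl) , refl) → t , th })
          (λ { {hex _ _ _ _ _ _} {hex _ _ _ _ _ _} ((_ , refl) , refl) ((_ , refl) , refl) refl → refl }) (thin-mid x1 x3) }

      case₂ : AtMost (t * Kₜ) (λ x → (P₀ x × ¬ Q₁ x) × Q₂ x)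
      case₂ = atMost-window _≟⁴_ g₀ ht (λ { {hex _ _ _ _ _ _} (((h , _) , _) , _) → h })
        λ { (hex x0 x1 x2 x3 _ _) _ → atMost-injective _≟ᵛ_ (at 5F)
          (λ { {hex _ _ _ _ _ _} ((((_ , (t , _ , _) , th , _) , _) , refl) , refl) → t , th })
          (λ { {hex _ _ _ _ _ _} {hex _ _ _ _ _ _} ((_ , refl) , refl) ((_ , refl) , refl) refl → refl }) (thin-mid x0 x2) }

      case₃ : AtMost (t * Kₜ) (λ x → ((P₀ x × ¬ Q₁ x) × ¬ Q₂ x) × Q₃ x)
      case₃ = atMost-window _≟⁴_ g₀ ht (λ { {hex _ _ _ _ _ _} ((((h , _) , _) , _) , _) → h })
        λ { (hex x0 x1 x2 x3 _ _) _ → atMost-injective _≟ᵛ_ (at 4F)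
          (λ { {hex _ _ _ _ _ _} (((((_ , (_ , t , _) , _ , th) , _) , _) , refl) , refl) → t , th })
          (λ { {hex _ _ _ _ _ _} {hex _ _ _ _ _ _} ((_ , refl) , refl) ((_ , refl) , refl) refl → refl }) (thin-mid x2 x3) }

      case₄ : AtMost (t * (L₀ * Kₜ)) (λ x → (((P₀ x × ¬ Q₁ x) × ¬ Q₂ x) × ¬ Q₃ x) × Q₄ x)
      case₄ = atMost-window _≟⁴_ g₀ ht (λ { {hex _ _ _ _ _ _} (((((h , _) , _) , _) , _) , _) → h })
        λ { (hex x0 x1 x2 x3 _ _) _ → atMost-fibre _≟ᵛ_ {Q = λ y → TwoPath x1 x0 y × Thick x1 x0 y}
          (at 5F)
          (λ { {hex _ _ _ _ _ _} (((((((((a , _) , _) , _) , (((a′ , _) , _) , _)) , n₁) , _) , _) , th) , refl) →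
               (~-sym a , a′ , n₁ ∘ sym) , th })
          (thick-next x1 x0)
          λ y _ → atMost-injective _≟ᵛ_ (at 4F)
            (λ { {hex _ _ _ _ _ _} (((((((_ , (_ , t , _) , _ , th) , _) , _) , _) , _) , refl) , refl) → t , th })
            (λ { {hex _ _ _ _ _ _} {hex _ _ _ _ _ _} ((_ , refl) , refl) ((_ , refl) , refl) refl → refl }) (thin-mid y x3) }

      case₅ : AtMost (t * (L₀ * Kₜ)) (λ x → ((((P₀ x × ¬ Q₁ x) × ¬ Q₂ x) × ¬ Q₃ x) × ¬ Q₄ x) × Q₅ x)
      case₅ = atMost-window _≟⁴_ g₀ ht (λ { {hex _ _ _ _ _ _} ((((((h , _) , _) , _) , _) , _) , _) → h })
        λ { (hex x0 x1 x2 x3 _ _) _ → atMost-fibre _≟ᵛ_ {Q = λ y → TwoPath x2 x3 y × Thick x2 x3 y}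
          (at 4F)
          (λ { {hex _ _ _ _ _ _} ((((((((((_ , (_ , d , _) , _) , _) , ((_ , (_ , d′ , _) , _) , _)) , _) , n₂) , _) , _) , th))
              , refl) →
               (d , ~-sym d′ , n₂ ∘ sym) , th })
          (thick-next x2 x3)
          λ y _ → atMost-injective _≟ᵛ_ (at 5F)
            (λ { {hex _ _ _ _ _ _} ((((((((_ , (t , _ , _) , th , _) , _) , _) , _) , _) , _) , refl) , refl) → t , th })
            (λ { {hex _ _ _ _ _ _} {hex _ _ _ _ _ _} ((_ , refl) , refl) ((_ , refl) , refl) refl → refl }) (thin-mid x0 y) }

      -- From here on the window contains one of the two edges of equal colour and just one end of
      -- the other. Properness gives the second end, and the last vertex is a thin middle.
      case₆ : ∀ {P : Vec V 6 → Set} → (∀ {x} → P x → Core₅ x × Q₆ x) → AtMost (t * Kₜ) P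
      case₆ f = atMost-⊆ f (atMost-window _≟⁴_ g₀ ht (λ { {hex _ _ _ _ _ _} ((h , _) , _) → h })
        λ { (hex x0 x1 x2 x3 _ _) _ → atMost-injective (≡-dec _≟ᵛ_ _≟ᵛ_) (λ { (hex _ _ _ _ x4 x5) → x5 , x4 })
          (λ { {hex _ _ _ _ _ _} (((_ , h , _) , e) , refl) → thinPath-sym h , e })
          (λ { {hex _ _ _ _ _ _} {hex _ _ _ _ _ _} (_ , refl) (_ , refl) refl → refl }) (fixFirstColour x0 x3 (c x1 x2)) })

      case₇ : ∀ {P : Vec V 6 → Set} → (∀ {x} → P x → Core₅ x × Q₇ x) → AtMost (t * Kₜ) P
      case₇ f = atMost-⊆ f (atMost-window _≟⁴_ g₀ ht (λ { {hex _ _ _ _ _ _} ((h , _) , _) → h })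
        λ { (hex x0 x1 x2 x3 _ _) _ → atMost-injective (≡-dec _≟ᵛ_ _≟ᵛ_) (λ { (hex _ _ _ _ x4 x5) → x4 , x5 })
          (λ { {hex _ _ _ _ _ _} (((_ , h , _) , e) , refl) → h , e })
          (λ { {hex _ _ _ _ _ _} {hex _ _ _ _ _ _} (_ , refl) (_ , refl) refl → refl }) (fixFirstColour x3 x0 (c x1 x2)) })

      case₈ : ∀ {P : Vec V 6 → Set} → (∀ {x} → P x → Core₅ x × Q₈ x) → AtMost (t * Kₜ) P
      case₈ f = atMost-⊆ f (atMost-window _≟⁴_ g₅ ht (λ { {hex _ _ _ _ _ _} ((_ , _ , h , _) , _) → h })
        λ { (hex x0 x1 x2 _ _ x5) _ → atMost-injective (≡-dec _≟ᵛ_ _≟ᵛ_) (λ { (hex _ _ _ x3 x4 _) → x3 , x4 })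
          (λ { {hex _ _ _ _ _ _} (((_ , _ , _ , h) , e) , refl) → h , e })
          (λ { {hex _ _ _ _ _ _} {hex _ _ _ _ _ _} (_ , refl) (_ , refl) refl → refl }) (fixSecondColour x2 x5 (c x1 x2)) })

      case₉ : ∀ {P : Vec V 6 → Set} → (∀ {x} → P x → Core₅ x × Q₉ x) → AtMost (t * Kₜ) P
      case₉ f = atMost-⊆ f (atMost-window _≟⁴_ g₂ ht (λ { {hex _ _ _ _ _ _} ((_ , _ , _ , h) , _) → h })
        λ { (hex _ _ x2 x3 x4 x5) _ → atMost-injective (≡-dec _≟ᵛ_ _≟ᵛ_) (λ { (hex x0 x1 _ _ _ _) → x0 , x1 })
          (λ { {hex _ _ _ _ _ _} (((_ , _ , h , _) , e) , refl) → h , trans (c-sym _ _) e })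
          (λ { {hex _ _ _ _ _ _} {hex _ _ _ _ _ _} (_ , refl) (_ , refl) refl → refl }) (fixFirstColour x5 x2 (c x3 x4)) })

      case₁₀ : ∀ {P : Vec V 6 → Set} → (∀ {x} → P x → Core₅ x × Q₁₀ x) → AtMost (t * Kₜ) P
      case₁₀ f = atMost-⊆ f (atMost-window _≟⁴_ g₅ ht (λ { {hex _ _ _ _ _ _} ((_ , _ , h , _) , _) → h })
        λ { (hex x0 x1 x2 _ _ x5) _ → atMost-injective (≡-dec _≟ᵛ_ _≟ᵛ_) (λ { (hex _ _ _ x3 x4 _) → x3 , x4 })
          (λ { {hex _ _ _ _ _ _} (((_ , _ , _ , h) , e) , refl) → h , sym e })
          (λ { {hex _ _ _ _ _ _} {hex _ _ _ _ _ _} (_ , refl) (_ , refl) refl → refl }) (fixFirstColour x2 x5 (c x1 x0)) })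

      rainbowHex-count : AtMost (t * (2 * (M₂ * M₂))) RainbowHex
      rainbowHex-count with labelling
      ... | label , h = atMost-≤ (≤-reflexive (swap t (M₂ * M₂))) (atMost-⊆ (λ {x} p → label x , p , refl)
          (atMost-⋃ 2 {P = λ i x → RainbowHex x × label x ≡ i} λ i → atMost-fibre _≟⁴_ {Q = ThinQuad} (keyOf i)
            (λ {x} (p , _) → keyThin i x p) ht λ k _ → atMost-⊆ (λ { ((p , l) , e) → p , l , e }) (h i k)))
        where
        swap : ∀ t m → 2 * (t * m) ≡ t * (2 * m)
        swap = solve-∀

    -- The bound is linear in the unknown number t of thin paths itself; `heavy≤light` turns this
    -- into a bound by n².
    hexPairs : AtMost (t * C₂) P₀
    hexPairs =
      atMost-?* t (λ { (hex _ _ _ _ _ _) → _ ≟ᵛ _ }) case₁ (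
      atMost-?* t (λ { (hex _ _ _ _ _ _) → _ ≟ᵛ _ }) case₂ (
      atMost-?* t (λ { (hex _ _ _ _ _ _) → _ ≟ᵛ _ }) case₃ (
      atMost-?* t (λ { (hex _ _ _ _ _ _) → thick? _ _ _ }) case₄ (
      atMost-?* t (λ { (hex _ _ _ _ _ _) → thick? _ _ _ }) case₅ (atMost-⊆ {Q = Core₅} (λ {x} → core₅ x) (
      atMost-?* t (λ { (hex _ _ _ _ _ _) → _ ≟ᶜ _ }) (case₆ id) (
      atMost-?* t (λ { (hex _ _ _ _ _ _) → _ ≟ᶜ _ }) (case₇ λ ((a , _) , b) → a , b) (
      atMost-?* t (λ { (hex _ _ _ _ _ _) → _ ≟ᶜ _ }) (case₈ λ (((a , _) , _) , b) → a , b) (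
      atMost-?* t (λ { (hex _ _ _ _ _ _) → _ ≟ᶜ _ }) (case₉ λ ((((a , _) , _) , _) , b) → a , b) (
      atMost-?* t (λ { (hex _ _ _ _ _ _) → _ ≟ᶜ _ }) (case₁₀ λ (((((a , _) , _) , _) , _) , b) → a , b)
        (atMost-⊆ {Q = RainbowHex} (λ {x} → rainbow x) rainbowHex-count)))))))))))

  private
    ends : Vec V 4 → V × V
    ends (quad x0 x1 x2 x3) = x0 , x3

    _≟²_ : DecidableEquality (V × V)
    _≟²_ = ≡-dec _≟ᵛ_ _≟ᵛ_

    quads : List (Vec V 4)
    quads = filter thinQuad? (allVecs 4 n)

    unique-quads : Unique quads
    unique-quads = Uniqueₚ.filter⁺ thinQuad? (unique-allVecs 4 n)

    quads-thin : ∀ {x} → x ∈ quads → ThinQuad x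
    quads-thin m = proj₂ (∈-filter⁻ thinQuad? {xs = allVecs 4 n} m)

    parallel : V × V → List (Vec V 4)
    parallel e = filter (λ y → ends y ≟² e) quads

    pairs-count : AtMost (length quads * C₂) (λ ((x , y) : Vec V 4 × Vec V 4) → ThinQuad x × ThinQuad y × ends y ≡ ends x)
    pairs-count = atMost-injective (Vecₚ.≡-dec _≟ᵛ_)
      (λ { (quad x0 x1 x2 x3 , quad _ y₁ y₂ _) → hex x0 x1 x2 x3 y₂ y₁ })
      (λ { {quad _ _ _ _ , quad _ _ _ _} (h , h′ , refl) → h , h′ })
      (λ { {quad _ _ _ _ , quad _ _ _ _} {quad _ _ _ _ , quad _ _ _ _} (_ , _ , refl) (_ , _ , refl) refl → refl })
      (hexPairs (atMost-list quads λ h → ∈-filter⁺ thinQuad? (∈-allVecs _) h))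

    heavy? : Decidable (λ x → suc C₂ ≤ length (parallel (ends x)))
    heavy? x = suc C₂ ≤? length (parallel (ends x))

    hs ls : List (Vec V 4)
    hs = filter heavy? quads
    ls = filter (¬? ∘ heavy?) quads

    heavy-count : suc C₂ * length hs ≤ length quads * C₂
    heavy-count = atMost-pairs {P = λ x → x ∈ quads × suc C₂ ≤ length (parallel (ends x))} (parallel ∘ ends)
      (λ {x} (x∈ , h) → Uniqueₚ.filter⁺ (λ y → ends y ≟² ends x) unique-quads , h , λ {y} y∈ →
        let (y∈q , e) = ∈-filter⁻ (λ y → ends y ≟² ends x) {xs = quads} y∈ in quads-thin x∈ , quads-thin y∈q , e)
      pairs-count hs (Uniqueₚ.filter⁺ heavy? unique-quads) (All.tabulate λ m → ∈-filter⁻ heavy? m)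

    light-count : length ls ≤ (n * n) * C₂
    light-count = bound (atMost-fibre _≟²_ {P = λ x → x ∈ quads × ¬ suc C₂ ≤ length (parallel (ends x))} ends (λ _ → tt)
        (atMost-fibre _≟ᵛ_ proj₁ (λ _ → tt) atMost-Fin λ _ _ →
          atMost-injective _≟ᵛ_ proj₂ (λ _ → tt) (λ { (_ , refl) (_ , refl) refl → refl }) atMost-Fin)
        (λ e _ → atMost-inhabited λ { x ((_ , l) , refl) → atMost-≤ (≤-pred (≰⇒> l)) (atMost-list (parallel (ends x))
          λ { ((y∈ , _) , e′) → ∈-filter⁺ (λ y → ends y ≟² ends x) y∈ e′ }) }))
      ls (Uniqueₚ.filter⁺ (¬? ∘ heavy?) unique-quads) (All.tabulate λ m → ∈-filter⁻ (¬? ∘ heavy?) m)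

    -- The heavy paths alone give (C₂ + 1)|hs| parallel pairs, but there are at most C₂(|hs| + |ls|)
    -- pairs. The threshold in `heavy?` exceeds the average by one to leave this difference.
    heavy≤light : length hs ≤ C₂ * length ls
    heavy≤light = +-cancelʳ-≤ (length hs * C₂) (length hs) (C₂ * length ls) (begin
      length hs + length hs * C₂         ≡⟨ cong (length hs +_) (*-comm (length hs) C₂) ⟩
      suc C₂ * length hs                 ≤⟨ heavy-count ⟩
      length quads * C₂                  ≡⟨ cong (_* C₂) (sym (length-filter-split heavy? quads)) ⟩
      (length hs + length ls) * C₂       ≡⟨ rearrange (length hs) (length ls) C₂ ⟩
      C₂ * length ls + length hs * C₂    ∎)
      where
      open ≤-Reasoning
      rearrange : ∀ a b d → (a + b) * d ≡ d * b + a * d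
      rearrange = solve-∀

  thinQuad-count : AtMost (suc C₂ * ((n * n) * C₂)) ThinQuad
  thinQuad-count = atMost-≤ (begin
      length quads                       ≡⟨ sym (length-filter-split heavy? quads) ⟩
      length hs + length ls              ≤⟨ +-monoˡ-≤ (length ls) heavy≤light ⟩
      C₂ * length ls + length ls         ≡⟨ +-comm _ (length ls) ⟩
      suc C₂ * length ls                 ≤⟨ *-monoʳ-≤ (suc C₂) light-count ⟩
      suc C₂ * ((n * n) * C₂)            ∎)
    (atMost-list quads λ h → ∈-filter⁺ thinQuad? (∈-allVecs _) h)
    where open ≤-Reasoning

  ThreePath : Vec V 4 → Set
  ThreePath (quad x0 x1 x2 x3) = TwoPath x0 x1 x2 × TwoPath x1 x2 x3 × x0 ≢ x3

  private
    triples : AtMost (n * (n * C₁)) (λ ((p , v , x) : V × V × V) → TwoPath p v x)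
    triples = atMost-fibre _≟ᵛ_ proj₁ (λ _ → tt) atMost-Fin λ p _ →
      atMost-injective (≡-dec _≟ᵛ_ _≟ᵛ_) proj₂ (λ { (h , refl) → h }) (λ { (_ , refl) (_ , refl) refl → refl }) (two-paths p)

    _≟³_ : DecidableEquality (V × V × V)
    _≟³_ = ≡-dec _≟ᵛ_ (≡-dec _≟ᵛ_ _≟ᵛ_)

  -- If the corner at x1 is thick, x2 and x1 leave few choices for x0, so the two-path x1 x2 x3
  -- nearly determines the path; likewise at x2.
  three-paths : AtMost ((n * n) * C₃) ThreePath
  three-paths = atMost-≤ (≤-reflexive (collect n C₁ L₀ C₂))
    (atMost-? {Q = λ { (quad x0 x1 x2 x3) → Thick x0 x1 x2 }} (λ { (quad _ _ _ _) → thick? _ _ _ })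
      (atMost-fibre _≟³_ {Q = λ (p , v , x) → TwoPath p v x} (λ { (quad x0 x1 x2 x3) → x1 , x2 , x3 })
        (λ { {quad _ _ _ _} ((_ , h , _) , _) → h }) triples
        λ { (y₁ , y₂ , y₃) _ → atMost-injective _≟ᵛ_ (λ { (quad x0 _ _ _) → x0 })
          (λ { {quad _ _ _ _} (((h , _ , _) , th) , refl) → twoPath-sym h , thick-sym th })
          (λ { {quad _ _ _ _} {quad _ _ _ _} (_ , refl) (_ , refl) refl → refl }) (thick-next y₂ y₁) })
    (atMost-? {Q = λ { (quad x0 x1 x2 x3) → Thick x1 x2 x3 }} (λ { (quad _ _ _ _) → thick? _ _ _ })
      (atMost-fibre _≟³_ {Q = λ (p , v , x) → TwoPath p v x} (λ { (quad x0 x1 x2 x3) → x0 , x1 , x2 })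
        (λ { {quad _ _ _ _} (((h , _ , _) , _) , _) → h }) triples
        λ { (y₀ , y₁ , y₂) _ → atMost-injective _≟ᵛ_ (λ { (quad _ _ _ x3) → x3 })
          (λ { {quad _ _ _ _} ((((_ , h , _) , _) , th) , refl) → h , th })
          (λ { {quad _ _ _ _} {quad _ _ _ _} (_ , refl) (_ , refl) refl → refl }) (thick-next y₁ y₂) })
      (atMost-⊆ (λ { {quad _ _ _ _} ((h , n₁) , n₂) → h , n₁ , n₂ }) thinQuad-count)))
    where
    collect : ∀ n c l d → n * (n * c) * l + (n * (n * c) * l + suc d * ((n * n) * d)) ≡ (n * n) * (c * l + (c * l + suc d * d))
    collect = solve-∀

-- Cycles as periodic sequences

%-shift : ∀ a t n .{{_ : ℕ.NonZero n}} → (a + t % n) % n ≡ (a + t) % n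
%-shift a t n = trans (%-distribˡ-+ a (t % n) n)
  (trans (cong (λ x → (a % n + x) % n) (m%n%n≡m%n t n)) (sym (%-distribˡ-+ a t n)))

%-moves : ∀ n .{{_ : ℕ.NonZero n}} d t → 0 < d → d < n → (d + t) % n ≢ t % n
%-moves n d t 0<d d<n e with d + t % n <? n
... | yes lt = <⇒≢ (m<n+m (t % n) 0<d) (sym (trans (sym (m<n⇒m%n≡m lt)) (trans (%-shift d t n) e)))
... | no nlt = <⇒≢ smaller (trans (sym (trans (cong (_% n) split) (trans ([m+n]%n≡m%n rest n)
    (m<n⇒m%n≡m (<-trans smaller (m%n<n t n))))))
                                  (trans (%-shift d t n) e))
  where
  rest = (d + t % n) ∸ n
  split : d + t % n ≡ rest + n
  split = sym (m∸n+n≡m (≮⇒≥ nlt))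
  smaller : rest < t % n
  smaller = +-cancelʳ-< n rest (t % n) (subst (_< t % n + n) split (subst (d + t % n <_) (+-comm n (t % n))
      (+-monoˡ-< (t % n) d<n)))

toℕ-mod : ∀ t l → toℕ (t mod suc l) ≡ t % suc l
toℕ-mod t l = Finₚ.toℕ-fromℕ< _

seg : {A : Set} → ∀ m → ℕ → (ℕ → A) → Vec A m
seg zero s z = []
seg (suc m) s z = z s ∷ seg m (suc s) z

seg-agree : {A : Set} → ∀ m s {z z′ : ℕ → A} → seg m s z ≡ seg m s z′ → ∀ d → d < m → z (d + s) ≡ z′ (d + s)
seg-agree (suc m) s e zero lt = Vecₚ.∷-injectiveˡ e
seg-agree (suc m) s {z} {z′} e (suc d) (s≤s lt) =
  subst (λ t → z t ≡ z′ t) (+-suc d s) (seg-agree m (suc s) (Vecₚ.∷-injectiveʳ e) d lt)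

lookup-ext : {A : Set} → ∀ {m} (v v′ : Vec A m) → (∀ i → Vec.lookup v i ≡ Vec.lookup v′ i) → v ≡ v′
lookup-ext v v′ h = trans (sym (Vecₚ.tabulate∘lookup v)) (trans (Vecₚ.tabulate-cong h) (Vecₚ.tabulate∘lookup v′))

-- With indices in all of ℕ, a change of starting point is an addition and the closing edge is an
-- edge like any other.
module Periodic {A : Set} (l : ℕ) (f : Fin (suc l) → A) where

  opaque
    z : ℕ → A
    z t = f (t mod suc l)

    z-def : ∀ t → z t ≡ f (t mod suc l)
    z-def t = refl

  z-cong : ∀ s t → s % suc l ≡ t % suc l → z s ≡ z t
  z-cong s t e = trans (z-def s) (trans
    (cong f (Finₚ.toℕ-injective (trans (toℕ-mod s l) (trans e (sym (toℕ-mod t l)))))) (sym (z-def t)))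

  z-mod : ∀ a t → z (a + t % suc l) ≡ z (a + t)
  z-mod a t = z-cong (a + t % suc l) (a + t) (%-shift a t (suc l))

  z-period : ∀ t → z (suc l + t) ≡ z t
  z-period t = trans (cong z (+-comm (suc l) t)) (z-cong (t + suc l) t ([m+n]%n≡m%n t (suc l)))

  z-lookup : ∀ i → z (toℕ i) ≡ f i
  z-lookup i = trans (z-def (toℕ i))
    (cong f (Finₚ.toℕ-injective (trans (toℕ-mod (toℕ i) l) (m<n⇒m%n≡m (Finₚ.toℕ<n i)))))

  z-toℕ-mod : ∀ a t → z (a + toℕ (t mod suc l)) ≡ z (a + t)
  z-toℕ-mod a t = trans (cong (λ x → z (a + x)) (toℕ-mod t l)) (z-mod a t)

  cyc-mod : ∀ t → cyc (t mod suc l) ≡ suc t mod suc l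
  cyc-mod t = Finₚ.toℕ-injective (trans (toℕ-cyc (t mod suc l)) (trans (cong (λ x → suc x % suc l) (toℕ-mod t l))
    (trans (%-shift 1 t (suc l)) (sym (toℕ-mod (suc t) l)))))

module Unroll {A : Set} (l : ℕ) (v : Vec A (suc l)) = Periodic l (Vec.lookup v)

module CycleWalk {n : ℕ} (c : Colouring n) (l : ℕ) (f : Fin (suc l) → Fin n) (cyclic : IsCycle c l f) where

  open Periodic l f

  adjacent : ∀ t → Adj c (z t) (z (suc t))
  adjacent t = subst₂ (Adj c) (sym (z-def t)) (trans (cong f (cyc-mod t)) (sym (z-def (suc t)))) (proj₂ cyclic (t mod suc l))

  distinct : ∀ d t → 0 < d → d < suc l → z t ≢ z (d + t)
  distinct d t 0<d d<L e = %-moves (suc l) d t 0<d d<L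
    (trans (sym (toℕ-mod (d + t) l))
      (trans (cong toℕ (sym (proj₁ cyclic (t mod suc l) ((d + t) mod suc l) (trans (sym (z-def t)) (trans e (z-def (d + t)))))))
          (toℕ-mod t l)))

unroll-agree : {A : Set} → ∀ l (v v′ : Vec A (suc l)) s →
  (∀ d → d < suc l → Unroll.z l v (d + s) ≡ Unroll.z l v′ (d + s)) → v ≡ v′
unroll-agree l v v′ s h = lookup-ext v v′ λ i → trans (sym (Unroll.z-lookup l v i))
  (trans (shift v (toℕ i)) (trans (h _ (m%n<n (wind (toℕ i)) (suc l))) (trans (sym (shift v′ (toℕ i))) (Unroll.z-lookup l v′ i))))
  where
  -- Adding s full periods first keeps the subtraction of s from truncating.
  wind : ℕ → ℕ
  wind t = (t + s * suc l) ∸ s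
  shift : ∀ v t → Unroll.z l v t ≡ Unroll.z l v (wind t % suc l + s)
  shift v t = trans (z-cong t (t + s * suc l) (sym ([m+kn]%n≡m%n t s (suc l))))
    (trans (cong z (sym (trans (+-comm s (wind t)) (m∸n+n≡m (≤-trans (m≤m*n s (suc l)) (m≤n+m (s * suc l) t))))))
    (trans (sym (z-mod s (wind t))) (cong z (+-comm s _))))
    where open Unroll l v

-- Counting the 2k-cycles for k at least 3

module CycleCount {n : ℕ} (c : Colouring n) (pc : ProperColouring c) (q : ℕ)
  (noRainbow : ¬ HasRainbowCycle c (5 + q * 2)) where

  open Coloured c pc
  open NoRainbow q noRainbow
  open ThreePathCount c pc q noRainbow
  open Constants q
  open Constants₃ q

  common-fresh : ∀ a b F G → length F ≤ L + L → length G ≤ L → K₀ < length (common a b) →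
    ∃ λ w → (a ~ w × w ~ b) × ¬ (w ∈ F ⊎ c a w ∈ G ⊎ c b w ∈ G)
  common-fresh a b F G F≤ G≤ large =
    let (w , w∈ , nb) = pick {P = λ w → a ~ w × w ~ b} {Q = λ w → w ∈ F ⊎ c a w ∈ G ⊎ c b w ∈ G}
          (λ w → (w ∈?ᵛ F) ⊎-dec (c a w ∈?ᶜ G) ⊎-dec (c b w ∈?ᶜ G))
          (atMost-∪
            (atMost-map∈′ _≟ᵛ_ {L = L + L} id F F≤ λ y → atMost-1 λ { (_ , refl) (_ , refl) → refl })
          (atMost-∪
            (atMost-map∈′ _≟ᶜ_ (c a) G G≤ λ y → atMost-1 λ { ((e , _) , eq) (_ , eq′) → proper e (trans eq (sym eq′)) })
            (atMost-map∈′ _≟ᶜ_ (c b) G G≤ λ y → atMost-1 λ { ((_ , e) , eq) (_ , eq′) → proper (~-sym e) (trans eq (sym eq′)) })))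
          (common a b) (Uniqueₚ.filter⁺ both? (Uniqueₚ.allFin⁺ n))
          (All.tabulate λ w∈ → proj₂ (∈-filter⁻ both? {xs = allFin n} w∈)) (≤-<-trans room large)
    in w , proj₂ (∈-filter⁻ both? {xs = allFin n} w∈) , nb
    where
    both? : Decidable (λ w → a ~ w × w ~ b)
    both? w = (a ~? w) ×-dec (w ~? b)
    regroup : ∀ x → (x + x) * 1 + (x * 1 + x * 1) ≡ (x * 1 + (x * 1 + x * 1)) + x
    regroup = solve-∀
    room : (L + L) * 1 + (L * 1 + L * 1) ≤ K₀
    room = ≤-trans (≤-reflexive (regroup L)) (+-monoˡ-≤ L 3L≤M₁)

  -- Two vertices are prepended at a time, as a two-path from the current end, so two vertices
  -- together cost only one factor n.
  Segment : ∀ j → Vec V (4 + j * 2) → Set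
  Segment zero w = ThreePath w
  Segment (suc j) (a ∷ b ∷ x ∷ w) = TwoPath x b a × Segment j (x ∷ w)

  S : ℕ → ℕ
  S j = (n * n) * C₃ * (n * C₁) ^ j

  segment-count : ∀ j → AtMost (S j) (Segment j)
  segment-count zero = atMost-≤ (≤-reflexive (sym (*-identityʳ _))) three-paths
  segment-count (suc j) = atMost-≤ (≤-reflexive (trans (*-assoc ((n * n) * C₃) _ _) (cong ((n * n) * C₃ *_) (*-comm ((n * C₁) ^ j)
      (n * C₁)))))
    (atMost-fibre (Vecₚ.≡-dec _≟ᵛ_) {Q = Segment j} (λ { (a ∷ b ∷ w) → w })
      (λ { {a ∷ b ∷ x ∷ w} (_ , h) → h }) (segment-count j)
      λ { (x ∷ w) _ → atMost-injective (≡-dec _≟ᵛ_ _≟ᵛ_) (λ { (a ∷ b ∷ _) → b , a })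
        (λ { {a ∷ b ∷ x ∷ w} ((h , _) , refl) → h })
        (λ { {a ∷ b ∷ x ∷ w} {a′ ∷ b′ ∷ x′ ∷ w′} (_ , refl) (_ , refl) refl → refl }) (two-paths x) })

  seg-Segment : ∀ j s (z : ℕ → V) → (∀ t → TwoPath (z t) (z (1 + t)) (z (2 + t))) → (∀ t → z t ≢ z (3 + t)) →
    Segment j (seg (4 + j * 2) s z)
  seg-Segment zero s z two three = two s , two (suc s) , three s
  seg-Segment (suc j) s z two three = twoPath-sym (two s) , seg-Segment j (2 + s) z two three

  l : ℕ
  l = 5 + q * 2

  Cyclic : Vec V (suc l) → Set
  Cyclic v = IsCycle c l (Vec.lookup v)

  ThickAt : Vec V (suc l) → ℕ → Set
  ThickAt v t = Thick (z t) (z (1 + t)) (z (2 + t))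
    where open Unroll l v

  colourAt : Vec V (suc l) → ℕ → Col
  colourAt v t = c (z t) (z (1 + t))
    where open Unroll l v

  module OnCycle (v : Vec V (suc l)) (cyclic : Cyclic v) where

    open Unroll l v

    open CycleWalk c l (Vec.lookup v) cyclic public

    twoPath : ∀ t → TwoPath (z t) (z (1 + t)) (z (2 + t))
    twoPath t = adjacent t , adjacent (suc t) , λ e → distinct 2 t (s≤s z≤n) (s≤s (s≤s (s≤s z≤n))) (sym e)

    three : ∀ t → z t ≢ z (3 + t)
    three t = distinct 3 t (s≤s z≤n) (s≤s (s≤s (s≤s (s≤s z≤n))))

    thickAt-mod : ∀ t → ThickAt v t → ThickAt v (toℕ (t mod suc l))
    thickAt-mod t = subst id (sym (cong₂ (λ f g → f g) (cong₂ Thick (z-toℕ-mod 0 t) (z-toℕ-mod 1 t)) (z-toℕ-mod 2 t)))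

    thickAt-mod⁻ : ∀ a t → ThickAt v (a + toℕ (t mod suc l)) → ThickAt v (a + t)
    thickAt-mod⁻ a t = subst id (cong₂ (λ f g → f g) (cong₂ Thick (z-toℕ-mod a t) (z-toℕ-mod (1 + a) t)) (z-toℕ-mod (2 + a) t))

    -- If every second vertex of the cycle is thick, these vertices can be exchanged one after another, each time
    -- with two edges of new colours.
    module _ (i : ℕ) (thick : ∀ t → ThickAt v t → ThickAt v (2 + t)) (start-thick : ThickAt v i) where

      hub : ℕ → V
      hub j = z (j * 2 + i)

      hub-thick : ∀ j → ThickAt v (j * 2 + i)
      hub-thick zero = start-thick
      hub-thick (suc j) = thick (j * 2 + i) (hub-thick j)

      hub≢ : ∀ j → hub j ≢ hub (suc j)
      hub≢ j = distinct 2 (j * 2 + i) (s≤s z≤n) (s≤s (s≤s (s≤s z≤n)))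

      hub≢hub : ∀ j j′ → j < j′ → j′ < 3 + q → hub j ≢ hub j′
      hub≢hub j j′ lt lt′ e = distinct ((j′ ∸ j) * 2) (j * 2 + i) (*-monoˡ-< 2 (m<n⇒0<n∸m lt))
        (*-monoˡ-< 2 (≤-<-trans (m∸n≤m j′ j) lt′))
        (trans e (cong z (trans (cong (λ x → x * 2 + i) (sym (m∸n+n≡m (<⇒≤ lt))))
          (trans (cong (_+ i) (*-distribʳ-+ 2 (j′ ∸ j) j)) (+-assoc ((j′ ∸ j) * 2) (j * 2) i)))))

      hubs : List V
      hubs = applyUpTo hub (3 + q)

      refresh : ∀ r j {m us cs} → Trail (hub 0) m (hub j) us cs → j + suc r ≡ 3 + q → m ≡ j * 2 →
        (∀ j′ → j < j′ → j′ < 3 + q → hub j′ ∉ hub j ∷ toList us) → ⊥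
      refresh r j {m} {us} {cs} tr len refl ahead = continue r len
        where
        j*2≤ : suc (j * 2) ≤ 5 + q * 2
        j*2≤ = ≤-pred (*-monoˡ-≤ 2 (subst (suc j ≤_) len (subst (_≤ j + suc r) (+-comm j 1) (+-monoʳ-≤ j (s≤s z≤n)))))
        size′ : length (toList cs) ≤ L
        size′ = ≤-trans (≤-reflexive (proj₂ (trail-length tr))) (≤-trans (n≤1+n _) (≤-trans j*2≤ (n≤1+n _)))
        size : length (hubs ++ hub j ∷ toList us) ≤ L + L
        size = ≤-trans (≤-reflexive (length-++ hubs)) (+-mono-≤
          (≤-trans (≤-reflexive (length-applyUpTo hub (3 + q))) (m≤m*n (3 + q) 2))
          (≤-trans (≤-reflexive (proj₁ (trail-length tr))) (≤-trans j*2≤ (n≤1+n _))))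
        -- All hubs are forbidden besides the vertices already used, so that the trail can still
        -- pass through the later ones.
        choice = common-fresh (hub j) (hub (suc j)) (hubs ++ hub j ∷ toList us) (toList cs) size size′ (proj₂ (proj₂ (hub-thick j)))
        w : V
        w = proj₁ choice
        edges : hub j ~ w × w ~ hub (suc j)
        edges = proj₁ (proj₂ choice)
        nb : ¬ (w ∈ hubs ++ hub j ∷ toList us ⊎ c (hub j) w ∈ toList cs ⊎ c (hub (suc j)) w ∈ toList cs)
        nb = proj₂ (proj₂ choice)
        w∉hubs : ∀ j′ → j′ < 3 + q → hub j′ ≢ w
        w∉hubs j′ lt e = nb (inj₁ (∈-++⁺ˡ (subst (_∈ hubs) e (∈-applyUpTo⁺ hub lt))))
        tr′ : Trail (hub 0) (suc (j * 2)) w (hub j ∷ us) (c (hub j) w ∷ cs)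
        tr′ = step tr (proj₁ edges) (λ b → nb (inj₁ (∈-++⁺ʳ hubs b))) (nb ∘ inj₂ ∘ inj₁)
        fresh : c w (hub (suc j)) ∉ c (hub j) w ∷ toList cs
        fresh (here e) = hub≢ j (sym (proper (proj₂ edges) (trans e (c-sym (hub j) w))))
        fresh (there b) = nb (inj₂ (inj₂ (subst (_∈ toList cs) (c-sym w _) b)))
        continue : ∀ r → j + suc r ≡ 3 + q → ⊥
        continue zero len′ with suc-injective (trans (+-comm 1 j) len′)
        ... | refl = noRainbow (close tr′ (subst (w ~_) back (proj₂ edges)) (subst (λ x → c w x ∉ c (hub j) w ∷ toList cs)
            back fresh))
          where
          back : hub (3 + q) ≡ hub 0
          back = z-period i
        continue (suc r) len′ = refresh r (suc j)
          (step tr′ (proj₂ edges) (λ { (here e) → w∉hubs (suc j) suc-j< e ; (there b) → ahead (suc j) ≤-refl suc-j< b }) fresh)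
          len″ refl
          λ { j′ lt lt′ (here e) → hub≢hub (suc j) j′ lt lt′ (sym e)
            ; j′ lt lt′ (there (here e)) → w∉hubs j′ lt′ e
            ; j′ lt lt′ (there (there b)) → ahead j′ (≤-trans (n≤1+n _) lt) lt′ b }
          where
          len″ : suc j + suc r ≡ 3 + q
          len″ = trans (sym (+-suc j (suc r))) len′
          suc-j< : suc j < 3 + q
          suc-j< = subst (suc j <_) len″ (m<m+n (suc j) (s≤s z≤n))

      all-thick : ⊥
      all-thick = refresh (2 + q) 0 start refl refl λ { j′ lt lt′ (here e) → hub≢hub 0 j′ lt lt′ (sym e) }

module CycleBound {n : ℕ} (c : Colouring n) (pc : ProperColouring c) (q : ℕ)
  (noRainbow : ¬ HasRainbowCycle c (5 + q * 2)) where

  open Coloured c pc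
  open NoRainbow q noRainbow
  open CycleCount c pc q noRainbow
  open Constants q
  open Constants₃ q
  open Unroll {A = V} l

  private
    _≟ʷ_ : ∀ {m} → DecidableEquality (Vec V m)
    _≟ʷ_ = Vecₚ.≡-dec _≟ᵛ_

    along : ∀ {a a′ b b′ x : V} → a ≡ a′ → b ≡ b′ → TwoPath a b x × Thick a b x → TwoPath a′ b′ x × Thick a′ b′ x
    along refl refl h = h

    between : ∀ {a a′ b b′ x : V} → a ≡ a′ → b ≡ b′ → TwoPath a x b × ¬ Thick a x b → TwoPath a′ x b′ × ¬ Thick a′ x b′
    between refl refl h = h

    segOf : ℕ → Vec V (suc l) → Vec V (4 + q * 2)
    segOf s v = seg (4 + q * 2) s (z v)

    segOf-Segment : ∀ {v} s → Cyclic v → Segment q (segOf s v)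
    segOf-Segment {v} s cy = seg-Segment q s (z v) twoPath three
      where open OnCycle v cy

    on-segment : ∀ {v v′} s → segOf s v ≡ segOf s v′ → ∀ d → d < 4 + q * 2 → z v (d + s) ≡ z v′ (d + s)
    on-segment s = seg-agree (4 + q * 2) s

    wrap : ∀ {v v′} d s t → d < 4 + q * 2 → d + s ≡ suc l + t → segOf s v ≡ segOf s v′ → z v t ≡ z v′ t
    wrap {v} {v′} d s t lt e same = trans (sym (z-period v t)) (trans (cong (z v) (sym e))
      (trans (on-segment {v} {v′} s same d lt) (trans (cong (z v′) e) (z-period v′ t))))

    rest-agree : ∀ {v v′} i → segOf (3 + i) v ≡ segOf (3 + i) v′ → z v (1 + i) ≡ z v′ (1 + i) → z v (2 + i) ≡ z v′ (2 + i) → v ≡ v′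
    rest-agree {v} {v′} i same e₁ e₂ = unroll-agree l v v′ (1 + i) λ
      { zero _ → e₁ ; (suc zero) _ → e₂
      ; (suc (suc d)) (s≤s (s≤s lt)) → subst (λ t → z v t ≡ z v′ t) (index d i) (on-segment {v} {v′} (3 + i) same d lt) }
      where
      index : ∀ d i → d + (3 + i) ≡ 2 + d + (1 + i)
      index = solve-∀

    end₀ : ∀ q i → 3 + q * 2 + (3 + i) ≡ 6 + q * 2 + i
    end₀ = solve-∀

    end₁ : ∀ q i → 2 + q * 2 + (3 + suc i) ≡ 6 + q * 2 + i
    end₁ = solve-∀

  -- z (2 + i) is a next vertex after the thick vertex z (1 + i), and z (3 + i) is a thin middle.
  thick-thin-count : ∀ i → AtMost (S q * (L₀ * Kₜ)) (λ v → Cyclic v × ThickAt v i × ¬ ThickAt v (2 + i))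
  thick-thin-count i = atMost-window _≟ʷ_ (segOf (4 + i)) (segment-count q) (λ {v} (cy , _) → segOf-Segment {v} (4 + i) cy)
    λ v₀ _ → atMost-fibre _≟ᵛ_ {Q = λ y → TwoPath (z v₀ i) (z v₀ (1 + i)) y × Thick (z v₀ i) (z v₀ (1 + i)) y}
      (λ v → z v (2 + i))
      (λ {v} ((cy , th , _) , same) → along
        (wrap {v} {v₀} (2 + q * 2) (4 + i) i (s≤s (s≤s (s≤s (n≤1+n _)))) (end₁ q i) same)
        (wrap {v} {v₀} (3 + q * 2) (4 + i) (1 + i) ≤-refl (end₀ q (1 + i)) same)
        (OnCycle.twoPath v cy i , th))
      (thick-next _ _)
      λ y _ → atMost-injective _≟ᵛ_ (λ v → z v (3 + i))
        (λ {v} (((cy , _ , nth) , same) , e) → between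
          e (on-segment {v} {v₀} (4 + i) same 0 (s≤s z≤n)) (OnCycle.twoPath v cy (2 + i) , nth))
        (λ {v} {v′} ((_ , same) , e) ((_ , same′) , e′) e″ →
          rest-agree {v} {v′} (1 + i) (trans same (sym same′)) (trans e (sym e′)) e″)
        (thin-mid y (z v₀ (4 + i)))

  -- The segment from 3 + b on omits only z (1 + b) and z (2 + b). It ends in z b and contains the
  -- second edge of the repeated colour, so properness at z b gives z (1 + b); then z (2 + b) is a
  -- thin middle between known vertices.
  repeated-colour-count : ∀ b e → e < 3 + q * 2 → AtMost (S q * Kₜ)
    (λ v → Cyclic v × (∀ t → ¬ ThickAt v t) × colourAt v b ≡ colourAt v (e + (3 + b)))
  repeated-colour-count b e lt = atMost-window _≟ʷ_ (segOf (3 + b)) (segment-count q) (λ {v} (cy , _) → segOf-Segment {v}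
      (3 + b) cy)
    λ v₀ (cy₀ , thin₀ , eq₀) → atMost-injective _≟ᵛ_ (λ v → z v (2 + b))
      (λ {v} ((cy , thin , eq) , same) → between
        (next {v} {v₀} cy eq eq₀ same) (on-segment {v} {v₀} (3 + b) same 0 (s≤s z≤n))
        (OnCycle.twoPath v cy (1 + b) , thin (1 + b)))
      (λ {v} {v′} ((cy , _ , eq) , same) ((_ , _ , eq′) , same′) e″ →
        rest-agree {v} {v′} b (trans same (sym same′)) (next {v} {v′} cy eq eq′ (trans same (sym same′))) e″)
      (thin-mid (z v₀ (1 + b)) (z v₀ (3 + b)))
    where
    next : ∀ {v v′} → Cyclic v → colourAt v b ≡ colourAt v (e + (3 + b)) → colourAt v′ b ≡ colourAt v′ (e + (3 + b)) →
      segOf (3 + b) v ≡ segOf (3 + b) v′ → z v (1 + b) ≡ z v′ (1 + b)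
    next {v} {v′} cy eq eq′ same = proper (OnCycle.adjacent v cy b) (trans eq
      (trans (cong₂ c (on-segment {v} {v′} (3 + b) same e (≤-trans lt (n≤1+n _))) (on-segment {v} {v′} (3 + b) same (suc e)
          (s≤s lt)))
        (trans (sym eq′) (cong (λ x → c x (z v′ (1 + b))) (sym (wrap {v} {v′} (3 + q * 2) (3 + b) b ≤-refl (end₀ q b) same))))))

  Repeats : ℕ → ℕ → Vec V (suc l) → Set
  Repeats b e v = Cyclic v × (∀ t → ¬ ThickAt v t) × colourAt v b ≡ colourAt v (e + (3 + b))

  module Classify (v : Vec V (suc l)) (cy : Cyclic v) where

    open OnCycle v cy

    thickAt? : ∀ t → Dec (ThickAt v t)
    thickAt? t = thick? (z v t) (z v (1 + t)) (z v (2 + t))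

    colourAt-mod : ∀ a t → colourAt v (a + toℕ (t mod suc l)) ≡ colourAt v (a + t)
    colourAt-mod a t = cong₂ c (z-toℕ-mod v a t) (z-toℕ-mod v (1 + a) t)

    repeats-mod : (∀ t → ¬ ThickAt v t) → ∀ b e → colourAt v b ≡ colourAt v (e + (3 + b)) →
      Repeats (toℕ (b mod suc l)) e v
    repeats-mod thin b e eq = cy , thin , trans (colourAt-mod 0 b) (trans eq (sym
      (trans (cong (colourAt v) (sym (+-assoc e 3 (toℕ (b mod suc l))))) (trans (colourAt-mod (e + 3) b) (cong (colourAt v)
          (+-assoc e 3 b))))))

    -- Adjacent edges have different colours. For d = 2 the second edge would meet the omitted
    -- vertices, so the roles are exchanged: starting from it, the first edge is reached almost a
    -- full turn later. Larger d give the offset d - 3.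
    later : (∀ t → ¬ ThickAt v t) → ∀ a d → 0 < d → d < suc l → colourAt v a ≡ colourAt v (d + a) →
      ∃ λ (b : Fin (suc l)) → ∃ λ (e : Fin (3 + q * 2)) → Repeats (toℕ b) (toℕ e) v
    later thin a (suc zero) _ _ eq = ⊥-elim (distinct 2 a (s≤s z≤n) (s≤s (s≤s (s≤s z≤n)))
      (proper (~-sym (adjacent a)) (trans (c-sym _ _) eq)))
    later thin a (suc (suc zero)) _ _ eq = (2 + a) mod suc l , fromℕ< lt ,
      subst (λ e → Repeats (toℕ ((2 + a) mod suc l)) e v) (sym (Finₚ.toℕ-fromℕ< lt))
        (repeats-mod thin (2 + a) (1 + q * 2) (trans (sym eq) (sym (cong₂ c
          (trans (cong (z v) (turn q a)) (z-period v a)) (trans (cong (z v) (cong suc (turn q a)))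
              (trans (cong (z v) (sym (+-suc (suc l) a))) (z-period v (suc a))))))))
      where
      lt : 1 + q * 2 < 3 + q * 2
      lt = s≤s (s≤s (n≤1+n _))
      turn : ∀ q a → 1 + q * 2 + (3 + (2 + a)) ≡ 6 + q * 2 + a
      turn = solve-∀
    later thin a (suc (suc (suc e))) _ (s≤s (s≤s (s≤s lt))) eq = a mod suc l , fromℕ< lt ,
      subst (λ e → Repeats (toℕ (a mod suc l)) e v) (sym (Finₚ.toℕ-fromℕ< lt))
        (repeats-mod thin a e (trans eq (cong (colourAt v) (shift e a))))
      where
      shift : ∀ e a → 3 + e + a ≡ e + (3 + a)
      shift = solve-∀

    repeats : (∀ t → ¬ ThickAt v t) → ∃ λ (b : Fin (suc l)) → ∃ λ (e : Fin (3 + q * 2)) → Repeats (toℕ b) (toℕ e) v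
    repeats thin = case Finₚ.any? (λ i → Finₚ.any? (λ j → (colourAt v (toℕ i) ≟ᶜ colourAt v (toℕ j)) ×-dec (toℕ i <? toℕ j))) of λ
      { (yes (i , j , eq , lt)) → found i j eq lt
      ; (no none) → ⊥-elim (noRainbow (Vec.lookup v , cy , rainbow none)) }
      where
      found : ∀ (i j : Fin (suc l)) → colourAt v (toℕ i) ≡ colourAt v (toℕ j) → toℕ i < toℕ j →
        ∃ λ (b : Fin (suc l)) → ∃ λ (e : Fin (3 + q * 2)) → Repeats (toℕ b) (toℕ e) v
      found i j eq lt = later thin (toℕ i) (toℕ j ∸ toℕ i) (m<n⇒0<n∸m lt) (≤-<-trans (m∸n≤m (toℕ j) (toℕ i)) (Finₚ.toℕ<n j))
        (trans eq (cong (colourAt v) (sym (m∸n+n≡m (<⇒≤ lt)))))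
      lookup-cyc : ∀ i → z v (suc (toℕ i)) ≡ Vec.lookup v (cyc i)
      lookup-cyc i = z-def v (suc (toℕ i))
      colour : ∀ i → colourAt v (toℕ i) ≡ c (Vec.lookup v i) (Vec.lookup v (cyc i))
      colour i = cong₂ c (z-lookup v i) (lookup-cyc i)
      rainbow : ¬ (∃ λ (i : Fin (suc l)) → ∃ λ (j : Fin (suc l)) → colourAt v (toℕ i) ≡ colourAt v (toℕ j) × toℕ i < toℕ j) →
        ∀ i j → c (Vec.lookup v i) (Vec.lookup v (cyc i)) ≡ c (Vec.lookup v j) (Vec.lookup v (cyc j)) → i ≡ j
      rainbow none i j eq = case <-cmp (toℕ i) (toℕ j) of λ
        { (tri< lt _ _) → ⊥-elim (none (i , j , trans (colour i) (trans eq (sym (colour j))) , lt))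
        ; (tri≈ _ e _) → Finₚ.toℕ-injective e
        ; (tri> _ _ gt) → ⊥-elim (none (j , i , trans (colour j) (trans (sym eq) (sym (colour i))) , gt)) }

    classify : (∃ λ (i : Fin (suc l)) → Cyclic v × ThickAt v (toℕ i) × ¬ ThickAt v (2 + toℕ i)) ⊎
      (∃ λ (b : Fin (suc l)) → ∃ λ (e : Fin (3 + q * 2)) → Repeats (toℕ b) (toℕ e) v)
    classify = case Finₚ.any? (λ (i : Fin (suc l)) → thickAt? (toℕ i) ×-dec ¬? (thickAt? (2 + toℕ i))) of λ
      { (yes (i , th , nth)) → inj₁ (i , cy , th , nth)
      ; (no none) → inj₂ (repeats λ t th → all-thick t (closed none) th) }
      where
      closed : ¬ (∃ λ (i : Fin (suc l)) → ThickAt v (toℕ i) × ¬ ThickAt v (2 + toℕ i)) →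
        ∀ t → ThickAt v t → ThickAt v (2 + t)
      closed none t th = case thickAt? (2 + toℕ (t mod suc l)) of λ
        { (yes th′) → thickAt-mod⁻ 2 t th′
        ; (no nth) → ⊥-elim (none (t mod suc l , thickAt-mod t th , nth)) }

  cycle-count : AtMost (suc l * (S q * (L₀ * Kₜ)) + suc l * ((3 + q * 2) * (S q * Kₜ))) Cyclic
  cycle-count = atMost-⊎ (λ {v} cy → Classify.classify v cy)
    (atMost-⋃ (suc l) λ i → thick-thin-count (toℕ i))
    (atMost-⋃ (suc l) λ b → atMost-⋃ (3 + q * 2) λ e → repeated-colour-count (toℕ b) (toℕ e) (Finₚ.toℕ<n e))

^-distrib-* : ∀ q m n → (m * n) ^ q ≡ m ^ q * n ^ q
^-distrib-* zero m n = refl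
^-distrib-* (suc q) m n = trans (cong (m * n *_) (^-distrib-* q m n)) (interchange m n (m ^ q) (n ^ q))
  where
  interchange : ∀ a b x y → a * b * (x * y) ≡ a * x * (b * y)
  interchange = solve-∀

embeddings≤ : ∀ {n} (c : Colouring n) l {N} → AtMost N (λ v → IsCycle c l (Vec.lookup v)) → copiesOfCycle c l ≤ N
embeddings≤ {n} c l {N} h = ≤-trans (m/n≤m (numCycleEmbeddings c l) (2 * suc l))
  (bound h _ (Uniqueₚ.filter⁺ cyc? (unique-allVecs (suc l) n)) (Allₚ.all-filter cyc? (allVecs (suc l) n)))
  where
  cyc? : Decidable (λ v → IsCycle c l (Vec.lookup v))
  cyc? v = isCycle? c l (Vec.lookup v)

upper-bound : ∀ q → ∃ λ C → ∀ n (c : Colouring n) → ProperColouring c → ¬ HasRainbowCycle c (5 + q * 2) →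
  copiesOfCycle c (5 + q * 2) ≤ C * n ^ (2 + q)
upper-bound q = C , λ n c pc nr → ≤-trans (embeddings≤ c (5 + q * 2) (CycleBound.cycle-count c pc q nr)) (≤-reflexive (collect n))
  where
  open Constants q
  open Constants₃ q
  C : ℕ
  C = (6 + q * 2) * (L₀ * Kₜ + (3 + q * 2) * Kₜ) * (C₃ * C₁ ^ q)
  rearrange : ∀ n c₃ a b u w t x → u * (n * n * c₃ * (a * b) * x) + u * (w * (n * n * c₃ * (a * b) * t)) ≡
    u * (x + w * t) * (c₃ * b) * (n * (n * a))
  rearrange = solve-∀
  collect : ∀ n → (6 + q * 2) * ((n * n) * C₃ * (n * C₁) ^ q * (L₀ * Kₜ)) + (6 + q * 2) * ((3 + q * 2) * ((n * n) * C₃ *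
      (n * C₁) ^ q * Kₜ)) ≡
    C * n ^ (2 + q)
  collect n = trans (cong (λ p → (6 + q * 2) * ((n * n) * C₃ * p * (L₀ * Kₜ)) + (6 + q * 2) * ((3 + q * 2) *
      ((n * n) * C₃ * p * Kₜ))) (^-distrib-* q n C₁))
    (rearrange n C₃ (n ^ q) (C₁ ^ q) (6 + q * 2) (3 + q * 2) Kₜ (L₀ * Kₜ))

-- Upper bound for four-cycles

module FourCycles {n : ℕ} (c : Colouring n) (pc : ProperColouring c) (noRainbow : ¬ HasRainbowCycle c 3) where

  open Coloured c pc

  -- Two common neighbours w, w′ of a and b form a rainbow four-cycle unless a w, b w′ or b w, a w′ have equal colours.
  codegree : ∀ a b → a ≢ b → AtMost 3 (λ w → a ~ w × w ~ b)
  bound (codegree a b a≢b) [] u ps = z≤n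
  bound (codegree a b a≢b) (w ∷ ws) u ((a~w , w~b) ∷ ps) = ≮⇒≥ λ lt →
    let (w′ , w′∈ , nb) = pick {Q = λ w′ → w′ ≡ w ⊎ c b w′ ≡ c a w ⊎ c a w′ ≡ c b w}
          (λ w′ → (w′ ≟ᵛ w) ⊎-dec (_ ≟ᶜ _) ⊎-dec (_ ≟ᶜ _))
          (atMost-∪
            (atMost-1 λ { (_ , refl) (_ , refl) → refl })
          (atMost-∪
            (atMost-1 λ { ((_ , e) , eq) (_ , eq′) → proper (~-sym e) (trans eq (sym eq′)) })
            (atMost-1 λ { ((e , _) , eq) (_ , eq′) → proper e (trans eq (sym eq′)) })))
          (w ∷ ws) u ((a~w , w~b) ∷ ps) lt
        (a~w′ , w′~b) = All.lookup ((a~w , w~b) ∷ ps) w′∈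
        t₁ = step start a~w (λ { (here e) → ~⇒≢ a~w (sym e) }) (λ ())
        t₂ = step t₁ w~b (λ { (here e) → ~⇒≢ w~b (sym e) ; (there (here e)) → a≢b (sym e) })
               (λ { (here e) → a≢b (sym (proper w~b (trans e (c-sym a w)))) })
        t₃ = step t₂ (~-sym w′~b) (λ { (here e) → ~⇒≢ w′~b e ; (there (here e)) → nb (inj₁ e) ; (there (there (here e))) → ~⇒≢ a~w′
            (sym e) })
               (λ { (here e) → nb (inj₁ (proper (~-sym w′~b) (trans e (c-sym w b)))) ; (there (here e)) → nb (inj₂ (inj₁ e)) })
    in noRainbow (close t₃ (~-sym a~w′)
         λ { (here e) → a≢b (proper (~-sym a~w′) (trans e (c-sym b w′)))
           ; (there (here e)) → nb (inj₂ (inj₂ (trans (c-sym a w′) (trans e (c-sym w b)))))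
           ; (there (there (here e))) → nb (inj₁ (proper a~w′ (trans (c-sym a w′) e))) })

  -- A pair of opposite vertices leaves at most three choices for each of the other two.
  four-cycles : AtMost (n * n * (3 * 3)) (λ v → IsCycle c 3 (Vec.lookup v))
  four-cycles = atMost-fibre (≡-dec _≟ᵛ_ _≟ᵛ_) {Q = λ (a , b) → a ≢ b} (λ { (quad a _ b _) → a , b })
    (λ { {quad a _ b _} (inj , _) e → case inj zero (suc (suc zero)) e of λ () })
    (atMost-fibre _≟ᵛ_ proj₁ (λ _ → tt) atMost-Fin λ _ _ →
      atMost-injective _≟ᵛ_ proj₂ (λ _ → tt) (λ { (_ , refl) (_ , refl) refl → refl }) atMost-Fin)
    λ { (a , b) a≢b → atMost-fibre _≟ᵛ_ {Q = λ w → a ~ w × w ~ b} (λ { (quad _ w _ _) → w })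
      (λ { {quad _ _ _ _} ((_ , adj) , refl) → adj zero , adj (suc zero) }) (codegree a b a≢b)
      λ w _ → atMost-injective _≟ᵛ_ (λ { (quad _ _ _ w′) → w′ })
        (λ { {quad _ _ _ _} (((_ , adj) , refl) , _) → ~-sym (adj (suc (suc (suc zero)))) , ~-sym (adj (suc (suc zero))) })
        (λ { {quad _ _ _ _} {quad _ _ _ _} ((_ , refl) , refl) ((_ , refl) , refl) refl → refl }) (codegree a b a≢b) }

upper-bound₄ : ∀ n (c : Colouring n) → ProperColouring c → ¬ HasRainbowCycle c 3 → copiesOfCycle c 3 ≤ 9 * n ^ 2
upper-bound₄ n c pc nr = ≤-trans (embeddings≤ c 3 (FourCycles.four-cycles c pc nr)) (≤-reflexive (rearrange n))
  where
  rearrange : ∀ n → n * n * 9 ≡ 9 * (n * (n * 1))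
  rearrange = solve-∀

-- Lower bound for k at least 3: blowing up the cycle

embeddings≥ : ∀ {n} (c : Colouring n) l (xs : List (Vec (Fin n) (suc l))) → Unique xs →
  (∀ {v} → v ∈ xs → IsCycle c l (Vec.lookup v)) → length xs ≤ numCycleEmbeddings c l
embeddings≥ c l xs u h = unique-⊆-length u λ {v} m →
  ∈-filter⁺ (λ v → isCycle? c l (Vec.lookup v)) (∈-allVecs v) (h m)

-- The remainder of E modulo D is below D, hence at most the multiple of D that division retains;
-- this costs the factor 2.
copies≥ : ∀ {n} (c : Colouring n) l m → m ≤ numCycleEmbeddings c l → 2 * suc l ≤ m → m ≤ 2 * (2 * suc l) * copiesOfCycle c l
copies≥ c l m m≤E D≤m = ≤-trans m≤E (begin
  E                      ≡⟨ DivMod.m≡m%n+[m/n]*n E D ⟩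
  E % D + (E / D) * D    ≤⟨ +-monoˡ-≤ ((E / D) * D) (<⇒≤ (m%n<n E D)) ⟩
  D + (E / D) * D        ≤⟨ +-monoˡ-≤ ((E / D) * D) (subst (_≤ (E / D) * D) (*-identityˡ D) (*-monoˡ-≤ D (DivMod.m≥n⇒m/n>0
      (≤-trans D≤m m≤E)))) ⟩
  (E / D) * D + (E / D) * D  ≡⟨ double (E / D) D ⟩
  2 * D * (E / D)        ∎)
  where
  open ≤-Reasoning
  open DivMod using (_/_)
  E D : ℕ
  E = numCycleEmbeddings c l
  D = 2 * suc l
  double : ∀ x y → x * y + x * y ≡ 2 * y * x
  double = solve-∀

length-concatMap : {A B : Set} (g : A → List B) (k : ℕ) → (∀ x → length (g x) ≡ k) → ∀ xs → length (concatMap g xs) ≡ length xs * k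
length-concatMap g k h [] = refl
length-concatMap g k h (x ∷ xs) = trans (length-++ (g x)) (cong₂ _+_ (h x) (length-concatMap g k h xs))

length-allVecs : ∀ m n → length (allVecs m n) ≡ n ^ m
length-allVecs zero n = refl
length-allVecs (suc m) n = trans (length-concatMap _ n (λ v → trans (length-map (Vec._∷ v) (allFin n)) (length-tabulate id))
    (allVecs m n))
  (trans (cong (_* n) (length-allVecs m n)) (*-comm (n ^ m) n))

-- The levels 1, 3, …, 2q + 1 and 2q + 4 of the (6 + 2q)-cycle are blown up.
blown : ℕ → ℕ → Bool
blown q 0 = false
blown q 1 = true
blown zero 2 = false
blown zero 3 = false
blown zero 4 = true
blown zero (suc (suc (suc (suc (suc _))))) = false
blown (suc q) (suc (suc r)) = blown q r

-- A choice of one copy for each blown-up level, read as a function of the level. It is 0 on the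
-- other levels and recurses like `blown`.
copy : ∀ q → Vec ℕ (2 + q) → ℕ → ℕ
copy q js 0 = 0
copy q (j ∷ js) 1 = j
copy zero js 2 = 0
copy zero js 3 = 0
copy zero (_ ∷ j ∷ []) 4 = j
copy zero js (suc (suc (suc (suc (suc _))))) = 0
copy (suc q) (_ ∷ js) (suc (suc r)) = copy q js r

blown-next : ∀ q r → T (blown q r) → ¬ T (blown q (suc r))
blown-next zero 1 _ ()
blown-next zero 4 _ ()
blown-next (suc q) 1 _ b = b
blown-next (suc q) (suc (suc r)) b b′ = blown-next q r b b′

blown-last : ∀ q → ¬ T (blown q (5 + q * 2))
blown-last zero ()
blown-last (suc q) = blown-last q

blown-2q+2 : ∀ q → ¬ T (blown q (2 + q * 2))
blown-2q+2 zero ()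
blown-2q+2 (suc q) = blown-2q+2 q

blown-2q+3 : ∀ q → ¬ T (blown q (3 + q * 2))
blown-2q+3 zero ()
blown-2q+3 (suc q) = blown-2q+3 q

copy-hub : ∀ q js r → ¬ T (blown q r) → copy q js r ≡ 0
copy-hub q (j ∷ js) 0 nb = refl
copy-hub q (j ∷ js) 1 nb = ⊥-elim (nb tt)
copy-hub zero (j ∷ js) 2 nb = refl
copy-hub zero (j ∷ js) 3 nb = refl
copy-hub zero (j ∷ j′ ∷ []) 4 nb = ⊥-elim (nb tt)
copy-hub zero (j ∷ j′ ∷ []) (suc (suc (suc (suc (suc r))))) nb = refl
copy-hub (suc q) (j ∷ js) (suc (suc r)) nb = copy-hub q js r nb

copy< : ∀ q (js : Vec ℕ (2 + q)) N → 0 < N → (∀ i → Vec.lookup js i < N) → ∀ r → copy q js r < N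
copy< q (j ∷ js) N pos h 0 = pos
copy< q (j ∷ js) N pos h 1 = h zero
copy< zero (j ∷ js) N pos h 2 = pos
copy< zero (j ∷ js) N pos h 3 = pos
copy< zero (j ∷ j′ ∷ []) N pos h 4 = h (suc zero)
copy< zero (j ∷ j′ ∷ []) N pos h (suc (suc (suc (suc (suc r))))) = pos
copy< (suc q) (j ∷ js) N pos h (suc (suc r)) = copy< q js N pos (h ∘ suc) r

copy-injective : ∀ q (js js′ : Vec ℕ (2 + q)) → (∀ r → r < 6 + q * 2 → copy q js r ≡ copy q js′ r) → js ≡ js′
copy-injective zero (j ∷ k ∷ []) (j′ ∷ k′ ∷ []) h =
  cong₂ (λ a b → a ∷ b ∷ []) (h 1 (s≤s (s≤s z≤n))) (h 4 (s≤s (s≤s (s≤s (s≤s (s≤s z≤n))))))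
copy-injective (suc q) (j ∷ js) (j′ ∷ js′) h =
  cong₂ _∷_ (h 1 (s≤s (s≤s z≤n))) (copy-injective q js js′ λ r lt → h (2 + r) (s≤s (s≤s lt)))

%-suc-injective : ∀ L .{{_ : ℕ.NonZero L}} {x y} → x < L → y < L → suc x % L ≡ suc y % L → x ≡ y
%-suc-injective L {x} {y} x<L y<L e with <-cmp x y
... | tri≈ _ eq _ = eq
... | tri< lt _ _ = ⊥-elim (%-moves L (y ∸ x) (suc x) (m<n⇒0<n∸m lt) (≤-<-trans (m∸n≤m y x) y<L)
  (trans (cong (_% L) (trans (+-suc (y ∸ x) x) (cong suc (m∸n+n≡m (<⇒≤ lt))))) (sym e)))
... | tri> _ _ gt = ⊥-elim (%-moves L (x ∸ y) (suc y) (m<n⇒0<n∸m gt) (≤-<-trans (m∸n≤m x y) x<L)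
  (trans (cong (_% L) (trans (+-suc (x ∸ y) y) (cong suc (m∸n+n≡m (<⇒≤ gt))))) e))

module BlowUp (q n : ℕ) where

  L l : ℕ
  L = 6 + q * 2
  l = 5 + q * 2

  V : Set
  V = Fin n

  opaque
    level : V → ℕ
    level v = toℕ v % L

    level-def : ∀ v → level v ≡ toℕ v % L
    level-def v = refl

    next : ℕ → ℕ
    next r = suc r % L

    next-def : ∀ r → next r ≡ suc r % L
    next-def r = refl

  level< : ∀ v → level v < L
  level< v = subst (_< L) (sym (level-def v)) (m%n<n (toℕ v) L)

  next-injective : ∀ {x y} → x < L → y < L → next x ≡ next y → x ≡ y
  next-injective {x} {y} x< y< e = %-suc-injective L x< y< (trans (sym (next-def x)) (trans e (next-def y)))

  next≢ : ∀ x → x < L → next x ≢ x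
  next≢ x x< e = %-moves L 1 x (s≤s z≤n) (s≤s (s≤s z≤n)) (trans (sym (next-def x)) (trans e (sym (m<n⇒m%n≡m x<))))

  next-small : ∀ {x} → suc x < L → next x ≡ suc x
  next-small {x} lt = trans (next-def x) (m<n⇒m%n≡m lt)

  next-last : next l ≡ 0
  next-last = trans (next-def l) (n%n≡0 L)

  -- A level that is not blown up keeps only its first vertex; all vertices that are not `Ok` are
  -- isolated.
  Hub Ok : V → Set
  Hub v = toℕ v < L
  Ok v = T (blown q (level v)) ⊎ Hub v

  ok? : ∀ v → Dec (Ok v)
  ok? v = T? (blown q (level v)) ⊎-dec (toℕ v <? L)

  hub-level : ∀ {v} → Hub v → level v ≡ toℕ v
  hub-level {v} h = trans (level-def v) (m<n⇒m%n≡m h)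

  hub-unique : ∀ {u v} → Ok u → Ok v → level u ≡ level v → ¬ T (blown q (level v)) → u ≡ v
  hub-unique (inj₁ b) _ e nb = ⊥-elim (nb (subst (T ∘ blown q) e b))
  hub-unique (inj₂ _) (inj₁ b) e nb = ⊥-elim (nb b)
  hub-unique (inj₂ h) (inj₂ h′) e nb = Finₚ.toℕ-injective (trans (sym (hub-level h)) (trans e (hub-level h′)))

  Edge : V → V → Set
  Edge u v = (level v ≡ next (level u) ⊎ level u ≡ next (level v)) × Ok u × Ok v

  edge? : ∀ u v → Dec (Edge u v)
  edge? u v = ((level v ℕ.≟ next (level u)) ⊎-dec (level u ℕ.≟ next (level v))) ×-dec ok? u ×-dec ok? v

  edge-sym : ∀ {u v} → Edge u v → Edge v u
  edge-sym (inj₁ e , a , b) = inj₂ e , b , a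
  edge-sym (inj₂ e , a , b) = inj₁ e , b , a

  -- The two edges of the cycle that survive the blow-up, in both directions: these are the only
  -- consecutive levels of which neither is blown up.
  Pair : ℕ → ℕ → Set
  Pair r s = (r ≡ l × s ≡ 0) ⊎ (r ≡ 0 × s ≡ l) ⊎ (r ≡ 2 + q * 2 × s ≡ 3 + q * 2) ⊎ (r ≡ 3 + q * 2 × s ≡ 2 + q * 2)

  pair? : ∀ r s → Dec (Pair r s)
  pair? r s = ((r ℕ.≟ l) ×-dec (s ℕ.≟ 0)) ⊎-dec ((r ℕ.≟ 0) ×-dec (s ℕ.≟ l)) ⊎-dec
    ((r ℕ.≟ 2 + q * 2) ×-dec (s ℕ.≟ 3 + q * 2)) ⊎-dec ((r ℕ.≟ 3 + q * 2) ×-dec (s ℕ.≟ 2 + q * 2))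

  pair-sym : ∀ {r s} → Pair r s → Pair s r
  pair-sym (inj₁ (a , b)) = inj₂ (inj₁ (b , a))
  pair-sym (inj₂ (inj₁ (a , b))) = inj₁ (b , a)
  pair-sym (inj₂ (inj₂ (inj₁ (a , b)))) = inj₂ (inj₂ (inj₂ (b , a)))
  pair-sym (inj₂ (inj₂ (inj₂ (a , b)))) = inj₂ (inj₂ (inj₁ (b , a)))

  pair-hub : ∀ {r s} → Pair r s → ¬ T (blown q s)
  pair-hub (inj₁ (_ , refl)) = id
  pair-hub (inj₂ (inj₁ (_ , refl))) = blown-last q
  pair-hub (inj₂ (inj₂ (inj₁ (_ , refl)))) = blown-2q+3 q
  pair-hub (inj₂ (inj₂ (inj₂ (_ , refl)))) = blown-2q+2 q

  pair-unique : ∀ {r s s′} → Pair r s → Pair r s′ → s ≡ s′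
  pair-unique (inj₁ (_ , refl)) (inj₁ (_ , refl)) = refl
  pair-unique (inj₁ (refl , _)) (inj₂ (inj₁ (() , _)))
  pair-unique (inj₁ (refl , _)) (inj₂ (inj₂ (inj₁ (e , _)))) = ⊥-elim (<⇒≢ (s≤s (s≤s (s≤s (m≤n+m _ 2)))) (sym e))
  pair-unique (inj₁ (refl , _)) (inj₂ (inj₂ (inj₂ (e , _)))) = ⊥-elim (<⇒≢ (s≤s (s≤s (s≤s (s≤s (m≤n+m _ 1))))) (sym e))
  pair-unique (inj₂ (inj₁ (refl , _))) (inj₁ (() , _))
  pair-unique (inj₂ (inj₁ (_ , refl))) (inj₂ (inj₁ (_ , refl))) = refl
  pair-unique (inj₂ (inj₁ (refl , _))) (inj₂ (inj₂ (inj₁ (() , _))))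
  pair-unique (inj₂ (inj₁ (refl , _))) (inj₂ (inj₂ (inj₂ (() , _))))
  pair-unique (inj₂ (inj₂ (inj₁ (refl , _)))) (inj₁ (e , _)) = ⊥-elim (<⇒≢ (s≤s (s≤s (s≤s (m≤n+m _ 2)))) e)
  pair-unique (inj₂ (inj₂ (inj₁ (refl , _)))) (inj₂ (inj₁ (() , _)))
  pair-unique (inj₂ (inj₂ (inj₁ (_ , refl)))) (inj₂ (inj₂ (inj₁ (_ , refl)))) = refl
  pair-unique (inj₂ (inj₂ (inj₁ (refl , _)))) (inj₂ (inj₂ (inj₂ (e , _)))) = ⊥-elim (<⇒≢ ≤-refl e)
  pair-unique (inj₂ (inj₂ (inj₂ (refl , _)))) (inj₁ (e , _)) = ⊥-elim (<⇒≢ (s≤s (s≤s (s≤s (s≤s (m≤n+m _ 1))))) e)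
  pair-unique (inj₂ (inj₂ (inj₂ (refl , _)))) (inj₂ (inj₁ (() , _)))
  pair-unique (inj₂ (inj₂ (inj₂ (refl , _)))) (inj₂ (inj₂ (inj₁ (e , _)))) = ⊥-elim (<⇒≢ ≤-refl (sym e))
  pair-unique (inj₂ (inj₂ (inj₂ (_ , refl)))) (inj₂ (inj₂ (inj₂ (_ , refl)))) = refl

  -- The sum is symmetric and injective in either argument, which makes the colouring proper; the
  -- successor reserves 0 for the two special edges.
  colour : V → V → ℕ
  colour u v = case pair? (level u) (level v) of λ { (yes _) → 0 ; (no _) → suc (toℕ u + toℕ v) }

  colour-pair : ∀ {u v} → Pair (level u) (level v) → colour u v ≡ 0
  colour-pair {u} {v} p with pair? (level u) (level v)
  ... | yes _ = refl
  ... | no np = ⊥-elim (np p)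

  colour-sym : ∀ u v → colour u v ≡ colour v u
  colour-sym u v with pair? (level u) (level v) | pair? (level v) (level u)
  ... | yes _ | yes _ = refl
  ... | yes p | no np = ⊥-elim (np (pair-sym p))
  ... | no np | yes p = ⊥-elim (np (pair-sym p))
  ... | no _ | no _ = cong suc (+-comm (toℕ u) (toℕ v))

  c : Colouring n
  c u v = case edge? u v of λ { (yes _) → just (colour u v) ; (no _) → nothing }

  edge-colour : ∀ {u v} → Edge u v → c u v ≡ just (colour u v)
  edge-colour {u} {v} e with edge? u v
  ... | yes _ = refl
  ... | no ne = ⊥-elim (ne e)

  coloured-edge : ∀ {u v a} → c u v ≡ just a → Edge u v × colour u v ≡ a
  coloured-edge {u} {v} eq with edge? u v | eq
  ... | yes e | refl = e , refl
  ... | no _ | ()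

  adj-edge : ∀ {u v} → Adj c u v → Edge u v
  adj-edge {u} {v} a with edge? u v | a
  ... | yes e | _ = e
  ... | no _ | ()

  edge-adj : ∀ {u v} → Edge u v → Adj c u v
  edge-adj e = subst (T ∘ is-just) (sym (edge-colour e)) tt

  c-proper : ProperColouring c
  c-proper = symm , irrefl , unique
    where
    symm : ∀ u v → c u v ≡ c v u
    symm u v with edge? u v | edge? v u
    ... | yes _ | yes _ = cong just (colour-sym u v)
    ... | yes e | no ne = ⊥-elim (ne (edge-sym e))
    ... | no ne | yes e = ⊥-elim (ne (edge-sym e))
    ... | no _ | no _ = refl
    irrefl : ∀ u → c u u ≡ nothing
    irrefl u with edge? u u
    ... | yes (inj₁ e , _) = ⊥-elim (next≢ (level u) (level< u) (sym e))
    ... | yes (inj₂ e , _) = ⊥-elim (next≢ (level u) (level< u) (sym e))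
    ... | no _ = refl
    same : ∀ u v w → Ok v → Ok w → colour u v ≡ colour u w → v ≡ w
    same u v w okv okw eq with pair? (level u) (level v) | pair? (level u) (level w)
    ... | yes p | yes p′ = hub-unique okv okw (pair-unique p p′) (pair-hub p′)
    same u v w okv okw () | yes _ | no _
    same u v w okv okw () | no _ | yes _
    ... | no _ | no _ = Finₚ.toℕ-injective (+-cancelˡ-≡ (toℕ u) (toℕ v) (toℕ w) (suc-injective eq))
    unique : ∀ u v w a → c u v ≡ just a → c u w ≡ just a → v ≡ w
    unique u v w a e₁ e₂ =
      let ((_ , _ , okv) , x) = coloured-edge e₁
          ((_ , _ , okw) , y) = coloured-edge e₂
      in same u v w okv okw (trans x (sym y))

module BlowUpCycles (q n : ℕ) where

  open BlowUp q n

  blown-next′ : ∀ {r} → r < L → T (blown q r) → ¬ T (blown q (next r))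
  blown-next′ {r} r<L b b′ = case suc r <? L of λ
    { (yes lt) → blown-next q r b (subst (T ∘ blown q) (next-small lt) b′)
    ; (no nlt) → blown-last q (subst (T ∘ blown q) (≤-antisym (≤-pred r<L) (≤-pred (≮⇒≥ nlt))) b) }

  module _ (f : Fin L → V) (cyclic : IsCycle c l f) where

    open Periodic l f
    open CycleWalk c l f cyclic

    lev : ℕ → ℕ
    lev t = level (z t)

    lev< : ∀ t → lev t < L
    lev< t = level< (z t)

    Up Down : ℕ → Set
    Up t = lev (suc t) ≡ next (lev t)
    Down t = lev t ≡ next (lev (suc t))

    edge : ∀ t → Edge (z t) (z (suc t))
    edge t = adj-edge (adjacent t)

    ok : ∀ t → Ok (z t)
    ok t = proj₁ (proj₂ (edge t))

    -- A level that is not blown up has a single vertex, which a cycle cannot visit twice within one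
    -- turn.
    far : ∀ d t → 0 < d → d < L → lev t ≡ lev (d + t) → T (blown q (lev (d + t)))
    far d t 0<d d<L e = case T? (blown q (lev (d + t))) of λ
      { (yes b) → b ; (no nb) → ⊥-elim (distinct d t 0<d d<L (hub-unique (ok t) (ok (d + t)) e nb)) }

    2≤ : 2 < L
    2≤ = s≤s (s≤s (s≤s z≤n))

    4≤ : 4 < L
    4≤ = s≤s (s≤s (s≤s (s≤s (s≤s z≤n))))

    -- If the level rises and falls around z (2 + t), its two neighbours lie on a blown level, so z t and z (4 + t)
    -- are the same hub.
    no-peak : ∀ t → Up (1 + t) → Down (2 + t) → ⊥
    no-peak t up down = case proj₁ (edge t) of λ
      { (inj₂ d) → nb₂ (far 2 t (s≤s z≤n) 2≤ (trans d (sym up)))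
      ; (inj₁ u) → case proj₁ (edge (3 + t)) of λ
        { (inj₁ u′) → nb₂ (subst (T ∘ blown q) (trans u′ (sym down)) (far 2 (2 + t) (s≤s z≤n) 2≤ (trans down (sym u′))))
        ; (inj₂ d′) → blown-next′ (lev< (4 + t))
            (far 4 t (s≤s z≤n) 4≤ (next-injective (lev< t) (lev< (4 + t)) (trans (sym u) (trans same d′))))
            (subst (T ∘ blown q) d′ b₃) } }
      where
      same : lev (1 + t) ≡ lev (3 + t)
      same = next-injective (lev< (1 + t)) (lev< (3 + t)) (trans (sym up) down)
      b₃ : T (blown q (lev (3 + t)))
      b₃ = far 2 (1 + t) (s≤s z≤n) 2≤ same
      nb₂ : ¬ T (blown q (lev (2 + t)))
      nb₂ b = blown-next′ (lev< (3 + t)) b₃ (subst (T ∘ blown q) down b)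

    no-valley : ∀ t → Down (1 + t) → Up (2 + t) → ⊥
    no-valley t down up = case proj₁ (edge t) of λ
      { (inj₁ u) → nb₂ (far 2 t (s≤s z≤n) 2≤ (next-injective (lev< t) (lev< (2 + t)) (trans (sym u) down)))
      ; (inj₂ d) → case proj₁ (edge (3 + t)) of λ
        { (inj₂ d′) → let e = next-injective (lev< (2 + t)) (lev< (4 + t)) (trans (sym up) d′)
                      in nb₂ (subst (T ∘ blown q) (sym e) (far 2 (2 + t) (s≤s z≤n) 2≤ e))
        ; (inj₁ u′) → blown-next′ (lev< (3 + t)) b₃
            (subst (T ∘ blown q) u′ (far 4 t (s≤s z≤n) 4≤ (trans d (trans (cong next same) (sym u′))))) } }
      where
      same : lev (1 + t) ≡ lev (3 + t)
      same = trans down (sym up)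
      b₃ : T (blown q (lev (3 + t)))
      b₃ = far 2 (1 + t) (s≤s z≤n) 2≤ same
      nb₂ : ¬ T (blown q (lev (2 + t)))
      nb₂ b = blown-next′ (lev< (2 + t)) b (subst (T ∘ blown q) up b₃)

    Visited : ℕ → Set
    Visited ρ = ∃ λ t → lev (1 + t) ≡ ρ

    next-% : ∀ x → next (x % L) ≡ suc x % L
    next-% x = trans (next-def (x % L)) (%-shift 1 x L)

    around : ∀ ρ σ → ρ < L → σ < L → ((L ∸ ρ) + σ + ρ) % L ≡ σ
    around ρ σ ρ<L σ<L = trans (cong (_% L) (trans (cong (_+ ρ) (+-comm (L ∸ ρ) σ)) (trans (+-assoc σ (L ∸ ρ) ρ)
        (cong (σ +_) (m∸n+n≡m (<⇒≤ ρ<L))))))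
      (trans ([m+n]%n≡m%n σ L) (m<n⇒m%n≡m σ<L))

    ups : (∀ t → Up (1 + t)) → ∀ ρ → ρ < L → Visited ρ
    ups up ρ ρ<L = subst Visited (around (lev 1) ρ (lev< 1) ρ<L) (climb ((L ∸ lev 1) + ρ))
      where
      climb : ∀ d → Visited ((d + lev 1) % L)
      climb zero = 0 , sym (m<n⇒m%n≡m (lev< 1))
      climb (suc d) = let (t , e) = climb d in suc t , trans (up t) (trans (cong next e) (next-% (d + lev 1)))

    downs : (∀ t → Down (1 + t)) → ∀ ρ → ρ < L → Visited ρ
    downs down ρ ρ<L = descend ((L ∸ ρ) + lev 1) ρ ρ<L (0 , sym (around ρ (lev 1) ρ<L (lev< 1)))
      where
      descend : ∀ d ρ → ρ < L → Visited ((d + ρ) % L) → Visited ρ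
      descend zero ρ ρ<L v = subst Visited (m<n⇒m%n≡m ρ<L) v
      descend (suc d) ρ ρ<L v =
        let (t , e) = descend d (next ρ) (subst (_< L) (sym (next-def ρ)) (m%n<n (suc ρ) L))
                        (subst Visited (trans (cong (_% L) (sym (+-suc d ρ))) (trans (sym (%-shift d (suc ρ) L))
                            (cong (λ x → (d + x) % L) (sym (next-def ρ))))) v)
        in suc t , next-injective (lev< (2 + t)) ρ<L (trans (sym (down t)) e)

    -- Neither peaks nor valleys occur, so the first direction persists. The indices start at 1
    -- because excluding a turn at z (2 + t) looks back to z t.
    monotone : (∀ t → Up (1 + t)) ⊎ (∀ t → Down (1 + t))
    monotone = case proj₁ (edge 1) of λ { (inj₁ u) → inj₁ (upwards u) ; (inj₂ d) → inj₂ (downwards d) }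
      where
      upwards : Up 1 → ∀ t → Up (1 + t)
      upwards u zero = u
      upwards u (suc t) = case proj₁ (edge (2 + t)) of λ { (inj₁ u′) → u′ ; (inj₂ d) → ⊥-elim (no-peak t (upwards u t) d) }
      downwards : Down 1 → ∀ t → Down (1 + t)
      downwards d zero = d
      downwards d (suc t) = case proj₁ (edge (2 + t)) of λ { (inj₁ u) → ⊥-elim (no-valley t (downwards d t) u) ; (inj₂ d′) → d′ }

    special-step : ∀ t → Pair (lev t) (lev (suc t)) → c (f (t mod L)) (f (cyc (t mod L))) ≡ just 0
    special-step t p = trans (cong₂ c (sym (z-def t)) (trans (cong f (cyc-mod t)) (sym (z-def (suc t)))))
      (trans (edge-colour (edge t)) (cong just (colour-pair p)))

    -- A monotone cycle visits every level and hence traverses both special edges. They share the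
    -- colour 0, and a rainbow cycle would have to traverse them in one place.
    not-rainbow : ¬ (∀ i j → c (f i) (f (cyc i)) ≡ c (f j) (f (cyc j)) → i ≡ j)
    not-rainbow rainbow = case monotone of λ
      { (inj₁ up) → let (t , e) = ups up l ≤-refl
                        (t′ , e′) = ups up (2 + q * 2) (s≤s (s≤s (s≤s (m≤n+m _ 3))))
                    in <⇒≢ (s≤s (s≤s (s≤s (m≤n+m _ 2)))) (trans (sym e′) (trans (same (suc t′) (suc t)
                         (inj₂ (inj₂ (inj₁ (e′ , trans (up t′) (trans (cong next e′)
                             (next-small (s≤s (s≤s (s≤s (s≤s (m≤n+m _ 2)))))))))))
                         (inj₁ (e , trans (up t) (trans (cong next e) next-last)))) e))
      ; (inj₂ down) → let (t , e) = downs down 0 (s≤s z≤n)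
                          (t′ , e′) = downs down (3 + q * 2) (s≤s (s≤s (s≤s (s≤s (m≤n+m _ 2)))))
                      in case trans (sym e) (trans (same (suc t) (suc t′)
                           (inj₂ (inj₁ (e , next-injective (lev< (2 + t)) ≤-refl (trans (sym (down t)) (trans e (sym next-last))))))
                           (inj₂ (inj₂ (inj₂ (e′ , next-injective (lev< (2 + t′)) (s≤s (s≤s (s≤s (m≤n+m _ 3))))
                              (trans (sym (down t′)) (trans e′ (sym (next-small (s≤s (s≤s (s≤s (s≤s (m≤n+m _ 2)))))))))))))) e′)
                                  of λ () }
      where
      same : ∀ s s′ → Pair (lev s) (lev (suc s)) → Pair (lev s′) (lev (suc s′)) → lev s ≡ lev s′
      same s s′ p p′ = cong level (trans (z-def s)
          (trans (cong f (rainbow _ _ (trans (special-step s p) (sym (special-step s′ p′))))) (sym (z-def s′))))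

  no-rainbow : ¬ HasRainbowCycle c l
  no-rainbow (f , cyclic , rainbow) = not-rainbow f cyclic rainbow

  module _ (N : ℕ) (pos : 0 < N) (N*L≤n : N * L ≤ n) where

    heights : Vec (Fin N) (2 + q) → Vec ℕ (2 + q)
    heights = Vec.map toℕ

    -- Level and copy number are the remainder and the quotient modulo L.
    position : Vec (Fin N) (2 + q) → ℕ → ℕ
    position js r = r + copy q (heights js) r * L

    position< : ∀ js (r : Fin L) → position js (toℕ r) < n
    position< js r = ≤-trans (+-monoˡ-≤ (copy q (heights js) (toℕ r) * L) (Finₚ.toℕ<n r))
      (≤-trans (*-monoˡ-≤ L (copy< q (heights js) N pos (λ i → subst (_< N) (sym (Vecₚ.lookup-map i toℕ js))
          (Finₚ.toℕ<n (Vec.lookup js i))) (toℕ r))) N*L≤n)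

    build : Vec (Fin N) (2 + q) → Vec V L
    build js = Vec.tabulate λ r → fromℕ< (position< js r)

    toℕ-build : ∀ js r → toℕ (Vec.lookup (build js) r) ≡ position js (toℕ r)
    toℕ-build js r = trans (cong toℕ (Vecₚ.lookup∘tabulate (λ r → fromℕ< (position< js r)) r)) (Finₚ.toℕ-fromℕ< (position< js r))

    level-build : ∀ js r → level (Vec.lookup (build js) r) ≡ toℕ r
    level-build js r = trans (level-def _) (trans (cong (_% L) (toℕ-build js r))
      (trans ([m+kn]%n≡m%n (toℕ r) (copy q (heights js) (toℕ r)) L) (m<n⇒m%n≡m (Finₚ.toℕ<n r))))

    build-ok : ∀ js r → Ok (Vec.lookup (build js) r)
    build-ok js r = case T? (blown q (toℕ r)) of λ
      { (yes b) → inj₁ (subst (T ∘ blown q) (sym (level-build js r)) b)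
      ; (no nb) → inj₂ (subst (_< L) (sym (trans (toℕ-build js r) (trans (cong (λ x → toℕ r + x * L) (copy-hub q (heights js)
          (toℕ r) nb)) (+-identityʳ (toℕ r))))) (Finₚ.toℕ<n r)) }

    build-cycle : ∀ js → IsCycle c l (Vec.lookup (build js))
    build-cycle js = (λ i j e → Finₚ.toℕ-injective (trans (sym (level-build js i)) (trans (cong level e) (level-build js j)))) ,
      λ r → edge-adj (inj₁ (trans (level-build js (cyc r)) (trans (toℕ-cyc r) (trans (sym (next-def (toℕ r)))
          (cong next (sym (level-build js r)))))) ,
                      build-ok js r , build-ok js (cyc r))

    build-injective : ∀ {js js′} → build js ≡ build js′ → js ≡ js′
    build-injective {js} {js′} e = lookup-ext js js′ λ i → Finₚ.toℕ-injective
      (trans (sym (Vecₚ.lookup-map i toℕ js)) (trans (cong (λ h → Vec.lookup h i) (copy-injective q (heights js) (heights js′)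
          copies))
        (Vecₚ.lookup-map i toℕ js′)))
      where
      copies : ∀ r → r < 6 + q * 2 → copy q (heights js) r ≡ copy q (heights js′) r
      copies r lt = *-cancelʳ-≡ _ _ L (+-cancelˡ-≡ r _ _ (subst (λ r → position js r ≡ position js′ r) (Finₚ.toℕ-fromℕ< lt)
        (trans (sym (toℕ-build js (fromℕ< lt))) (trans (cong (λ v → toℕ (Vec.lookup v (fromℕ< lt))) e) (toℕ-build js′
            (fromℕ< lt))))))

    many-cycles : N ^ (2 + q) ≤ numCycleEmbeddings c l
    many-cycles = subst (_≤ numCycleEmbeddings c l) (trans (length-map build (allVecs (2 + q) N)) (length-allVecs (2 + q) N))
      (embeddings≥ c l (map build (allVecs (2 + q) N)) (Uniqueₚ.map⁺ build-injective (unique-allVecs (2 + q) N))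
        λ m → case ∈-map⁻ build m of λ { (js , _ , refl) → build-cycle js })

lower-bound : ∀ q → ∃ λ a → ∃ λ n₀ → ∀ n → n₀ ≤ n → Σ (Colouring n) λ c → ProperColouring c ×
  ¬ HasRainbowCycle c (5 + q * 2) × n ^ (2 + q) ≤ a * copiesOfCycle c (5 + q * 2)
-- From n = 2L · L on, N = n / L is at least 2L, the order of the automorphism group, as `copies≥`
-- requires. The power of 2L pays for n ≤ 2LN, and 2 · 2L is the loss in `copies≥`.
lower-bound q = (2 * L) ^ (2 + q) * (2 * (2 * L)) , 2 * L * L , λ n n₀≤n →
  let open BlowUp q n using (c; c-proper)
      N = n DivMod./ L
      2L≤N : 2 * L ≤ N
      2L≤N = subst (_≤ N) (DivMod.m*n/n≡m (2 * L) L) (DivMod./-monoˡ-≤ L n₀≤n)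
      0<N = ≤-trans (s≤s z≤n) 2L≤N
      many = BlowUpCycles.many-cycles q n N 0<N (DivMod.m/n*n≤m n L)
  in c , c-proper , BlowUpCycles.no-rainbow q n , (begin
    n ^ (2 + q)                                        ≤⟨ ^-monoˡ-≤ (2 + q) (small n N 0<N refl) ⟩
    (2 * L * N) ^ (2 + q)                              ≡⟨ ^-distrib-* (2 + q) (2 * L) N ⟩
    (2 * L) ^ (2 + q) * N ^ (2 + q)                    ≤⟨ *-monoʳ-≤ ((2 * L) ^ (2 + q)) (copies≥ c (5 + q * 2) (N ^ (2 + q)) many
                                                            (≤-trans 2L≤N (power N 0<N))) ⟩
    (2 * L) ^ (2 + q) * (2 * (2 * L) * copiesOfCycle c (5 + q * 2))  ≡⟨ sym (*-assoc ((2 * L) ^ (2 + q)) (2 * (2 * L)) _) ⟩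
    (2 * L) ^ (2 + q) * (2 * (2 * L)) * copiesOfCycle c (5 + q * 2)  ∎)
  where
  open ≤-Reasoning
  L : ℕ
  L = 6 + q * 2
  power : ∀ N → 0 < N → N ≤ N ^ (2 + q)
  power N 0<N = subst (_≤ N ^ (2 + q)) (*-identityʳ N) (*-monoʳ-≤ N (subst (_≤ N ^ (1 + q)) (^-zeroˡ (1 + q))
      (^-monoˡ-≤ (1 + q) 0<N)))
  small : ∀ n N → 0 < N → N ≡ n DivMod./ L → n ≤ 2 * L * N
  small n N 0<N refl = begin
    n                    ≡⟨ DivMod.m≡m%n+[m/n]*n n L ⟩
    n % L + N * L        ≤⟨ +-monoˡ-≤ (N * L) (<⇒≤ (m%n<n n L)) ⟩
    L + N * L            ≤⟨ +-monoˡ-≤ (N * L) (subst (_≤ N * L) (*-identityˡ L) (*-monoˡ-≤ L 0<N)) ⟩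
    N * L + N * L        ≡⟨ double N L ⟩
    2 * L * N            ∎
    where
    double : ∀ x y → x * y + x * y ≡ 2 * y * x
    double = solve-∀

-- A Chebyshev estimate: primes in short multiplicative ranges

-- binom a b is (a + b) choose a; in this form Pascal's rule needs no subtraction.
binom : ℕ → ℕ → ℕ
binom zero b = 1
binom (suc a) zero = 1
binom (suc a) (suc b) = binom a (suc b) + binom (suc a) b

binom-! : ∀ a b → binom a b * (a ! * b !) ≡ (a + b) !
binom-! zero b = trans (*-identityˡ _) (*-identityˡ _)
binom-! (suc a) zero = trans (*-identityˡ _) (trans (*-identityʳ _) (cong _! (sym (+-identityʳ (suc a)))))
binom-! (suc a) (suc b) = begin
  (binom a (suc b) + binom (suc a) b) * (suc a ! * suc b !)
    ≡⟨ spread (binom a (suc b)) (binom (suc a) b) a b (a !) (b !) ⟩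
  suc a * (binom a (suc b) * (a ! * suc b !)) + suc b * (binom (suc a) b * (suc a ! * b !))
    ≡⟨ cong₂ (λ x y → suc a * x + suc b * y) (trans (binom-! a (suc b)) (cong _! (+-suc a b))) (binom-! (suc a) b) ⟩
  suc a * suc (a + b) ! + suc b * suc (a + b) !
    ≡⟨ sym (*-distribʳ-+ (suc (a + b) !) (suc a) (suc b)) ⟩
  (suc a + suc b) * suc (a + b) !
    ≡⟨ cong (λ x → (suc a + suc b) * x !) (sym (+-suc a b)) ⟩
  (suc a + suc b) ! ∎
  where
  open ≡-Reasoning
  spread : ∀ x y a b f g → (x + y) * ((1 + a) * f * ((1 + b) * g)) ≡
    (1 + a) * (x * (f * ((1 + b) * g))) + (1 + b) * (y * ((1 + a) * f * g))
  spread = solve-∀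

binom-incʳ : ∀ a b → binom a b ≤ binom a (suc b)
binom-incʳ zero b = ≤-refl
binom-incʳ (suc a) zero = m≤n+m 1 _
binom-incʳ (suc a) (suc b) = m≤n+m (binom (suc a) (suc b)) (binom a (suc (suc b)))

binom-incˡ : ∀ a b → binom a b ≤ binom (suc a) b
binom-incˡ a zero = ≤-reflexive (zeroʳ a)
  where
  zeroʳ : ∀ a → binom a 0 ≡ 1
  zeroʳ zero = refl
  zeroʳ (suc a) = refl
binom-incˡ a (suc b) = m≤m+n _ _

2^≤binom : ∀ r → 2 ^ r ≤ binom r r
2^≤binom zero = ≤-refl
2^≤binom (suc r) = +-mono-≤ (≤-trans (2^≤binom r) (binom-incʳ r r))
  (subst (_≤ binom (suc r) r) (sym (+-identityʳ (2 ^ r))) (≤-trans (2^≤binom r) (binom-incˡ r r)))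

binom≤2^ : ∀ a b → binom a b ≤ 2 ^ (a + b)
binom≤2^ zero b = m^n>0 2 b
binom≤2^ (suc a) zero = m^n>0 2 (suc a + 0)
binom≤2^ (suc a) (suc b) = +-mono-≤ {binom a (suc b)} {2 ^ (a + suc b)} (binom≤2^ a (suc b))
  (subst (binom (suc a) b ≤_) (trans (cong (2 ^_) (sym (+-suc a b))) (sym (+-identityʳ (2 ^ (a + suc b))))) (binom≤2^ (suc a) b))

absorbˡ : ∀ a b → suc a * binom (suc a) b ≡ suc (a + b) * binom a b
absorbˡ a b = *-cancelʳ-≡ _ _ (a ! * b !) {{m*n≢0 (a !) (b !) {{n!≢0 a}} {{n!≢0 b}}}} (begin
  suc a * binom (suc a) b * (a ! * b !)     ≡⟨ regroup a (binom (suc a) b) (a !) (b !) ⟩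
  binom (suc a) b * (suc a ! * b !)         ≡⟨ binom-! (suc a) b ⟩
  suc (a + b) * (a + b) !                   ≡⟨ cong (suc (a + b) *_) (sym (binom-! a b)) ⟩
  suc (a + b) * (binom a b * (a ! * b !))   ≡⟨ sym (*-assoc (suc (a + b)) (binom a b) (a ! * b !)) ⟩
  suc (a + b) * binom a b * (a ! * b !)     ∎)
  where
  open ≡-Reasoning
  n!≢0 : ∀ n → NonZero (n !)
  n!≢0 n = ℕ.>-nonZero (1≤n! n)
  regroup : ∀ a x f g → (1 + a) * x * (f * g) ≡ x * ((1 + a) * f * g)
  regroup = solve-∀

binom-sym : ∀ a b → binom a b ≡ binom b a
binom-sym zero zero = refl
binom-sym zero (suc b) = refl
binom-sym (suc a) zero = refl
binom-sym (suc a) (suc b) = trans (cong₂ _+_ (binom-sym a (suc b)) (binom-sym (suc a) b)) (+-comm (binom (suc b) a)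
    (binom b (suc a)))

absorbʳ : ∀ a b → suc b * binom a (suc b) ≡ suc (a + b) * binom a b
absorbʳ a b = trans (cong (suc b *_) (binom-sym a (suc b)))
  (trans (absorbˡ b a) (cong₂ (λ x y → suc x * y) (+-comm b a) (binom-sym b a)))

leibniz : ℕ → ℕ → ℕ
leibniz a b = suc (a + b) * binom a b

-- The reciprocals form Leibniz's harmonic triangle: 1 / leibniz a b = 1 / leibniz (1 + a) b + 1 / leibniz a (1 + b).
leibniz-triangle : ∀ a b → leibniz (suc a) b * leibniz a (suc b) ≡ leibniz a b * leibniz a (suc b) + leibniz (suc a) b * leibniz a b
leibniz-triangle a b = begin
  N * e * (suc (a + suc b) * f)                           ≡⟨ cong (λ x → N * e * (suc x * f)) (+-suc a b) ⟩
  N * e * (N * f)                                         ≡⟨ expand a b e f ⟩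
  suc b * f * (N * e) + suc a * e * (N * f)               ≡⟨ cong₂ (λ x y → x * (N * e) + y * (N * f)) (absorbʳ a b) (absorbˡ a b) ⟩
  leibniz a b * (N * e) + leibniz a b * (N * f)           ≡⟨ +-comm (leibniz a b * (N * e)) _ ⟩
  leibniz a b * (N * f) + leibniz a b * (N * e)           ≡⟨ cong₂ _+_ (cong (λ x → leibniz a b * (suc x * f)) (sym (+-suc a b)))
      (*-comm (leibniz a b) (N * e)) ⟩
  leibniz a b * leibniz a (suc b) + leibniz (suc a) b * leibniz a b ∎
  where
  open ≡-Reasoning
  N e f : ℕ
  N = suc (suc (a + b))
  e = binom (suc a) b
  f = binom a (suc b)
  expand : ∀ a b e f → (2 + (a + b)) * e * ((2 + (a + b)) * f) ≡ (1 + b) * f * ((2 + (a + b)) * e) + (1 + a) * e *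
      ((2 + (a + b)) * f)
  expand = solve-∀

binom>0 : ∀ a b → 0 < binom a b
binom>0 zero b = s≤s z≤n
binom>0 (suc a) zero = s≤s z≤n
binom>0 (suc a) (suc b) = <-≤-trans (binom>0 (suc a) b) (m≤n+m _ _)

-- By the triangle, D / leibniz (1 + a) b is the difference of the integers D / leibniz a b and D /
-- leibniz a (1 + b). The induction starts from the numbers up to m themselves.
leibniz∣ : ∀ m D → (∀ x → 0 < x → x ≤ m → x ∣ D) → ∀ a b → suc (a + b) ≤ m → leibniz a b ∣ D
leibniz∣ m D h zero b le = subst (_∣ D) (sym (*-identityʳ (suc b))) (h (suc b) (s≤s z≤n) le)
leibniz∣ m D h (suc a) b le =
  let divides x eˣ = leibniz∣ m D h a b (≤-trans (n≤1+n _) le)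
      divides y eʸ = leibniz∣ m D h a (suc b) (subst (λ s → suc s ≤ m) (sym (+-suc a b)) le)
  in ∣m+n∣n⇒∣m (leibniz (suc a) b * y) (subst (leibniz (suc a) b ∣_) (balance x y eˣ eʸ) (m∣m*n x)) (m∣m*n y)
  where
  ∣m+n∣n⇒∣m : ∀ {i m} n → i ∣ m + n → i ∣ n → i ∣ m
  ∣m+n∣n⇒∣m {i} {m} n d d′ = ∣m+n∣m⇒∣n (subst (i ∣_) (+-comm m n) d) d′
  balance : ∀ x y → D ≡ x * leibniz a b → D ≡ y * leibniz a (suc b) →
    leibniz (suc a) b * x ≡ D + leibniz (suc a) b * y
  balance x y eˣ eʸ = *-cancelʳ-≡ _ _ (A * B) {{ℕ.>-nonZero (*-mono-≤ {1} {A} {1} {B} (pos a b) (pos a (suc b)))}} (begin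
    E * x * (A * B)            ≡⟨ r₁ E x A B ⟩
    x * A * (E * B)            ≡⟨ cong₂ _*_ (sym eˣ) (leibniz-triangle a b) ⟩
    D * (A * B + E * A)        ≡⟨ *-distribˡ-+ D (A * B) (E * A) ⟩
    D * (A * B) + D * (E * A)  ≡⟨ cong (λ d → D * (A * B) + d * (E * A)) eʸ ⟩
    D * (A * B) + y * B * (E * A) ≡⟨ r₂ D A B E y ⟩
    (D + E * y) * (A * B)      ∎)
    where
    open ≡-Reasoning
    A B E : ℕ
    A = leibniz a b
    B = leibniz a (suc b)
    E = leibniz (suc a) b
    pos : ∀ a b → 0 < leibniz a b
    pos a b = *-mono-≤ {1} {suc (a + b)} {1} {binom a b} (s≤s z≤n) (binom>0 a b)
    r₁ : ∀ E x A B → E * x * (A * B) ≡ x * A * (E * B)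
    r₁ = solve-∀
    r₂ : ∀ D A B E y → D * (A * B) + y * B * (E * A) ≡ (D + E * y) * (A * B)
    r₂ = solve-∀

-- `leibniz r r` is 2r + 1 times a central binomial coefficient, and it divides D.
common-multiple≥ : ∀ r D → 0 < D → (∀ x → 0 < x → x ≤ suc (r + r) → x ∣ D) → 2 ^ r ≤ D
common-multiple≥ r D 0<D h = ≤-trans (2^≤binom r) (≤-trans (m≤n*m (binom r r) (suc (r + r)))
  (∣⇒≤ {{ℕ.>-nonZero 0<D}} (leibniz∣ (suc (r + r)) D h r r ≤-refl)))

prime-divisor : ∀ a → 1 < a → ∃ λ p → Prime p × p ∣ a
prime-divisor a 1<a = go (factors f) (isFactorisation f) (factorsPrime f)
  where
  open PrimeFactorisation
  f = factorise a {{ℕ.>-nonZero (<-trans (s≤s z≤n) 1<a)}}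
  go : ∀ ps → a ≡ product ps → All Prime ps → ∃ λ p → Prime p × p ∣ a
  go [] e _ = ⊥-elim (<⇒≢ 1<a (sym e))
  go (p ∷ ps) e (pp ∷ _) = p , pp , subst (p ∣_) (sym e) (m∣m*n (product ps))

prime>1 : ∀ {p} → Prime p → 1 < p
prime>1 {zero} pr = ⊥-elim (¬prime[0] pr)
prime>1 {suc zero} pr = ⊥-elim (¬prime[1] pr)
prime>1 {suc (suc p)} pr = s≤s (s≤s z≤n)

n<m^n : ∀ m n → 1 < m → n < m ^ n
n<m^n m zero 1<m = s≤s z≤n
n<m^n m (suc n) 1<m = ≤-trans (+-mono-≤ {1} {m ^ n} {suc n} {m ^ n} (≤-trans (s≤s z≤n) (n<m^n m n 1<m)) (n<m^n m n 1<m))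
  (subst (_≤ m * m ^ n) (cong (m ^ n +_) (+-identityʳ (m ^ n))) (*-monoˡ-≤ (m ^ n) 1<m))

topExponent : ℕ → ℕ → ℕ → ℕ
topExponent p m zero = 0
topExponent p m (suc k) = case p ^ suc k ≤? m of λ { (yes _) → suc k ; (no _) → topExponent p m k }

topExponent-≤ : ∀ p m k → 0 < m → p ^ topExponent p m k ≤ m
topExponent-≤ p m zero 0<m = 0<m
topExponent-≤ p m (suc k) 0<m with p ^ suc k ≤? m
... | yes le = le
... | no _ = topExponent-≤ p m k 0<m

topExponent-max : ∀ p m k f → f ≤ k → p ^ f ≤ m → f ≤ topExponent p m k
topExponent-max p m zero f f≤k le = f≤k
topExponent-max p m (suc k) f f≤k le with p ^ suc k ≤? m
... | yes _ = f≤k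
... | no nle = topExponent-max p m k f (≤-pred (≤∧≢⇒< f≤k λ { refl → nle le })) le

-- `∏ (factor m) j` is the least common multiple of those numbers up to m whose prime divisors are
-- at most j.
factor : ℕ → ℕ → ℕ
factor m i = case prime? i of λ { (yes _) → i ^ topExponent i m m ; (no _) → 1 }

primePart : ℕ → ℕ
primePart i = case prime? i of λ { (yes _) → i ; (no _) → 1 }

∏ : (ℕ → ℕ) → ℕ → ℕ
∏ f zero = 1
∏ f (suc j) = ∏ f j * f (suc j)

∏>0 : ∀ f → (∀ i → 0 < f i) → ∀ j → 0 < ∏ f j
∏>0 f h zero = s≤s z≤n
∏>0 f h (suc j) = *-mono-≤ {1} {∏ f j} {1} {f (suc j)} (∏>0 f h j) (h (suc j))

factor>0 : ∀ m i → 0 < factor m i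
factor>0 m i with prime? i
... | yes pr = m^n>0 i {{ℕ.>-nonZero (<-trans (s≤s z≤n) (prime>1 pr))}} (topExponent i m m)
... | no _ = s≤s z≤n

primePart>0 : ∀ i → 0 < primePart i
primePart>0 i with prime? i
... | yes pr = <-trans (s≤s z≤n) (prime>1 pr)
... | no _ = s≤s z≤n

valuation : ∀ k p a → 1 < p → 0 < a → a ≤ k → ∃ λ f → ∃ λ b → a ≡ p ^ f * b × ¬ p ∣ b
valuation zero p (suc _) 1<p 0<a ()
valuation (suc k) p a 1<p 0<a a≤k = case p ∣? a of λ
  { (no nd) → 0 , a , sym (*-identityˡ a) , nd
  ; (yes (divides b e)) →
      let 0<b = n≢0⇒n>0 λ { refl → <⇒≢ 0<a (sym e) }
          b<a = subst (b <_) (sym e) (m<m*n b p {{ℕ.>-nonZero 0<b}} 1<p)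
          (f , b′ , e′ , nd) = valuation k p b 1<p 0<b (≤-pred (≤-trans b<a a≤k))
      in suc f , b′ , trans e (trans (cong (_* p) e′) (regroup (p ^ f) b′ p)) , nd }
  where
  regroup : ∀ x y z → x * y * z ≡ z * x * y
  regroup = solve-∀

-- Split off the full power of the prime j + 1. It is at most m, so it divides `factor m (suc j)`,
-- and the cofactor has only smaller prime divisors.
smooth∣ : ∀ m j a → 0 < a → a ≤ m → (∀ p → Prime p → p ∣ a → p ≤ j) → a ∣ ∏ (factor m) j
smooth∣ m zero a 0<a a≤m h = case 1 <? a of λ
  { (yes lt) → let (p , pr , d) = prime-divisor a lt in ⊥-elim (<⇒≱ (<-trans (s≤s z≤n) (prime>1 pr)) (h p pr d))
  ; (no nlt) → subst (_∣ 1) (sym (≤-antisym (≮⇒≥ nlt) 0<a)) ∣-refl }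
smooth∣ m (suc j) a 0<a a≤m h with prime? (suc j)
... | no npr = ∣-trans (smooth∣ m j a 0<a a≤m λ p pr d → ≤-pred (≤∧≢⇒< (h p pr d) λ { refl → npr pr })) (m∣m*n 1)
... | yes pr =
  let (f , b , e , nd) = valuation a (suc j) a (prime>1 pr) 0<a ≤-refl
      0<b = n≢0⇒n>0 λ z → <⇒≢ 0<a (sym (trans e (trans (cong (suc j ^ f *_) z) (*-zeroʳ (suc j ^ f)))))
      b∣a = subst (b ∣_) (sym e) (n∣m*n (suc j ^ f))
      b≤m = ≤-trans (∣⇒≤ {{ℕ.>-nonZero 0<a}} b∣a) a≤m
      p^f≤m = ≤-trans (subst (suc j ^ f ≤_) (sym e) (m≤m*n (suc j ^ f) b {{ℕ.>-nonZero 0<b}})) a≤m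
      f≤ = topExponent-max (suc j) m m f (<⇒≤ (<-≤-trans (n<m^n (suc j) f (prime>1 pr)) p^f≤m)) p^f≤m
      b∣ = smooth∣ m j b 0<b b≤m λ p pp d → ≤-pred (≤∧≢⇒< (h p pp (∣-trans d b∣a)) λ { refl → nd d })
  in subst (_∣ _) (trans (*-comm b (suc j ^ f)) (sym e)) (*-pres-∣ b∣
       (subst (suc j ^ f ∣_) (trans (sym (^-distribˡ-+-* (suc j) f _)) (cong (suc j ^_) (m+[n∸m]≡n f≤)))
           (m∣m*n (suc j ^ (topExponent (suc j) m m ∸ f)))))

factor≤ : ∀ m i → 0 < m → factor m i ≤ m
factor≤ m i 0<m with prime? i
... | yes _ = topExponent-≤ i m m 0<m
... | no _ = 0<m

factor≤primePart : ∀ m i → 0 < m → m < i * i → factor m i ≤ primePart i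
factor≤primePart m i 0<m m<i² with prime? i
... | no _ = ≤-refl
... | yes pr = ≤-trans (^-monoʳ-≤ i {{i≢0}} {topExponent i m m} {1} (≮⇒≥ λ 1<e → <⇒≱ m<i² (≤-trans
    (subst (_≤ i ^ topExponent i m m) (cong (i *_) (*-identityʳ i)) (^-monoʳ-≤ i {{i≢0}} {2} {topExponent i m m} 1<e))
    (topExponent-≤ i m m 0<m))))
  (≤-reflexive (*-identityʳ i))
  where
  i≢0 : NonZero i
  i≢0 = prime⇒nonZero pr

-- Each of the first s factors is at most m. Beyond s the square of a prime exceeds m, so its
-- exponent is at most one.
smooth≤ : ∀ m s d → 0 < m → m ≤ s * s → ∏ (factor m) (s + d) ≤ m ^ s * ∏ primePart (s + d)
smooth≤ m s zero 0<m m≤s² = subst (λ t → ∏ (factor m) t ≤ m ^ s * ∏ primePart t) (sym (+-identityʳ s))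
  (≤-trans (initial s) (m≤m*n (m ^ s) (∏ primePart s) {{ℕ.>-nonZero (∏>0 primePart primePart>0 s)}}))
  where
  initial : ∀ j → ∏ (factor m) j ≤ m ^ j
  initial zero = ≤-refl
  initial (suc j) = ≤-trans (*-mono-≤ (initial j) (factor≤ m (suc j) 0<m)) (≤-reflexive (*-comm (m ^ j) m))
smooth≤ m s (suc d) 0<m m≤s² = subst (λ t → ∏ (factor m) t ≤ m ^ s * ∏ primePart t) (sym (+-suc s d))
  (≤-trans (*-mono-≤ (smooth≤ m s d 0<m m≤s²) (factor≤primePart m (suc (s + d)) 0<m
      (≤-<-trans m≤s² (*-mono-< (s≤s (m≤m+n s d)) (s≤s (m≤m+n s d))))))
    (≤-reflexive (*-assoc (m ^ s) (∏ primePart (s + d)) _)))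

prime∤! : ∀ {p} → Prime p → ∀ r → p ∣ r ! → p ≤ r
prime∤! pr zero d = ⊥-elim (<⇒≱ (prime>1 pr) (∣⇒≤ d))
prime∤! pr (suc r) d = case euclidsLemma (suc r) (r !) pr d of λ { (inj₁ d′) → ∣⇒≤ d′ ; (inj₂ d′) → ≤-trans (prime∤! pr r d′)
    (n≤1+n r) }

p∣n! : ∀ {p n} → 0 < p → p ≤ n → p ∣ n !
p∣n! {suc p} _ le = ∣-trans (m∣m*n (p !)) (m≤n⇒m!∣n! le)

-- A prime above r and at most 2r divides (2r)! but not r! · r!, so the product of these primes
-- divides the central binomial coefficient.
primorial-step : ∀ r → ∏ primePart (r + r) ≤ ∏ primePart r * binom r r
primorial-step r = subst (_≤ ∏ primePart r * binom r r) (sym (split r))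
  (*-monoʳ-≤ (∏ primePart r) (∣⇒≤ {{ℕ.>-nonZero (binom>0 r r)}} (divides-binom r ≤-refl)))
  where
  Q : ℕ → ℕ
  Q = ∏ (λ i → primePart (r + i))
  split : ∀ d → ∏ primePart (r + d) ≡ ∏ primePart r * Q d
  split zero = trans (cong (∏ primePart) (+-identityʳ r)) (sym (*-identityʳ _))
  split (suc d) = trans (cong (∏ primePart) (+-suc r d)) (trans (cong₂ _*_ (split d) (cong primePart (sym (+-suc r d))))
      (*-assoc (∏ primePart r) (Q d) _))
  bounded : ∀ {p} → Prime p → ∀ d → p ∣ Q d → p ≤ r + d
  bounded pr zero dv = ⊥-elim (<⇒≱ (prime>1 pr) (∣⇒≤ dv))
  bounded {p} pr (suc d) dv = case euclidsLemma (Q d) (primePart (r + suc d)) pr dv of λ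
    { (inj₁ d′) → ≤-trans (bounded pr d d′) (+-monoʳ-≤ r (n≤1+n d))
    ; (inj₂ d′) → last d′ }
    where
    last : p ∣ primePart (r + suc d) → p ≤ r + suc d
    last dv with prime? (r + suc d)
    ... | yes pr′ = ∣⇒≤ {{prime⇒nonZero pr′}} dv
    ... | no _ = ⊥-elim (<⇒≱ (prime>1 pr) (∣⇒≤ dv))
  divides-binom : ∀ d → d ≤ r → Q d ∣ binom r r
  divides-binom zero le = 1∣ binom r r
  divides-binom (suc d) le with prime? (r + suc d) | divides-binom d (≤-trans (n≤1+n d) le)
  ... | no _ | dv = subst (_∣ binom r r) (sym (*-identityʳ (Q d))) dv
  ... | yes pr | divides y e = case euclidsLemma y (Q d) pr (subst ((r + suc d) ∣_) e p∣binom) of λ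
      { (inj₂ d′) → ⊥-elim (<⇒≱ (≤-reflexive (sym (+-suc r d))) (bounded pr d d′))
      ; (inj₁ (divides x e′)) → divides x (trans e (trans (cong (_* Q d) e′) (regroup x (r + suc d) (Q d)))) }
    where
    regroup : ∀ x p q → x * p * q ≡ x * (q * p)
    regroup = solve-∀
    p>r : r < r + suc d
    p>r = m<m+n r (s≤s z≤n)
    p∣binom : (r + suc d) ∣ binom r r
    p∣binom = case euclidsLemma (binom r r) (r ! * r !) pr (subst ((r + suc d) ∣_) (sym (binom-! r r))
                (p∣n! (<-trans (s≤s z≤n) (prime>1 pr)) (+-monoʳ-≤ r le))) of λ
      { (inj₁ d′) → d′
      ; (inj₂ d′) → ⊥-elim (<⇒≱ p>r ([ prime∤! pr r , prime∤! pr r ]′ (euclidsLemma (r !) (r !) pr d′))) }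

-- Restriction to powers of two makes every induction step an exact doubling.
primorial≤ : ∀ j → ∏ primePart (2 ^ j) ≤ 2 ^ (2 * 2 ^ j)
primorial≤ zero = s≤s z≤n
primorial≤ (suc j) = subst (λ t → ∏ primePart t ≤ 2 ^ (2 * t)) (cong (2 ^ j +_) (sym (+-identityʳ (2 ^ j))))
  (≤-trans (primorial-step (2 ^ j)) (≤-trans (*-mono-≤ (primorial≤ j) (binom≤2^ (2 ^ j) (2 ^ j)))
    (≤-reflexive (trans (sym (^-distribˡ-+-* 2 (2 * 2 ^ j) (2 ^ j + 2 ^ j))) (cong (2 ^_) (double (2 ^ j)))))))
  where
  double : ∀ x → 2 * x + (x + x) ≡ 2 * (x + x)
  double = solve-∀

-- If there is no prime between n and m, the numbers up to m have a common multiple that is too small.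
prime-between : ∀ j s m r → s ≤ 2 ^ j → m ≤ s * s → suc (r + r) ≤ m → m ^ s * 2 ^ (2 * 2 ^ j) < 2 ^ r →
  ∃ λ p → Prime p × 2 ^ j < p × p ≤ m
prime-between j s m r s≤n m≤s² 2r<m small = case anyUpTo? (λ p → prime? p ×-dec (2 ^ j <? p)) (suc m) of λ
  { (yes (p , p≤m , pr , n<p)) → p , pr , n<p , ≤-pred p≤m
  ; (no none) → ⊥-elim (<⇒≱ small (≤-trans
      (common-multiple≥ r (∏ (factor m) (2 ^ j)) (∏>0 (factor m) (factor>0 m) (2 ^ j)) λ x 0<x x≤ →
        smooth∣ m (2 ^ j) x 0<x (≤-trans x≤ 2r<m) λ p pr d → ≮⇒≥ λ n<p →
          none (p , s≤s (≤-trans (∣⇒≤ {{ℕ.>-nonZero 0<x}} d) (≤-trans x≤ 2r<m)) , pr , n<p))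
      (≤-trans smooth (*-monoʳ-≤ (m ^ s) (primorial≤ j))))) }
  where
  smooth : ∏ (factor m) (2 ^ j) ≤ m ^ s * ∏ primePart (2 ^ j)
  smooth = subst (λ t → ∏ (factor m) t ≤ m ^ s * ∏ primePart t) (m+[n∸m]≡n s≤n)
    (smooth≤ m s (2 ^ j ∸ s) (≤-trans (s≤s z≤n) 2r<m) m≤s²)

-- With W = 2 ^ w, the three exponents are bounded by 2x, 2x and 8x - 1 for x = 16 W².
dense-primes : ∀ w → w + 4 ≤ 2 ^ w → ∃ λ p → Prime p × 2 ^ w * 16 * 2 ^ w < p × p ≤ (2 ^ w * 16) * (2 ^ w * 16)
dense-primes w w+4≤W = subst (λ y → ∃ λ p → Prime p × y < p × p ≤ (W * 16) * (W * 16)) n≡x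
  (prime-between j (W * 16) ((W * 16) * (W * 16)) (pred (8 * x)) s≤n ≤-refl 2r<m small)
  where
  W x j : ℕ
  W = 2 ^ w
  x = W * 16 * W
  j = w + 4 + w
  W>0 : 0 < W
  W>0 = m^n>0 2 w
  x>0 : 0 < x
  x>0 = *-mono-≤ {1} {W * 16} {1} {W} (*-mono-≤ {1} {W} {1} {16} W>0 (s≤s z≤n)) W>0
  n≡x : 2 ^ j ≡ x
  n≡x = trans (^-distribˡ-+-* 2 (w + 4) w) (cong (_* W) (^-distribˡ-+-* 2 w 4))
  s≤n : W * 16 ≤ 2 ^ j
  s≤n = subst (W * 16 ≤_) (sym n≡x) (m≤m*n (W * 16) W {{ℕ.>-nonZero W>0}})
  8x>0 : 0 < 8 * x
  8x>0 = *-mono-≤ {1} {8} {1} {x} (s≤s z≤n) x>0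
  m≡16x : (W * 16) * (W * 16) ≡ 8 * x + 8 * x
  m≡16x = expand W
    where
    expand : ∀ W → (W * 16) * (W * 16) ≡ 8 * (W * 16 * W) + 8 * (W * 16 * W)
    expand = solve-∀
  suc-pred-8x : suc (pred (8 * x)) ≡ 8 * x
  suc-pred-8x = suc-pred (8 * x) {{ℕ.>-nonZero 8x>0}}
  2r<m : suc (pred (8 * x) + pred (8 * x)) ≤ (W * 16) * (W * 16)
  2r<m = ≤-trans (+-mono-≤ {suc (pred (8 * x))} {8 * x} {pred (8 * x)} {8 * x} (≤-reflexive suc-pred-8x) (pred[n]≤n {8 * x}))
    (≤-reflexive (sym m≡16x))
  s-def : W * 16 ≡ 2 ^ (w + 4)
  s-def = sym (^-distribˡ-+-* 2 w 4)
  m-def : (W * 16) * (W * 16) ≡ 2 ^ ((w + 4) + (w + 4))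
  m-def = trans (cong₂ _*_ s-def s-def) (sym (^-distribˡ-+-* 2 (w + 4) (w + 4)))
  exponents : ((w + 4) + (w + 4)) * (W * 16) + 2 * 2 ^ j < pred (8 * x)
  exponents = ≤-pred (subst₂ _≤_ refl (sym suc-pred-8x) (begin
    suc (suc (((w + 4) + (w + 4)) * (W * 16) + 2 * 2 ^ j))   ≤⟨ s≤s (s≤s (+-mono-≤ (*-monoˡ-≤ (W * 16) (+-mono-≤ w+4≤W w+4≤W))
        (≤-reflexive (cong (2 *_) n≡x)))) ⟩
    2 + ((W + W) * (W * 16) + 2 * x)                         ≡⟨ cong (2 +_) (collect W) ⟩
    2 + 4 * x                                                ≤⟨ +-monoˡ-≤ (4 * x) (≤-trans (s≤s (s≤s z≤n)) (*-monoʳ-≤ 4 x>0)) ⟩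
    4 * x + 4 * x                                            ≡⟨ sym (*-distribʳ-+ x 4 4) ⟩
    8 * x                                                    ∎))
    where
    open ≤-Reasoning
    collect : ∀ W → (W + W) * (W * 16) + 2 * (W * 16 * W) ≡ 4 * (W * 16 * W)
    collect = solve-∀
  small : ((W * 16) * (W * 16)) ^ (W * 16) * 2 ^ (2 * 2 ^ j) < 2 ^ pred (8 * x)
  small = subst (_< 2 ^ pred (8 * x))
    (trans (^-distribˡ-+-* 2 (((w + 4) + (w + 4)) * (W * 16)) (2 * 2 ^ j))
      (cong (_* 2 ^ (2 * 2 ^ j)) (trans (sym (^-*-assoc 2 ((w + 4) + (w + 4)) (W * 16))) (cong (_^ (W * 16)) (sym m-def)))))
    (^-monoʳ-< 2 (s≤s (s≤s z≤n)) exponents)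

largest : ∀ (f : ℕ → ℕ) → (∀ w → w < f w) → ∀ n a → f a ≤ n → ∃ λ w → a ≤ w × f w ≤ n × n < f (suc w)
largest f grows n a fa≤n = go (n ∸ a) a ≤-refl (m∸n+n≡m (≤-trans (<⇒≤ (grows a)) fa≤n)) fa≤n
  where
  go : ∀ k w → a ≤ w → k + w ≡ n → f w ≤ n → ∃ λ w → a ≤ w × f w ≤ n × n < f (suc w)
  go zero w a≤w e fw≤n = ⊥-elim (<⇒≱ (grows w) (subst (f w ≤_) (sym e) fw≤n))
  go (suc k) w a≤w e fw≤n = case f (suc w) ≤? n of λ
    { (yes le) → go k (suc w) (≤-trans a≤w (n≤1+n w)) (trans (+-suc k w) e) le
    ; (no nle) → w , a≤w , fw≤n , ≰⇒> nle }

w+4≤2^w : ∀ v → 3 + v + 4 ≤ 2 ^ (3 + v)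
w+4≤2^w zero = n≤1+n 7
w+4≤2^w (suc v) = ≤-trans (+-mono-≤ {1} {2 ^ (3 + v)} {3 + v + 4} {2 ^ (3 + v)} (m^n>0 2 (3 + v)) (w+4≤2^w v))
  (≤-reflexive (cong (2 ^ (3 + v) +_) (sym (+-identityʳ (2 ^ (3 + v))))))

-- For W = 2 ^ w, `dense-primes` gives p ≤ 256 W², so the 4p² vertices of the graph fit into this
-- number.
scale : ℕ → ℕ
scale w = 4 * (((2 ^ w * 16) * (2 ^ w * 16)) * ((2 ^ w * 16) * (2 ^ w * 16)))

-- The constant 64: n lies below `scale (suc w)`, which is 4 (1024 W²)², while p exceeds 16 W².
suitable-prime : ∀ n → scale 3 ≤ n → ∃ λ p → Prime p × 2 < p × 4 * (p * p) ≤ n × n ≤ 4 * ((64 * p) * (64 * p))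
suitable-prime n le =
  let (w , 3≤w , lower , upper) = largest scale grows n 3 le
      (p , pr , big , small) = dense-primes w (subst (λ w → w + 4 ≤ 2 ^ w) (m+[n∸m]≡n 3≤w) (w+4≤2^w (w ∸ 3)))
      W>0 = m^n>0 2 w
  in p , pr , ≤-trans (s≤s (*-mono-≤ {2} {2 ^ w * 16} {1} {2 ^ w} (*-mono-≤ {1} {2 ^ w} {2} {16} W>0 (s≤s (s≤s z≤n))) W>0)) big ,
     ≤-trans (*-monoʳ-≤ 4 (*-mono-≤ small small)) lower ,
     <⇒≤ (<-≤-trans upper (*-monoʳ-≤ 4 (*-mono-≤ (step w (<⇒≤ big)) (step w (<⇒≤ big)))))
  where
  square≥ : ∀ x → 0 < x → x ≤ x * x
  square≥ x pos = m≤m*n x x {{ℕ.>-nonZero pos}}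
  grows : ∀ w → w < scale w
  grows w = <-≤-trans (n<m^n 2 w (s≤s (s≤s z≤n))) (≤-trans (m≤m*n W 16) (≤-trans (square≥ (W * 16) pos)
    (≤-trans (square≥ ((W * 16) * (W * 16)) (*-mono-≤ {1} {W * 16} {1} {W * 16} pos pos)) (m≤n*m _ 4))))
    where
    W : ℕ
    W = 2 ^ w
    pos : 0 < W * 16
    pos = *-mono-≤ {1} {W} {1} {16} (m^n>0 2 w) (s≤s z≤n)
  step : ∀ w {p} → 2 ^ w * 16 * 2 ^ w ≤ p → (2 ^ suc w * 16) * (2 ^ suc w * 16) ≤ 64 * p
  step w {p} le = ≤-trans (≤-reflexive (expand (2 ^ w))) (*-monoʳ-≤ 64 le)
    where
    expand : ∀ W → ((W + (W + 0)) * 16) * ((W + (W + 0)) * 16) ≡ 64 * (W * 16 * W)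
    expand = solve-∀

-- Lower bound for k = 2: a graph from the parabola

module Congruence (p : ℕ) .{{_ : NonZero p}} where

  infix 4 _≈_ _≈?_
  _≈_ : ℕ → ℕ → Set
  x ≈ y = x % p ≡ y % p

  _≈?_ : ∀ x y → Dec (x ≈ y)
  x ≈? y = x % p ℕ.≟ y % p

  ≈-+ : ∀ {x x′ y y′} → x ≈ x′ → y ≈ y′ → x + y ≈ x′ + y′
  ≈-+ {x} {x′} {y} {y′} e e′ = trans (%-distribˡ-+ x y p) (trans (cong₂ (λ a b → (a + b) % p) e e′) (sym (%-distribˡ-+ x′ y′ p)))

  -- Adding z (p - 1) completes z to a multiple of p.
  ≈-cancelʳ : ∀ x y z → x + z ≈ y + z → x ≈ y
  ≈-cancelʳ x y z e = trans (sym (fill x)) (trans (≈-+ {x + z} {y + z} {z * pred p} e refl) (fill y))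
    where
    fill : ∀ x → x + z + z * pred p ≈ x
    fill x = trans (cong (_% p) (trans (+-assoc x z (z * pred p)) (cong (x +_) (trans (sym (*-suc z (pred p)))
        (cong (z *_) (suc-pred p))))))
      ([m+kn]%n≡m%n x z p)

  ≈⇒≡ : ∀ {x y} → x < p → y < p → x ≈ y → x ≡ y
  ≈⇒≡ x<p y<p e = trans (sym (m<n⇒m%n≡m x<p)) (trans e (m<n⇒m%n≡m y<p))

  toℕ-≈ : ∀ {a b : Fin p} → toℕ a ≈ toℕ b → a ≡ b
  toℕ-≈ {a} {b} e = Finₚ.toℕ-injective (≈⇒≡ (Finₚ.toℕ<n a) (Finₚ.toℕ<n b) e)

  mod-≈ : ∀ x → toℕ (x mod p) ≈ x
  mod-≈ x = trans (cong (_% p) (Finₚ.toℕ-fromℕ< _)) (m%n%n≡m%n x p)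

  ≈⇒ℤ : ∀ x y → x ≈ y → ∃ λ k → ι x ≡ ι y ⊕ k ⊗ ι p
  ≈⇒ℤ x y e = ι (x / p) ⊖ ι (y / p) , (begin
    ι x                                        ≡⟨ cong ι (m≡m%n+[m/n]*n x p) ⟩
    ι (x % p + x / p * p)                      ≡⟨ homo (x % p) (x / p) ⟩
    ι (x % p) ⊕ ι (x / p) ⊗ ι p        ≡⟨ cong (λ r → ι r ⊕ ι (x / p) ⊗ ι p) e ⟩
    ι (y % p) ⊕ ι (x / p) ⊗ ι p        ≡⟨ shuffle (ι (y % p)) (ι (x / p)) (ι (y / p)) (ι p) ⟩
    (ι (y % p) ⊕ ι (y / p) ⊗ ι p) ⊕ (ι (x / p) ⊖ ι (y / p)) ⊗ ι p ≡⟨ cong (λ t → t ⊕ (ι (x / p) ⊖ ι (y / p)) ⊗ ι p)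
        (trans (sym (homo (y % p) (y / p))) (cong ι (sym (m≡m%n+[m/n]*n y p)))) ⟩
    ι y ⊕ (ι (x / p) ⊖ ι (y / p)) ⊗ ι p ∎)
    where
    open ≡-Reasoning
    homo : ∀ r q → ι (r + q * p) ≡ ι r ⊕ ι q ⊗ ι p
    homo r q = trans (ℤₚ.pos-+ r (q * p)) (cong (λ t → (ι r) ⊕ t) (ℤₚ.pos-* q p))
    shuffle : ∀ r x y p → r ⊕ x ⊗ p ≡ (r ⊕ y ⊗ p) ⊕ (x ⊖ y) ⊗ p
    shuffle = ℤ-Solver.solve-∀

-- Elements of Z/p are determined by their sum and the sum of their squares, up to order.
module Sidon (p : ℕ) (pr : Prime p) (2<p : 2 < p) where

  private
    equal : ∀ x y → x < p → y < p → p ∣ ∣ ι x ⊖ ι y ∣ → x ≡ y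
    equal x y x<p y<p d = case ∣ ι x ⊖ ι y ∣ ℕ.≟ 0 of λ
      { (yes e) → ℤₚ.+-injective (ℤₚ.i-j≡0⇒i≡j (ι x) (ι y) (ℤₚ.∣i∣≡0⇒i≡0 e))
      ; (no ne) → ⊥-elim (<⇒≱ small (∣⇒≤ {{ℕ.≢-nonZero ne}} d)) }
      where
      small : ∣ ι x ⊖ ι y ∣ < p
      small = subst (_< p) (cong ∣_∣ (sym (ℤₚ.m-n≡m⊖n x y))) (≤-<-trans (ℤₚ.∣m⊝n∣≤m⊔n x y) (⊔-pres-<m x<p y<p))

  sidon : ∀ {x y z w} → x < p → y < p → z < p → ∀ K K′ →
    ι w ≡ ι y ⊕ ι z ⊖ ι x ⊕ K ⊗ ι p →
    ι w ⊗ ι w ≡ ι y ⊗ ι y ⊕ ι z ⊗ ι z ⊖ ι x ⊗ ι x ⊕ K′ ⊗ ι p →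
    x ≡ y ⊎ x ≡ z
  sidon {x} {y} {z} {w} x<p y<p z<p K K′ e e′ =
    case euclidsLemma (2 * ∣ X ⊖ Y ∣) ∣ X ⊖ Z ∣ pr (divides ∣ M ∣ abs-eq) of λ
      { (inj₂ d) → inj₂ (equal x z x<p z<p d)
      ; (inj₁ d) → case euclidsLemma 2 ∣ X ⊖ Y ∣ pr d of λ
        { (inj₁ d′) → ⊥-elim (<⇒≱ 2<p (∣⇒≤ d′))
        ; (inj₂ d′) → inj₁ (equal x y x<p y<p d′) } }
    where
    X Y Z P M : ℤ
    X = ι x
    Y = ι y
    Z = ι z
    P = ι p
    M = K′ ⊖ (ι 2 ⊗ (Y ⊕ Z ⊖ X) ⊗ K ⊕ K ⊗ K ⊗ P)
    -- The identity (Y + Z - X)² - (Y² + Z² - X²) = 2 (X - Y)(X - Z), with the multiples of P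
    -- collected in M. As p is an odd prime, it divides X - Y or X - Z.
    complete : ∀ X Y Z P K K′ → (Y ⊕ Z ⊖ X ⊕ K ⊗ P) ⊗ (Y ⊕ Z ⊖ X ⊕ K ⊗ P) ≡ Y ⊗ Y ⊕ Z ⊗ Z ⊖ X ⊗ X ⊕ K′ ⊗ P →
      ι 2 ⊗ (X ⊖ Y) ⊗ (X ⊖ Z) ≡ (K′ ⊖ (ι 2 ⊗ (Y ⊕ Z ⊖ X) ⊗ K ⊕ K ⊗ K ⊗ P)) ⊗ P
    complete X Y Z P K K′ h = trans (lhs X Y Z P K) (trans (cong (_⊖ (Y ⊗ Y ⊕ Z ⊗ Z ⊖ X ⊗ X ⊕ (ι 2 ⊗ (Y ⊕ Z ⊖ X) ⊗ K ⊕ K ⊗ K ⊗ P) ⊗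
        P)) h) (rhs X Y Z P K K′))
      where
      lhs : ∀ X Y Z P K → ι 2 ⊗ (X ⊖ Y) ⊗ (X ⊖ Z) ≡ (Y ⊕ Z ⊖ X ⊕ K ⊗ P) ⊗ (Y ⊕ Z ⊖ X ⊕ K ⊗ P)
        ⊖ (Y ⊗ Y ⊕ Z ⊗ Z ⊖ X ⊗ X ⊕ (ι 2 ⊗ (Y ⊕ Z ⊖ X) ⊗ K ⊕ K ⊗ K ⊗ P) ⊗ P)
      lhs = ℤ-Solver.solve-∀
      rhs : ∀ X Y Z P K K′ → (Y ⊗ Y ⊕ Z ⊗ Z ⊖ X ⊗ X ⊕ K′ ⊗ P)
        ⊖ (Y ⊗ Y ⊕ Z ⊗ Z ⊖ X ⊗ X ⊕ (ι 2 ⊗ (Y ⊕ Z ⊖ X) ⊗ K ⊕ K ⊗ K ⊗ P) ⊗ P)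
        ≡ (K′ ⊖ (ι 2 ⊗ (Y ⊕ Z ⊖ X) ⊗ K ⊕ K ⊗ K ⊗ P)) ⊗ P
      rhs = ℤ-Solver.solve-∀
    product-eq : ι 2 ⊗ (X ⊖ Y) ⊗ (X ⊖ Z) ≡ M ⊗ P
    product-eq = complete X Y Z P K K′ (subst (λ t → t ⊗ t ≡ Y ⊗ Y ⊕ Z ⊗ Z ⊖ X ⊗ X ⊕ K′ ⊗ P) e e′)
    abs-eq : 2 * ∣ X ⊖ Y ∣ * ∣ X ⊖ Z ∣ ≡ ∣ M ∣ * p
    abs-eq = trans (cong (_* ∣ X ⊖ Z ∣) (sym (ℤₚ.abs-* (ι 2) (X ⊖ Y))))
      (trans (sym (ℤₚ.abs-* (ι 2 ⊗ (X ⊖ Y)) (X ⊖ Z))) (trans (cong ∣_∣ product-eq) (ℤₚ.abs-* M P)))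

-- Vertices (side, bit, a, b) with a, b in Z/p.  Equal bits: an edge of colour x < h joins (a, b) to (x - a, x² - b).
-- Different bits: an edge of colour x ≥ h joins (a, b) on side 0 to (a + x, b + x²) on side 1.
module FourCycleGraph (p h : ℕ) .{{_ : NonZero p}} (pr : Prime p) (2<p : 2 < p) where

  open Congruence p
  open Sidon p pr 2<p

  W : Set
  W = Fin 2 × Fin 2 × Fin p × Fin p

  Same Different : Fin p → Fin p → Fin p → Fin p → ℕ → Set
  Same a b a′ b′ x = x < h × toℕ a + toℕ a′ ≈ x × toℕ b + toℕ b′ ≈ x * x
  Different a b a′ b′ x = h ≤ x × toℕ a + x ≈ toℕ a′ × toℕ b + x * x ≈ toℕ b′

  Arc : W → W → ℕ → Set
  Arc (i , β , a , b) (j , β′ , a′ , b′) x = (i ≡ zero × j ≡ suc zero) ×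
    ((β ≡ β′ × Same a b a′ b′ x) ⊎ (β ≢ β′ × Different a b a′ b′ x))

  arc? : ∀ u v x → Dec (Arc u v x)
  arc? (i , β , a , b) (j , β′ , a′ , b′) x = ((i Finₚ.≟ zero) ×-dec (j Finₚ.≟ suc zero)) ×-dec
    (((β Finₚ.≟ β′) ×-dec ((x <? h) ×-dec (_ ≈? _) ×-dec (_ ≈? _))) ⊎-dec
     (¬? (β Finₚ.≟ β′) ×-dec ((h ≤? x) ×-dec (_ ≈? _) ×-dec (_ ≈? _))))

  Linked : W → W → ℕ → Set
  Linked u v x = Arc u v x ⊎ Arc v u x

  linked? : ∀ u v (x : Fin p) → Dec (Linked u v (toℕ x))
  linked? u v x = arc? u v (toℕ x) ⊎-dec arc? v u (toℕ x)

  linked-sym : ∀ {u v x} → Linked u v x → Linked v u x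
  linked-sym (inj₁ a) = inj₂ a
  linked-sym (inj₂ a) = inj₁ a

  arc-colour : ∀ u v {x y} → x < p → y < p → Arc u v x → Arc u v y → x ≡ y
  arc-colour u v x<p y<p (_ , inj₁ (_ , _ , e , _)) (_ , inj₁ (_ , _ , e′ , _)) = ≈⇒≡ x<p y<p (trans (sym e) e′)
  arc-colour u v _ _ (_ , inj₁ (e , _)) (_ , inj₂ (ne , _)) = ⊥-elim (ne e)
  arc-colour u v _ _ (_ , inj₂ (ne , _)) (_ , inj₁ (e , _)) = ⊥-elim (ne e)
  arc-colour (_ , _ , a , _) v {x} {y} x<p y<p (_ , inj₂ (_ , _ , e , _)) (_ , inj₂ (_ , _ , e′ , _)) =
    ≈⇒≡ x<p y<p (≈-cancelʳ x y (toℕ a) (trans (cong (_% p) (+-comm x (toℕ a)))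
        (trans e (trans (sym e′) (cong (_% p) (+-comm (toℕ a) y))))))

  no-reverse : ∀ u v w {x y} → Arc u v x → Arc w u y → ⊥
  no-reverse u v w ((refl , _) , _) ((_ , ()) , _)

  linked-colour : ∀ u v {x y} → x < p → y < p → Linked u v x → Linked u v y → x ≡ y
  linked-colour u v x<p y<p (inj₁ a) (inj₁ a′) = arc-colour u v x<p y<p a a′
  linked-colour u v x<p y<p (inj₂ a) (inj₂ a′) = arc-colour v u x<p y<p a a′
  linked-colour u v _ _ (inj₁ a) (inj₂ a′) = ⊥-elim (no-reverse u v v a a′)
  linked-colour u v _ _ (inj₂ a) (inj₁ a′) = ⊥-elim (no-reverse u v v a′ a)

  two-valued : ∀ {α β γ : Fin 2} → α ≢ β → α ≢ γ → β ≡ γ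
  two-valued {zero} {zero} ne _ = ⊥-elim (ne refl)
  two-valued {zero} {suc zero} {zero} _ ne = ⊥-elim (ne refl)
  two-valued {zero} {suc zero} {suc zero} _ _ = refl
  two-valued {suc zero} {suc zero} ne _ = ⊥-elim (ne refl)
  two-valued {suc zero} {zero} {suc zero} _ ne = ⊥-elim (ne refl)
  two-valued {suc zero} {zero} {zero} _ _ = refl

  private
    swap+ : ∀ {x y z} → x + y ≈ z → y + x ≈ z
    swap+ {x} {y} = trans (cong (_% p) (+-comm y x))

    vertex : ∀ {i j β γ : Fin 2} {a b a′ b′ : Fin p} → i ≡ j → β ≡ γ → toℕ a ≈ toℕ a′ → toℕ b ≈ toℕ b′ →
      (i , β , a , b) ≡ (j , γ , a′ , b′)
    vertex refl refl e e′ = cong₂ (λ a b → _ , _ , a , b) (toℕ-≈ e) (toℕ-≈ e′)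

  arc-target : ∀ u v w {x} → Arc u v x → Arc u w x → v ≡ w
  arc-target (_ , _ , a , b) (_ , _ , a′ , b′) (_ , _ , a″ , b″) ((_ , s) , inj₁ (β , _ , e , f)) ((_ , s′) , inj₁
      (β′ , _ , e′ , f′)) =
    vertex (trans s (sym s′)) (trans (sym β) β′)
      (≈-cancelʳ (toℕ a′) (toℕ a″) (toℕ a) (swap+ {toℕ a} (trans e (sym (swap+ {toℕ a} e′)))))
      (≈-cancelʳ (toℕ b′) (toℕ b″) (toℕ b) (swap+ {toℕ b} (trans f (sym (swap+ {toℕ b} f′)))))
  arc-target u v w (_ , inj₁ (_ , x<h , _)) (_ , inj₂ (_ , h≤x , _)) = ⊥-elim (<⇒≱ x<h h≤x)
  arc-target u v w (_ , inj₂ (_ , h≤x , _)) (_ , inj₁ (_ , x<h , _)) = ⊥-elim (<⇒≱ x<h h≤x)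
  arc-target u v w ((_ , s) , inj₂ (β , _ , e , f)) ((_ , s′) , inj₂ (β′ , _ , e′ , f′)) =
    vertex (trans s (sym s′)) (two-valued β β′) (trans (sym e) e′) (trans (sym f) f′)

  arc-source : ∀ u v w {x} → Arc v u x → Arc w u x → v ≡ w
  arc-source (_ , _ , a , b) (_ , _ , a′ , b′) (_ , _ , a″ , b″) ((s , _) , inj₁ (β , _ , e , f)) ((s′ , _) , inj₁
      (β′ , _ , e′ , f′)) =
    vertex (trans s (sym s′)) (trans β (sym β′))
      (≈-cancelʳ (toℕ a′) (toℕ a″) (toℕ a) (trans e (sym e′))) (≈-cancelʳ (toℕ b′) (toℕ b″) (toℕ b) (trans f (sym f′)))
  arc-source u v w (_ , inj₁ (_ , x<h , _)) (_ , inj₂ (_ , h≤x , _)) = ⊥-elim (<⇒≱ x<h h≤x)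
  arc-source u v w (_ , inj₂ (_ , h≤x , _)) (_ , inj₁ (_ , x<h , _)) = ⊥-elim (<⇒≱ x<h h≤x)
  arc-source u (_ , _ , a′ , b′) (_ , _ , a″ , b″) {x} ((s , _) , inj₂ (β , _ , e , f)) ((s′ , _) , inj₂ (β′ , _ , e′ , f′)) =
    vertex (trans s (sym s′)) (two-valued (β ∘ sym) (β′ ∘ sym))
      (≈-cancelʳ (toℕ a′) (toℕ a″) x (trans e (sym e′))) (≈-cancelʳ (toℕ b′) (toℕ b″) (x * x) (trans f (sym f′)))

  linked-proper : ∀ u v w {x} → Linked u v x → Linked u w x → v ≡ w
  linked-proper u v w (inj₁ a) (inj₁ a′) = arc-target u v w a a′
  linked-proper u v w (inj₂ a) (inj₂ a′) = arc-source u v w a a′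
  linked-proper u v w (inj₁ a) (inj₂ a′) = ⊥-elim (no-reverse u v w a a′)
  linked-proper u v w (inj₂ a) (inj₁ a′) = ⊥-elim (no-reverse u w v a′ a)

  -- With signs ε = ±1 given by the bits, both kinds of arcs satisfy ε a + ε′ a′ = ε′ x and ε b + ε′ b′ = ε′ x².
  sign : Fin 2 → ℤ → ℤ
  sign zero z = z
  sign (suc zero) z = ⊝ z

  Signed : Fin 2 → Fin 2 → ℕ → ℕ → ℕ → Set
  Signed β β′ a a′ x = ∃ λ k → sign β (ι a) ⊕ sign β′ (ι a′) ≡ sign β′ (ι x) ⊕ k ⊗ ι p

  same-signed : ∀ β a a′ x → a + a′ ≈ x → Signed β β a a′ x
  same-signed β a a′ x e with ≈⇒ℤ (a + a′) x e
  same-signed zero a a′ x e | k , eq = k , trans (sym (ℤₚ.pos-+ a a′)) eq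
  same-signed (suc zero) a a′ x e | k , eq = ⊝ k ,
    trans (sym (ℤₚ.neg-distrib-+ (ι a) (ι a′))) (trans (cong ⊝_ (trans (sym (ℤₚ.pos-+ a a′)) eq)) (negate (ι x) k (ι p)))
    where
    negate : ∀ x k p → ⊝ (x ⊕ k ⊗ p) ≡ ⊝ x ⊕ (⊝ k) ⊗ p
    negate = ℤ-Solver.solve-∀

  different-signed : ∀ β β′ a a′ x → β ≢ β′ → a + x ≈ a′ → Signed β β′ a a′ x
  different-signed β β′ a a′ x ne e with ≈⇒ℤ (a + x) a′ e
  different-signed zero zero a a′ x ne e | _ = ⊥-elim (ne refl)
  different-signed (suc zero) (suc zero) a a′ x ne e | _ = ⊥-elim (ne refl)
  different-signed zero (suc zero) a a′ x ne e | k , eq = k ,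
    solveFor (ι a) (ι a′) (ι x) k (ι p) (trans (sym (ℤₚ.pos-+ a x)) eq)
    where
    solveFor : ∀ a a′ x k p → a ⊕ x ≡ a′ ⊕ k ⊗ p → a ⊕ ⊝ a′ ≡ ⊝ x ⊕ k ⊗ p
    solveFor a a′ x k p h = trans (l a a′ x) (trans (cong (λ t → t ⊖ x ⊖ a′) h) (r a′ x k p))
      where
      l : ∀ a a′ x → a ⊕ ⊝ a′ ≡ (a ⊕ x) ⊖ x ⊖ a′
      l = ℤ-Solver.solve-∀
      r : ∀ a′ x k p → (a′ ⊕ k ⊗ p) ⊖ x ⊖ a′ ≡ ⊝ x ⊕ k ⊗ p
      r = ℤ-Solver.solve-∀
  different-signed (suc zero) zero a a′ x ne e | k , eq = ⊝ k ,
    solveFor (ι a) (ι a′) (ι x) k (ι p) (trans (sym (ℤₚ.pos-+ a x)) eq)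
    where
    solveFor : ∀ a a′ x k p → a ⊕ x ≡ a′ ⊕ k ⊗ p → ⊝ a ⊕ a′ ≡ x ⊕ (⊝ k) ⊗ p
    solveFor a a′ x k p h = trans (l a a′ x k p) (trans (cong (λ t → t ⊖ a ⊖ k ⊗ p) (sym h)) (r a x k p))
      where
      l : ∀ a a′ x k p → ⊝ a ⊕ a′ ≡ (a′ ⊕ k ⊗ p) ⊖ a ⊖ k ⊗ p
      l = ℤ-Solver.solve-∀
      r : ∀ a x k p → (a ⊕ x) ⊖ a ⊖ k ⊗ p ≡ x ⊕ (⊝ k) ⊗ p
      r = ℤ-Solver.solve-∀

  bit : W → Fin 2
  bit (_ , β , _) = β

  arc-signed : ∀ u v {x} → Arc u v x →
    Signed (bit u) (bit v) (toℕ (proj₁ (proj₂ (proj₂ u)))) (toℕ (proj₁ (proj₂ (proj₂ v)))) x ×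
    Signed (bit u) (bit v) (toℕ (proj₂ (proj₂ (proj₂ u)))) (toℕ (proj₂ (proj₂ (proj₂ v)))) (x * x)
  arc-signed (_ , β , a , b) (_ , .β , a′ , b′) {x} (_ , inj₁ (refl , _ , e , f)) = same-signed β (toℕ a) (toℕ a′) x e ,
      same-signed β (toℕ b) (toℕ b′) (x * x) f
  arc-signed (_ , β , a , b) (_ , β′ , a′ , b′) {x} (_ , inj₂ (ne , _ , e , f)) = different-signed β β′ (toℕ a) (toℕ a′) x ne e ,
      different-signed β β′ (toℕ b) (toℕ b′) (x * x) ne f

  -- In the alternating sum of the four edge equations the vertices cancel and a relation between
  -- the colours remains.
  around : ∀ {β₁ β₂ γ₁ γ₂ a₁ a₂ c₁ c₂ x1₁ x2₁ x2₂ x1₂} →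
    Signed β₁ γ₁ a₁ c₁ x1₁ → Signed β₂ γ₁ a₂ c₁ x2₁ → Signed β₂ γ₂ a₂ c₂ x2₂ → Signed β₁ γ₂ a₁ c₂ x1₂ →
    ∃ λ K → sign γ₁ (ι x1₁) ⊕ sign γ₂ (ι x2₂) ≡ sign γ₁ (ι x2₁) ⊕ sign γ₂ (ι x1₂) ⊕ K ⊗ ι p
  around {β₁} {β₂} {γ₁} {γ₂} {a₁} {a₂} {c₁} {c₂} {x1₁} {x2₁} {x2₂} {x1₂} (k₁₁ , e₁₁) (k₂₁ , e₂₁) (k₂₂ , e₂₂) (k₁₂ , e₁₂) =
    k₂₁ ⊕ k₁₂ ⊖ k₁₁ ⊖ k₂₂ ,
    addUp (sign β₁ (ι a₁)) (sign β₂ (ι a₂)) (sign γ₁ (ι c₁)) (sign γ₂ (ι c₂))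
      (sign γ₁ (ι x1₁)) (sign γ₁ (ι x2₁)) (sign γ₂ (ι x2₂)) (sign γ₂ (ι x1₂)) k₁₁ k₂₁ k₂₂ k₁₂ (ι p) e₁₁ e₂₁ e₂₂ e₁₂
    where
    addUp : ∀ A₁ A₂ C₁ C₂ X₁₁ X₂₁ X₂₂ X₁₂ k₁₁ k₂₁ k₂₂ k₁₂ P → A₁ ⊕ C₁ ≡ X₁₁ ⊕ k₁₁ ⊗ P → A₂ ⊕ C₁ ≡ X₂₁ ⊕ k₂₁ ⊗ P →
      A₂ ⊕ C₂ ≡ X₂₂ ⊕ k₂₂ ⊗ P → A₁ ⊕ C₂ ≡ X₁₂ ⊕ k₁₂ ⊗ P → X₁₁ ⊕ X₂₂ ≡ X₂₁ ⊕ X₁₂ ⊕ (k₂₁ ⊕ k₁₂ ⊖ k₁₁ ⊖ k₂₂) ⊗ P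
    addUp A₁ A₂ C₁ C₂ X₁₁ X₂₁ X₂₂ X₁₂ k₁₁ k₂₁ k₂₂ k₁₂ P e₁₁ e₂₁ e₂₂ e₁₂ =
      trans (l X₁₁ X₂₂ k₁₁ k₂₂ P) (trans (cong (λ t → t ⊖ (k₁₁ ⊕ k₂₂) ⊗ P)
        (trans (cong₂ _⊕_ (sym e₁₁) (sym e₂₂)) (trans (m A₁ A₂ C₁ C₂) (cong₂ _⊕_ e₂₁ e₁₂))))
        (r X₂₁ X₁₂ k₁₁ k₂₁ k₂₂ k₁₂ P))
      where
      l : ∀ X Y k k′ P → X ⊕ Y ≡ (X ⊕ k ⊗ P ⊕ (Y ⊕ k′ ⊗ P)) ⊖ (k ⊕ k′) ⊗ P
      l = ℤ-Solver.solve-∀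
      m : ∀ A B C D → A ⊕ C ⊕ (B ⊕ D) ≡ B ⊕ C ⊕ (A ⊕ D)
      m = ℤ-Solver.solve-∀
      r : ∀ X Y a b c d P → (X ⊕ b ⊗ P ⊕ (Y ⊕ d ⊗ P)) ⊖ (a ⊕ c) ⊗ P ≡ X ⊕ Y ⊕ (b ⊕ d ⊖ a ⊖ c) ⊗ P
      r = ℤ-Solver.solve-∀

  -- The relation pairs X₁₁ with X₂₂ if the signs agree and with X₁₂ if they differ. Solving for the
  -- partner gives the form that `sidon` takes.
  isolate : ∀ γ₁ γ₂ X₁₁ X₂₁ X₂₂ X₁₂ K P → sign γ₁ X₁₁ ⊕ sign γ₂ X₂₂ ≡ sign γ₁ X₂₁ ⊕ sign γ₂ X₁₂ ⊕ K ⊗ P →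
    (γ₁ ≡ γ₂ × X₂₂ ≡ X₂₁ ⊕ X₁₂ ⊖ X₁₁ ⊕ sign γ₁ K ⊗ P) ⊎
    (γ₁ ≢ γ₂ × X₁₂ ≡ X₂₁ ⊕ X₂₂ ⊖ X₁₁ ⊕ sign γ₁ K ⊗ P)
  isolate zero zero A B C D K P h = inj₁ (refl , trans (l A C) (trans (cong (_⊖ A) h) (r A B D K P)))
    where
    l : ∀ A C → C ≡ A ⊕ C ⊖ A
    l = ℤ-Solver.solve-∀
    r : ∀ A B D K P → B ⊕ D ⊕ K ⊗ P ⊖ A ≡ B ⊕ D ⊖ A ⊕ K ⊗ P
    r = ℤ-Solver.solve-∀
  isolate (suc zero) (suc zero) A B C D K P h = inj₁ (refl , trans (l A C) (trans (cong (λ t → ⊝ t ⊖ A) h) (r A B D K P)))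
    where
    l : ∀ A C → C ≡ ⊝ (⊝ A ⊕ ⊝ C) ⊖ A
    l = ℤ-Solver.solve-∀
    r : ∀ A B D K P → ⊝ (⊝ B ⊕ ⊝ D ⊕ K ⊗ P) ⊖ A ≡ B ⊕ D ⊖ A ⊕ (⊝ K) ⊗ P
    r = ℤ-Solver.solve-∀
  isolate zero (suc zero) A B C D K P h = inj₂ ((λ ()) , trans (l B D K P) (trans (cong (λ t → B ⊕ K ⊗ P ⊖ t) (sym h))
      (r A B C K P)))
    where
    l : ∀ B D K P → D ≡ B ⊕ K ⊗ P ⊖ (B ⊕ ⊝ D ⊕ K ⊗ P)
    l = ℤ-Solver.solve-∀
    r : ∀ A B C K P → B ⊕ K ⊗ P ⊖ (A ⊕ ⊝ C) ≡ B ⊕ C ⊖ A ⊕ K ⊗ P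
    r = ℤ-Solver.solve-∀
  isolate (suc zero) zero A B C D K P h = inj₂ ((λ ()) , trans (l B D K P) (trans (cong (λ t → t ⊕ B ⊖ K ⊗ P) (sym h))
      (r A B C K P)))
    where
    l : ∀ B D K P → D ≡ ⊝ B ⊕ D ⊕ K ⊗ P ⊕ B ⊖ K ⊗ P
    l = ℤ-Solver.solve-∀
    r : ∀ A B C K P → ⊝ A ⊕ C ⊕ B ⊖ K ⊗ P ≡ B ⊕ C ⊖ A ⊕ (⊝ K) ⊗ P
    r = ℤ-Solver.solve-∀

  -- The first coordinates give the relation for the colours, the second ones the same relation for
  -- their squares; the Sidon property then forces a repetition.
  four-cycle-colours : ∀ u₁ u₂ v₁ v₂ {x1₁ x2₁ x2₂ x1₂} → x1₁ < p → x2₁ < p → x2₂ < p → x1₂ < p →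
    Arc u₁ v₁ x1₁ → Arc u₂ v₁ x2₁ → Arc u₂ v₂ x2₂ → Arc u₁ v₂ x1₂ → x1₁ ≡ x2₁ ⊎ x1₁ ≡ x1₂ ⊎ x1₁ ≡ x2₂
  four-cycle-colours u₁ u₂ v₁ v₂ {x1₁} {x2₁} {x2₂} {x1₂} l₁₁ l₂₁ l₂₂ l₁₂ a₁₁ a₂₁ a₂₂ a₁₂ =
    let (s₁₁ , t₁₁) = arc-signed u₁ v₁ a₁₁
        (s₂₁ , t₂₁) = arc-signed u₂ v₁ a₂₁
        (s₂₂ , t₂₂) = arc-signed u₂ v₂ a₂₂
        (s₁₂ , t₁₂) = arc-signed u₁ v₂ a₁₂
        (K , e) = around {bit u₁} {bit u₂} {bit v₁} {bit v₂} {x1₁ = x1₁} {x2₁} {x2₂} {x1₂} s₁₁ s₂₁ s₂₂ s₁₂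
        (K′ , e′) = around {bit u₁} {bit u₂} {bit v₁} {bit v₂} {x1₁ = x1₁ * x1₁} {x2₁ * x2₁} {x2₂ * x2₂} {x1₂ * x1₂} t₁₁ t₂₁ t₂₂ t₁₂
    in conclude (sign (bit v₁) K) (sign (bit v₁) K′)
         (isolate (bit v₁) (bit v₂) (ι x1₁) (ι x2₁) (ι x2₂) (ι x1₂) K (ι p) e)
         (isolate (bit v₁) (bit v₂) (ι (x1₁ * x1₁)) (ι (x2₁ * x2₁)) (ι (x2₂ * x2₂)) (ι (x1₂ * x1₂)) K′ (ι p) e′)
    where
    Sol : ℕ → ℕ → ℕ → ℕ → ℤ → Set
    Sol x y z w K = ι w ≡ ι y ⊕ ι z ⊖ ι x ⊕ K ⊗ ι p
    squares : ∀ x y z w K → Sol (x * x) (y * y) (z * z) (w * w) K →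
      ι w ⊗ ι w ≡ ι y ⊗ ι y ⊕ ι z ⊗ ι z ⊖ ι x ⊗ ι x ⊕ K ⊗ ι p
    squares x y z w K h = trans (sym (ℤₚ.pos-* w w)) (trans h (cong (λ t → t ⊕ K ⊗ ι p)
      (cong₂ (λ s t → s ⊖ t) (cong₂ _⊕_ (ℤₚ.pos-* y y) (ℤₚ.pos-* z z)) (ℤₚ.pos-* x x))))
    conclude : ∀ K K′ →
      (bit v₁ ≡ bit v₂ × Sol x1₁ x2₁ x1₂ x2₂ K) ⊎ (bit v₁ ≢ bit v₂ × Sol x1₁ x2₁ x2₂ x1₂ K) →
      (bit v₁ ≡ bit v₂ × Sol (x1₁ * x1₁) (x2₁ * x2₁) (x1₂ * x1₂) (x2₂ * x2₂) K′) ⊎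
      (bit v₁ ≢ bit v₂ × Sol (x1₁ * x1₁) (x2₁ * x2₁) (x2₂ * x2₂) (x1₂ * x1₂) K′) →
      x1₁ ≡ x2₁ ⊎ x1₁ ≡ x1₂ ⊎ x1₁ ≡ x2₂
    conclude K K′ (inj₁ (_ , h)) (inj₁ (_ , h′)) =
      [ inj₁ , inj₂ ∘ inj₁ ]′ (sidon {w = x2₂} l₁₁ l₂₁ l₁₂ K K′ h (squares x1₁ x2₁ x1₂ x2₂ K′ h′))
    conclude K K′ (inj₂ (_ , h)) (inj₂ (_ , h′)) =
      [ inj₁ , inj₂ ∘ inj₂ ]′ (sidon {w = x1₂} l₁₁ l₂₁ l₂₂ K K′ h (squares x1₁ x2₁ x2₂ x1₂ K′ h′))
    conclude K K′ (inj₁ (e , _)) (inj₂ (ne , _)) = ⊥-elim (ne e)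
    conclude K K′ (inj₂ (ne , _)) (inj₁ (e , _)) = ⊥-elim (ne e)

-- The colouring on n vertices and its four-cycles

length-cartesianProduct : {A B : Set} (xs : List A) (ys : List B) → length (cartesianProduct xs ys) ≡ length xs * length ys
length-cartesianProduct [] ys = refl
length-cartesianProduct (x ∷ xs) ys = trans (length-++ (map (x ,_) ys))
  (cong₂ _+_ (length-map (x ,_) ys) (length-cartesianProduct xs ys))

module _ {k₁ k₂ k₃ k₄ : ℕ} where

  combine₄ : Fin k₁ × Fin k₂ × Fin k₃ × Fin k₄ → Fin (k₁ * (k₂ * (k₃ * k₄)))
  combine₄ (i , j , k , l) = combine i (combine j (combine k l))

  split₃ : Fin (k₂ * (k₃ * k₄)) → Fin k₂ × Fin k₃ × Fin k₄
  split₃ m = Product.map₂ (remQuot k₄) (remQuot (k₃ * k₄) m)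

  split₄ : Fin (k₁ * (k₂ * (k₃ * k₄))) → Fin k₁ × Fin k₂ × Fin k₃ × Fin k₄
  split₄ m = Product.map₂ split₃ (remQuot (k₂ * (k₃ * k₄)) m)

  split₄-combine₄ : ∀ w → split₄ (combine₄ w) ≡ w
  split₄-combine₄ (i , j , k , l) = trans (cong (Product.map₂ split₃) (Finₚ.remQuot-combine i (combine j (combine k l))))
      (cong (i ,_)
    (trans (cong (Product.map₂ (remQuot k₄)) (Finₚ.remQuot-combine j (combine k l))) (cong (j ,_) (Finₚ.remQuot-combine k l))))

  combine₄-split₄ : ∀ m → combine₄ (split₄ m) ≡ m
  combine₄-split₄ m = trans (cong (combine (proj₁ (remQuot {k₁} (k₂ * (k₃ * k₄)) m)))
      (trans (cong (combine (proj₁ (remQuot {k₂} (k₃ * k₄) r))) (Finₚ.combine-remQuot {k₃} k₄ (proj₂ (remQuot {k₂} (k₃ * k₄) r))))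
        (Finₚ.combine-remQuot {k₂} (k₃ * k₄) r)))
    (Finₚ.combine-remQuot {k₁} (k₂ * (k₃ * k₄)) m)
    where
    r : Fin (k₂ * (k₃ * k₄))
    r = proj₂ (remQuot {k₁} (k₂ * (k₃ * k₄)) m)

module FourCycleColouring (p h : ℕ) .{{_ : NonZero p}} (pr : Prime p) (2<p : 2 < p) (h+h≤p : h + h ≤ p)
  (n : ℕ) (room : 2 * (2 * (p * p)) ≤ n) where

  open Congruence p
  open FourCycleGraph p h pr 2<p

  colour : W → W → Maybe ℕ
  colour u v = case Finₚ.any? (linked? u v) of λ { (yes (x , _)) → just (toℕ x) ; (no _) → nothing }

  colour-linked : ∀ {u v a} → colour u v ≡ just a → ∃ λ (x : Fin p) → toℕ x ≡ a × Linked u v (toℕ x)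
  colour-linked {u} {v} eq with Finₚ.any? (linked? u v) | eq
  ... | yes (x , lk) | refl = x , refl , lk
  ... | no _ | ()

  linked⇒colour : ∀ u v (x : Fin p) → Linked u v (toℕ x) → colour u v ≡ just (toℕ x)
  linked⇒colour u v x lk with Finₚ.any? (linked? u v)
  ... | yes (y , lk′) = cong just (linked-colour u v (Finₚ.toℕ<n y) (Finₚ.toℕ<n x) lk′ lk)
  ... | no none = ⊥-elim (none (x , lk))

  colour-sym : ∀ u v → colour u v ≡ colour v u
  colour-sym u v with Finₚ.any? (linked? u v)
  ... | yes (x , lk) = sym (linked⇒colour v u x (linked-sym {u} {v} lk))
  ... | no none with Finₚ.any? (linked? v u)
  ...   | yes (x , lk) = ⊥-elim (none (x , linked-sym {v} {u} lk))
  ...   | no _ = refl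

  colour-irrefl : ∀ u → colour u u ≡ nothing
  colour-irrefl u with Finₚ.any? (linked? u u)
  ... | yes (x , inj₁ a) = ⊥-elim (no-reverse u u u a a)
  ... | yes (x , inj₂ a) = ⊥-elim (no-reverse u u u a a)
  ... | no _ = refl

  M : ℕ
  M = 2 * (2 * (p * p))

  encode : W → Fin M
  encode = combine₄

  decode : Fin M → W
  decode = split₄

  decode-encode : ∀ w → decode (encode w) ≡ w
  decode-encode = split₄-combine₄

  encode-decode : ∀ m → encode (decode m) ≡ m
  encode-decode = combine₄-split₄ {2} {2} {p} {p}

  V : Set
  V = Fin n

  embed : W → V
  embed w = inject≤ (encode w) room

  back : V → Maybe W
  back v = case toℕ v <? M of λ { (yes lt) → just (decode (fromℕ< lt)) ; (no _) → nothing }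

  back-embed : ∀ w → back (embed w) ≡ just w
  back-embed w with toℕ (embed w) <? M
  ... | yes lt = cong just (trans (cong decode (Finₚ.toℕ-injective (trans (Finₚ.toℕ-fromℕ< lt) (Finₚ.toℕ-inject≤
      (encode w) room)))) (decode-encode w))
  ... | no nlt = ⊥-elim (nlt (subst (_< M) (sym (Finₚ.toℕ-inject≤ (encode w) room)) (Finₚ.toℕ<n (encode w))))

  back-just : ∀ v {w} → back v ≡ just w → embed w ≡ v
  back-just v eq with toℕ v <? M | eq
  ... | yes lt | refl = Finₚ.toℕ-injective (trans (Finₚ.toℕ-inject≤ _ room) (trans (cong toℕ (encode-decode (fromℕ< lt)))
      (Finₚ.toℕ-fromℕ< lt)))
  ... | no _ | ()

  embed-injective : ∀ {u v} → embed u ≡ embed v → u ≡ v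
  embed-injective {u} {v} e = Maybeₚ.just-injective (trans (sym (back-embed u)) (trans (cong back e) (back-embed v)))

  lift : Maybe W → Maybe W → Maybe ℕ
  lift (just u) (just v) = colour u v
  lift (just _) nothing = nothing
  lift nothing _ = nothing

  c : Colouring n
  c u v = lift (back u) (back v)

  lift-just : ∀ u v {a} → lift u v ≡ just a → ∃ λ u′ → ∃ λ v′ → u ≡ just u′ × v ≡ just v′ × colour u′ v′ ≡ just a
  lift-just (just u) (just v) e = u , v , refl , refl , e

  c-proper : ProperColouring c
  c-proper = (λ u v → symm (back u) (back v)) , (λ u → irrefl (back u)) , unique
    where
    symm : ∀ u v → lift u v ≡ lift v u
    symm (just u) (just v) = colour-sym u v
    symm (just _) nothing = refl
    symm nothing (just _) = refl
    symm nothing nothing = refl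
    irrefl : ∀ u → lift u u ≡ nothing
    irrefl (just u) = colour-irrefl u
    irrefl nothing = refl
    unique : ∀ u v w a → c u v ≡ just a → c u w ≡ just a → v ≡ w
    unique u v w a e₁ e₂ =
      let (u₁ , v₁ , bu , bv , col₁) = lift-just (back u) (back v) e₁
          (u₂ , w₂ , bu′ , bw , col₂) = lift-just (back u) (back w) e₂
          (x , xa , lk) = colour-linked {u₁} {v₁} col₁
          (y , ya , lk′) = colour-linked {u₂} {w₂} col₂
          same = linked-proper u₁ v₁ w₂ {a} (subst (Linked u₁ v₁) xa lk)
                   (subst (λ u → Linked u w₂ a) (Maybeₚ.just-injective (trans (sym bu′) bu)) (subst (Linked u₂ w₂) ya lk′))
      in trans (sym (back-just v bv)) (trans (cong embed same) (back-just w bw))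

  edge : ∀ {u v} → Adj c u v → ∃ λ u′ → ∃ λ v′ → ∃ λ (x : Fin p) → back u ≡ just u′ × back v ≡ just v′ × Linked u′ v′ (toℕ x)
      × c u v ≡ just (toℕ x)
  edge {u} {v} adj with c u v in eq
  ... | just a = let (u′ , v′ , bu , bv , col) = lift-just (back u) (back v) eq
                     (x , xa , lk) = colour-linked {u′} {v′} col
                 in u′ , v′ , x , bu , bv , lk , cong just (sym xa)

  forward : ∀ u v w {x y} → Arc u v x → Linked v w y → Arc w v y
  forward u v w a (inj₁ b) = ⊥-elim (no-reverse v w u b a)
  forward u v w a (inj₂ b) = b

  backward : ∀ u v w {x y} → Arc v u x → Linked v w y → Arc v w y
  backward u v w a (inj₁ b) = b
  backward u v w a (inj₂ b) = ⊥-elim (no-reverse v u w a b)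

  -- Arcs lead from side 0 to side 1, so the first one decides the direction of the others; the two
  -- cases differ in the side of w₀.
  cycle-colours : ∀ w₀ w₁ w₂ w₃ (x0 x1 x2 x3 : Fin p) → Linked w₀ w₁ (toℕ x0) → Linked w₁ w₂ (toℕ x1) → Linked w₂ w₃ (toℕ x2) →
      Linked w₃ w₀ (toℕ x3) →
    toℕ x0 ≡ toℕ x1 ⊎ toℕ x0 ≡ toℕ x2 ⊎ toℕ x0 ≡ toℕ x3
  cycle-colours w₀ w₁ w₂ w₃ x0 x1 x2 x3 (inj₁ a₀) l₁ l₂ l₃ =
    let a₁ = forward w₀ w₁ w₂ a₀ l₁
        a₂ = backward w₁ w₂ w₃ a₁ l₂
        a₃ = forward w₂ w₃ w₀ a₂ l₃
    in [ inj₁ , [ inj₂ ∘ inj₂ , inj₂ ∘ inj₁ ]′ ]′ (four-cycle-colours w₀ w₂ w₁ w₃ (Finₚ.toℕ<n x0) (Finₚ.toℕ<n x1) (Finₚ.toℕ<n x2)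
            (Finₚ.toℕ<n x3) a₀ a₁ a₂ a₃)
  cycle-colours w₀ w₁ w₂ w₃ x0 x1 x2 x3 (inj₂ a₀) l₁ l₂ l₃ =
    let a₁ = backward w₀ w₁ w₂ a₀ l₁
        a₂ = forward w₁ w₂ w₃ a₁ l₂
        a₃ = backward w₂ w₃ w₀ a₂ l₃
    in [ inj₂ ∘ inj₂ , [ inj₁ , inj₂ ∘ inj₁ ]′ ]′ (four-cycle-colours w₁ w₃ w₀ w₂ (Finₚ.toℕ<n x0) (Finₚ.toℕ<n x3) (Finₚ.toℕ<n x2)
            (Finₚ.toℕ<n x1) a₀ a₃ a₂ a₁)

  no-rainbow : ¬ HasRainbowCycle c 3
  no-rainbow (f , (_ , adj) , rainbow) =
    let (w₀ , w₁ , x0 , b₀ , b₁ , l₀ , c₀) = edge (adj 0F)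
        (w₁′ , w₂ , x1 , b₁′ , b₂ , l₁ , c₁) = edge (adj 1F)
        (w₂′ , w₃ , x2 , b₂′ , b₃ , l₂ , c₂) = edge (adj 2F)
        (w₃′ , w₀′ , x3 , b₃′ , b₀′ , l₃ , c₃) = edge (adj 3F)
    in clash c₀ c₁ c₂ c₃ (cycle-colours w₀ w₁ w₂ w₃ x0 x1 x2 x3 l₀
         (subst (λ w → Linked w w₂ (toℕ x1)) (agree b₁′ b₁) l₁)
         (subst (λ w → Linked w w₃ (toℕ x2)) (agree b₂′ b₂) l₂)
         (subst₂ (λ w w′ → Linked w w′ (toℕ x3)) (agree b₃′ b₃) (agree b₀′ b₀) l₃))
    where
    agree : ∀ {v w w′} → back v ≡ just w → back v ≡ just w′ → w ≡ w′
    agree e e′ = Maybeₚ.just-injective (trans (sym e) e′)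
    clash : ∀ {x0 x1 x2 x3} → c (f 0F) (f 1F) ≡ just x0 → c (f 1F) (f 2F) ≡ just x1 → c (f 2F) (f 3F) ≡ just x2 → c (f 3F) (f 0F)
        ≡ just x3 →
      x0 ≡ x1 ⊎ x0 ≡ x2 ⊎ x0 ≡ x3 → ⊥
    clash c₀ c₁ c₂ c₃ (inj₁ refl) = case rainbow 0F 1F (trans c₀ (sym c₁)) of λ ()
    clash c₀ c₁ c₂ c₃ (inj₂ (inj₁ refl)) = case rainbow 0F 2F (trans c₀ (sym c₂)) of λ ()
    clash c₀ c₁ c₂ c₃ (inj₂ (inj₂ refl)) = case rainbow 0F 3F (trans c₀ (sym c₃)) of λ ()

  Parameters : Set
  Parameters = Fin p × Fin p × Fin h × Fin h

  private
    minus : ℕ → Fin p → Fin p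
    minus y a = (y + (p ∸ toℕ a)) mod p

    plus : Fin p → ℕ → Fin p
    plus a y = (toℕ a + y) mod p

    minus-≈ : ∀ y a → toℕ a + toℕ (minus y a) ≈ y
    minus-≈ y a = trans (≈-+ {toℕ a} {toℕ a} refl (mod-≈ (y + (p ∸ toℕ a))))
      (trans (cong (_% p) (trans (regroup (toℕ a) y (p ∸ toℕ a)) (cong (y +_) (m+[n∸m]≡n (<⇒≤ (Finₚ.toℕ<n a))))))
        (DivMod.[m+n]%n≡m%n y p))
      where
      regroup : ∀ a y r → a + (y + r) ≡ y + (a + r)
      regroup = solve-∀

    swap≈ : ∀ x y {z} → x + y ≈ z → y + x ≈ z
    swap≈ x y = trans (cong (_% p) (+-comm y x))

    minus-plus : ∀ y t a → toℕ (minus y (plus a t)) + t ≈ toℕ (minus y a)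
    minus-plus y t a = ≈-cancelʳ (toℕ (minus y (plus a t)) + t) (toℕ (minus y a)) (toℕ a)
      (trans (cong (_% p) (regroup (toℕ (minus y (plus a t))) t (toℕ a)))
      (trans (≈-+ {toℕ (minus y (plus a t))} refl (sym (mod-≈ (toℕ a + t))))
      (trans (swap≈ (toℕ (plus a t)) (toℕ (minus y (plus a t))) (minus-≈ y (plus a t))) (sym (swap≈ (toℕ a) (toℕ (minus y a))
          (minus-≈ y a))))))
      where
      regroup : ∀ m t a → m + t + a ≡ m + (a + t)
      regroup = solve-∀

  -- With y = h + t these four-cycles have the colours s, y, s, y. The four parameters are free,
  -- which gives p² h² cycles.
  corner : Parameters → Fin 4 → W
  corner (a , b , s , t) 0F = 0F , 0F , a , b
  corner (a , b , s , t) 1F = 1F , 0F , minus (toℕ s) a , minus (toℕ s * toℕ s) b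
  corner (a , b , s , t) 2F = 0F , 1F , minus (toℕ s) (plus a (h + toℕ t)) , minus (toℕ s * toℕ s)
      (plus b ((h + toℕ t) * (h + toℕ t)))
  corner (a , b , s , t) 3F = 1F , 1F , plus a (h + toℕ t) , plus b ((h + toℕ t) * (h + toℕ t))

  square : Parameters → Vec V 4
  square q = Vec.tabulate (embed ∘ corner q)

  lookup-square : ∀ q i → Vec.lookup (square q) i ≡ embed (corner q i)
  lookup-square q i = Vecₚ.lookup∘tabulate (embed ∘ corner q) i

  large< : ∀ (t : Fin h) → h + toℕ t < p
  large< t = <-≤-trans (+-monoʳ-< h (Finₚ.toℕ<n t)) h+h≤p

  small< : ∀ (s : Fin h) → toℕ s < p
  small< s = <-≤-trans (Finₚ.toℕ<n s) (≤-trans (m≤m+n h h) h+h≤p)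

  square-linked : ∀ q i → ∃ λ x → x < p × Linked (corner q i) (corner q (cyc i)) x
  square-linked (a , b , s , t) 0F = toℕ s , small< s , inj₁ ((refl , refl) , inj₁ (refl , Finₚ.toℕ<n s , minus-≈ (toℕ s) a ,
      minus-≈ (toℕ s * toℕ s) b))
  square-linked (a , b , s , t) 1F = h + toℕ t , large< t , inj₂ ((refl , refl) , inj₂ ((λ ()) , m≤m+n h (toℕ t) , minus-plus
      (toℕ s) (h + toℕ t) a , minus-plus (toℕ s * toℕ s) ((h + toℕ t) * (h + toℕ t)) b))
  square-linked (a , b , s , t) 2F = toℕ s , small< s , inj₁ ((refl , refl) , inj₁ (refl , Finₚ.toℕ<n s ,
    swap≈ (toℕ (plus a (h + toℕ t))) _ (minus-≈ (toℕ s) (plus a (h + toℕ t))) , swap≈ (toℕ (plus b ((h + toℕ t) * (h + toℕ t)))) _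
        (minus-≈ (toℕ s * toℕ s) (plus b ((h + toℕ t) * (h + toℕ t))))))
  square-linked (a , b , s , t) 3F = h + toℕ t , large< t , inj₂ ((refl , refl) , inj₂ ((λ ()) , m≤m+n h (toℕ t) , sym
      (mod-≈ (toℕ a + (h + toℕ t))) , sym (mod-≈ (toℕ b + (h + toℕ t) * (h + toℕ t)))))

  linked-adj : ∀ u v {x} → x < p → Linked u v x → Adj c (embed u) (embed v)
  linked-adj u v {x} x<p lk = subst (T ∘ is-just) (sym (trans (cong₂ lift (back-embed u) (back-embed v))
    (linked⇒colour u v (fromℕ< x<p) (subst (Linked u v) (sym (Finₚ.toℕ-fromℕ< x<p)) lk)))) tt

  square-cycle : ∀ q → IsCycle c 3 (Vec.lookup (square q))
  square-cycle q = (λ i j e → kinds-injective i j (trans (sym (kind-corner i)) (trans (cong kind (embed-injective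
      (trans (sym (lookup-square q i)) (trans e (lookup-square q j))))) (kind-corner j)))) ,
    λ i → let (x , x<p , lk) = square-linked q i
          in subst₂ (Adj c) (sym (lookup-square q i)) (sym (lookup-square q (cyc i))) (linked-adj (corner q i)
                  (corner q (cyc i)) x<p lk)
    where
    kind : W → Fin 2 × Fin 2
    kind (i , β , _) = i , β
    kinds : Fin 4 → Fin 2 × Fin 2
    kinds 0F = 0F , 0F
    kinds 1F = 1F , 0F
    kinds 2F = 0F , 1F
    kinds 3F = 1F , 1F
    kind-corner : ∀ i → kind (corner q i) ≡ kinds i
    kind-corner 0F = refl
    kind-corner 1F = refl
    kind-corner 2F = refl
    kind-corner 3F = refl
    kinds-injective : ∀ i j → kinds i ≡ kinds j → i ≡ j
    kinds-injective = from-yes (Finₚ.all? λ i → Finₚ.all? λ j → ≡-dec Finₚ._≟_ Finₚ._≟_ (kinds i) (kinds j) →-dec (i Finₚ.≟ j))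

  square-injective : ∀ {q q′} → square q ≡ square q′ → q ≡ q′
  square-injective {a , b , s , t} {a′ , b′ , s′ , t′} e = finish (at 0F) (at 1F) (at 3F)
    where
    at : ∀ i → corner (a , b , s , t) i ≡ corner (a′ , b′ , s′ , t′) i
    at i = embed-injective (trans (sym (lookup-square _ i)) (trans (cong (λ v → Vec.lookup v i) e) (lookup-square _ i)))
    finish : corner (a , b , s , t) 0F ≡ corner (a′ , b′ , s′ , t′) 0F → corner (a , b , s , t) 1F ≡ corner (a′ , b′ , s′ , t′) 1F →
      corner (a , b , s , t) 3F ≡ corner (a′ , b′ , s′ , t′) 3F → (a , b , s , t) ≡ (a′ , b′ , s′ , t′)
    finish refl e₁ e₃ = cong₂ (λ s t → a , b , s , t)
      (Finₚ.toℕ-injective (≈⇒≡ (small< s) (small< s′) (trans (sym (minus-≈ (toℕ s) a))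
        (trans (cong (λ w → (toℕ a + toℕ (proj₁ (proj₂ (proj₂ w)))) % p) e₁) (minus-≈ (toℕ s′) a)))))
      (Finₚ.toℕ-injective (+-cancelˡ-≡ h (toℕ t) (toℕ t′) (≈⇒≡ (large< t) (large< t′)
        (≈-cancelʳ (h + toℕ t) (h + toℕ t′) (toℕ a) (trans (cong (_% p) (+-comm (h + toℕ t) (toℕ a)))
          (trans (sym (mod-≈ (toℕ a + (h + toℕ t)))) (trans (cong (λ w → toℕ (proj₁ (proj₂ (proj₂ w))) % p) e₃)
            (trans (mod-≈ (toℕ a + (h + toℕ t′))) (cong (_% p) (+-comm (toℕ a) (h + toℕ t′)))))))))))

  parameters : List Parameters
  parameters = cartesianProduct (allFin p) (cartesianProduct (allFin p) (cartesianProduct (allFin h) (allFin h)))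

  many-squares : p * (p * (h * h)) ≤ numCycleEmbeddings c 3
  many-squares = subst (_≤ numCycleEmbeddings c 3) count
    (embeddings≥ c 3 (map square parameters) (Uniqueₚ.map⁺ square-injective
      (Uniqueₚ.cartesianProduct⁺ (Uniqueₚ.allFin⁺ p) (Uniqueₚ.cartesianProduct⁺ (Uniqueₚ.allFin⁺ p) (Uniqueₚ.cartesianProduct⁺
          (Uniqueₚ.allFin⁺ h) (Uniqueₚ.allFin⁺ h)))))
      λ m → case ∈-map⁻ square m of λ { (q , _ , refl) → square-cycle q })
    where
    fins : ∀ k → length (allFin k) ≡ k
    fins k = length-tabulate id
    count : length (map square parameters) ≡ p * (p * (h * h))
    count = trans (length-map square parameters) (trans (length-cartesianProduct (allFin p) _) (cong₂ _*_ (fins p)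
      (trans (length-cartesianProduct (allFin p) _) (cong₂ _*_ (fins p)
        (trans (length-cartesianProduct (allFin h) (allFin h)) (cong₂ _*_ (fins h) (fins h)))))))

opaque
  -- The square of 4 · 64² comes from n ≤ 4 (64p)², the 9 from p ≤ 3h, and 2 · (2 · 4) from
  -- `copies≥`.
  density : ℕ
  density = (4 * (64 * 64)) * (4 * (64 * 64)) * (9 * (2 * (2 * 4)))

  density-def : density ≡ (4 * (64 * 64)) * (4 * (64 * 64)) * (9 * (2 * (2 * 4)))
  density-def = refl

lower-bound₄ : ∀ n → scale 3 ≤ n → Σ (Colouring n) λ c → ProperColouring c × ¬ HasRainbowCycle c 3 ×
  n ^ 2 ≤ density * copiesOfCycle c 3
lower-bound₄ n le = let (p , pr , 2<p , small , big) = suitable-prime n le in construct p pr 2<p small big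
  where
  construct : ∀ p → Prime p → 2 < p → 4 * (p * p) ≤ n → n ≤ 4 * ((64 * p) * (64 * p)) →
    Σ (Colouring n) λ c → ProperColouring c × ¬ HasRainbowCycle c 3 × n ^ 2 ≤ density * copiesOfCycle c 3
  construct p pr 2<p small big = c , c-proper , no-rainbow , (begin
    n ^ 2                                                       ≤⟨ ^-monoˡ-≤ 2 big ⟩
    (4 * ((64 * p) * (64 * p))) ^ 2                             ≡⟨ collect 4 64 p ⟩
    (4 * (64 * 64)) * (4 * (64 * 64)) * (p * p * (p * p))       ≤⟨ *-monoʳ-≤ ((4 * (64 * 64)) * (4 * (64 * 64))) (begin
      p * p * (p * p)                   ≤⟨ *-monoʳ-≤ (p * p) (*-mono-≤ p≤3h p≤3h) ⟩
      p * p * (3 * h * (3 * h))         ≡⟨ nine p h ⟩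
      9 * (p * (p * (h * h)))           ≤⟨ *-monoʳ-≤ 9 (copies≥ c 3 (p * (p * (h * h))) many-squares eight≤) ⟩
      9 * (2 * (2 * 4) * copiesOfCycle c 3)  ∎) ⟩
    (4 * (64 * 64)) * (4 * (64 * 64)) * (9 * (2 * (2 * 4) * copiesOfCycle c 3))  ≡⟨ assoc ((4 * (64 * 64)) * (4 * (64 * 64))) 9
        (2 * (2 * 4)) (copiesOfCycle c 3) ⟩
    (4 * (64 * 64)) * (4 * (64 * 64)) * (9 * (2 * (2 * 4))) * copiesOfCycle c 3  ≡⟨ cong (_* copiesOfCycle c 3) (sym density-def) ⟩
    density * copiesOfCycle c 3                                                  ∎)
    where
    open ≤-Reasoning
    instance
      p≢0 : NonZero p
      p≢0 = prime⇒nonZero pr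
    h : ℕ
    h = p / 2
    h*2≤p : h * 2 ≤ p
    h*2≤p = DivMod.m/n*n≤m p 2
    h>0 : 0 < h
    h>0 = DivMod.m≥n⇒m/n>0 (<⇒≤ 2<p)
    p≤3h : p ≤ 3 * h
    p≤3h = ≤-trans (≤-reflexive (m≡m%n+[m/n]*n p 2)) (≤-trans (+-monoˡ-≤ (h * 2) (≤-trans (≤-pred (m%n<n p 2)) h>0))
        (≤-reflexive (three h)))
      where
      three : ∀ h → h + h * 2 ≡ 3 * h
      three = solve-∀
    double : ∀ h → h + h ≡ h * 2
    double = solve-∀
    four : ∀ x → 2 * (2 * x) ≡ 4 * x
    four = solve-∀
    open FourCycleColouring p h pr 2<p (≤-trans (≤-reflexive (double h)) h*2≤p) n (≤-trans (≤-reflexive (four (p * p))) small)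
    eight≤ : 2 * 4 ≤ p * (p * (h * h))
    eight≤ = ≤-trans (n≤1+n 8) (≤-trans (*-mono-≤ 2<p (*-mono-≤ 2<p (*-mono-≤ h>0 h>0))) ≤-refl)
    collect : ∀ d x p → d * ((x * p) * (x * p)) * (d * ((x * p) * (x * p)) * 1) ≡ (d * (x * x)) * (d * (x * x)) * (p * p * (p * p))
    collect = solve-∀
    nine : ∀ p h → p * p * (3 * h * (3 * h)) ≡ 9 * (p * (p * (h * h)))
    nine = solve-∀
    assoc : ∀ a b d x → a * (b * (d * x)) ≡ a * (b * d) * x
    assoc = solve-∀

theta : ∀ q → ExCycleTheta (5 + q * 2) (2 + q)
theta q = let (C , up) = upper-bound q
              (a , n₀ , low) = lower-bound q
          in C , a , n₀ , (λ n _ → up n) , low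

theta₄ : ExCycleTheta 3 2
theta₄ = 9 , density , scale 3 , (λ n _ → upper-bound₄ n) , lower-bound₄

theorem2p2 : (k : ℕ) → 2 ≤ k →
    (3 ≤ k → ExCycleTheta (2 * k ∸ 1) (k ∸ 1)) × (k ≡ 2 → ExCycleTheta (2 * k ∸ 1) 2)
theorem2p2 k _ = three≤ k , λ { refl → theta₄ }
  where
  three≤ : ∀ k → 3 ≤ k → ExCycleTheta (2 * k ∸ 1) (k ∸ 1)
  three≤ (suc (suc (suc q))) (s≤s (s≤s (s≤s z≤n))) = subst (λ l → ExCycleTheta l (2 + q)) (length-eq q) (theta q)
    where
    length-eq : ∀ q → 5 + q * 2 ≡ 2 * (3 + q) ∸ 1
    length-eq q = cong (_∸ 1) (expand q)
      where
      expand : ∀ q → 6 + q * 2 ≡ 2 * (3 + q)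
      expand = solve-∀
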